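{- Let $n$ be a positive odd integer and $d\geq3$ an integer with $n\equiv 1\pmod d$. For integers $k\geq0$ define $$c_q(k)=(-1)^k\frac{(1+q^{2dk+1})(q^2;q^{2d})^3_k}{(1+q)(q^{2d};q^{2d})^3_k}q^{dk^2+2k(d-1)}.$$ Then, modulo $\Phi_n(-q)^3\Phi_n(q)^2$, $$\sum_{\substack{i,j,s\geq0\\ i+j+s\leq n-1}}c_q(i)c_q(j)c_q(s)\equiv(-1)^{\frac{3(n-1)}{d}}[n]^3_{q^2}q^{\frac{3(n-1)(n+1-d)}{d}}\bigg(\sum_{k=0}^{\frac{n-1}{d}}\frac{(q^2;q^{2d})^2_k(q^d;q^{2d})_k\, q^{2(d-1)k}}{(q^{d+1},q^{2d},q^{2d+1};q^{2d})_k}\bigg)^3.$$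
   Context: Here $q$ is an indeterminate. The $q$-shifted factorial is $(a;q)_0=1$, $(a;q)_m=(1-a)(1-aq)\cdots(1-aq^{m-1})$ for $m\geq1$, and $(a_1,\dots,a_s;q)_m=(a_1;q)_m\cdots(a_s;q)_m$. $[m]_{q^2}=1+q^2+\cdots+q^{2(m-1)}$. $\Phi_n(q)$ denotes the $n$-th cyclotomic polynomial in $q$. A congruence between rational functions in $q$ modulo a polynomial $P(q)$ means that the numerator of the difference (in reduced form) is divisible by $P(q)$ while its denominator is coprime to $P(q)$. -}

module Defs where

open import Data.Nat as ℕ using (ℕ; zero; suc; _∸_)
open import Data.Integer as ℤ using (ℤ; 0ℤ; 1ℤ; -1ℤ)
open import Data.List using (List; []; _∷_; replicate; _++_)
open import Data.Product using (_×_; _,_; ∃-syntax)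
open import Data.Bool using (if_then_else_)
open import Relation.Binary.PropositionalEquality using (_≡_; _≢_)
open import Relation.Nullary using (does)
open import Data.Nat.Divisibility using (_∣?_)

-- Polynomials in q with integer coefficients (little-endian lists)

Poly : Set
Poly = List ℤ

coeff : Poly → ℕ → ℤ
coeff []      _       = 0ℤ
coeff (a ∷ p) zero    = a
coeff (a ∷ p) (suc i) = coeff p i

infix 4 _≈_
_≈_ : Poly → Poly → Set
p ≈ r = ∀ i → coeff p i ≡ coeff r i

infixl 6 _⊕_ _⊖_
infixl 7 _⊗_ _·_
infixr 8 _^P_

_⊕_ : Poly → Poly → Poly
[]      ⊕ r       = r
(a ∷ p) ⊕ []      = a ∷ p
(a ∷ p) ⊕ (b ∷ r) = (a ℤ.+ b) ∷ (p ⊕ r)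

_·_ : ℤ → Poly → Poly
c · []      = []
c · (a ∷ p) = (c ℤ.* a) ∷ (c · p)

⊝_ : Poly → Poly
⊝ p = -1ℤ · p

_⊖_ : Poly → Poly → Poly
p ⊖ r = p ⊕ (⊝ r)

_⊗_ : Poly → Poly → Poly
[]      ⊗ r = []
(a ∷ p) ⊗ r = (a · r) ⊕ (0ℤ ∷ (p ⊗ r))

const : ℤ → Poly
const c = c ∷ []

oneP : Poly
oneP = const 1ℤ

X^ : ℕ → Poly
X^ k = replicate k 0ℤ ++ (1ℤ ∷ [])

_^P_ : Poly → ℕ → Poly
p ^P zero  = oneP
p ^P suc k = p ⊗ (p ^P k)

-- substitution q ↦ -q :  p(q) = a + q r(q)  ⇒  p(-q) = a - q r(-q)
negArg : Poly → Poly
negArg []      = []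
negArg (a ∷ p) = a ∷ (⊝ negArg p)

signPow : ℕ → ℤ
signPow zero    = 1ℤ
signPow (suc k) = ℤ.- signPow k

qPoch : ℕ → ℕ → ℕ → Poly
qPoch a b zero    = oneP
qPoch a b (suc k) = qPoch a b k ⊗ (oneP ⊖ X^ (a ℕ.+ b ℕ.* k))

qint2 : ℕ → Poly
qint2 zero    = []
qint2 (suc m) = qint2 m ⊕ X^ (2 ℕ.* m)

divProd : (ℕ → Poly) → ℕ → ℕ → Poly
divProd Φ m zero    = oneP
divProd Φ m (suc e) =
  if does (suc e ∣? m) then Φ (suc e) ⊗ divProd Φ m e else divProd Φ m e

IsCyclotomic : (ℕ → Poly) → Set
IsCyclotomic Φ = ∀ m → 1 ℕ.≤ m → divProd Φ m m ≈ X^ m ⊖ oneP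

Frac : Set
Frac = Poly × Poly

infixl 6 _+F_
infixl 7 _*F_

_+F_ : Frac → Frac → Frac
(a , b) +F (c , d) = (a ⊗ d ⊕ c ⊗ b , b ⊗ d)

_*F_ : Frac → Frac → Frac
(a , b) *F (c , d) = (a ⊗ c , b ⊗ d)

zeroF : Frac
zeroF = ([] , oneP)

sumF : (ℕ → Frac) → ℕ → Frac
sumF f zero    = zeroF
sumF f (suc N) = sumF f N +F f N

cubeF : Frac → Frac
cubeF x = x *F x *F x

-- B coprime to P in ℚ[q]: a Bezout relation U B + V P = c with c a nonzero constant
CoprimeP : Poly → Poly → Set
CoprimeP B P = ∃[ U ] ∃[ V ] ∃[ c ] (c ≢ 0ℤ × (U ⊗ B ⊕ V ⊗ P ≈ const c))

-- N₁/D₁ ≡ N₂/D₂ (mod P): the difference equals P·A/B with B coprime to P,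
-- i.e. (N₁D₂ - N₂D₁)·B = P·A·D₁·D₂.
CongMod : Frac → Frac → Poly → Set
CongMod (N₁ , D₁) (N₂ , D₂) P =
  ∃[ A ] ∃[ B ] (CoprimeP B P × ((N₁ ⊗ D₂ ⊖ N₂ ⊗ D₁) ⊗ B ≈ P ⊗ A ⊗ D₁ ⊗ D₂))

cq : ℕ → ℕ → Frac
cq d k =
  ( signPow k · ((oneP ⊕ X^ (2 ℕ.* d ℕ.* k ℕ.+ 1)) ⊗ (qPoch 2 (2 ℕ.* d) k ^P 3)
                  ⊗ X^ (d ℕ.* k ℕ.* k ℕ.+ 2 ℕ.* k ℕ.* (d ∸ 1)))
  , (oneP ⊕ X^ 1) ⊗ (qPoch (2 ℕ.* d) (2 ℕ.* d) k ^P 3) )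

lhs : ℕ → ℕ → Frac
lhs d n = sumF (λ i → sumF (λ j → sumF (λ s → cq d i *F cq d j *F cq d s)
                                          (n ∸ i ∸ j))
                         (n ∸ i))
               n

tq : ℕ → ℕ → Frac
tq d k =
  ( (qPoch 2 (2 ℕ.* d) k ^P 2) ⊗ qPoch d (2 ℕ.* d) k ⊗ X^ (2 ℕ.* (d ∸ 1) ℕ.* k)
  , qPoch (d ℕ.+ 1) (2 ℕ.* d) k ⊗ qPoch (2 ℕ.* d) (2 ℕ.* d) k
      ⊗ qPoch (2 ℕ.* d ℕ.+ 1) (2 ℕ.* d) k )

-- right-hand side, with m = (n-1)/d:
-- (-1)^{3m} [n]_{q^2}^3 q^{3m(n+1-d)} (Σ_{k=0}^{m} tq k)^3
-- (for m ≥ 1 we have n+1 > d, and for m = 0 the exponent is 0, so ∸ is harmless)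
rhs : ℕ → ℕ → ℕ → Frac
rhs d n m =
  ( signPow (3 ℕ.* m) · ((qint2 n ^P 3) ⊗ X^ (3 ℕ.* m ℕ.* (n ℕ.+ 1 ∸ d))) , oneP )
  *F cubeF (sumF (tq d) (suc m))

modulus : (ℕ → Poly) → ℕ → Poly
modulus Φ n = (negArg (Φ n) ^P 3) ⊗ (Φ n ^P 2)

{-# OPTIONS --safe #-}
module Submission where

-- Write x = q, y = q^d, a = x², Q = y², n = 1 + d N and w = q^(2n) = a Q^N, so that E = 1 - w is divisible
-- by Φ_n(q) Φ_n(-q).  Let S be the sum of c_q(k) over k ≤ N and T the cube root of the right-hand side.
--
-- For N < k < n the factor (q²; q^(2d))_k³ makes c_q(k) a multiple of E³, and i, j, s ≤ N implies
-- i + j + s < n because d ≥ 3; hence the triple sum is S³ modulo E³.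
--
-- For s v = w one has (1 - w v)(1 - s) = (1 - w)² - s (1 - v)².  Hence replacing each (a; Q)_k² by
-- (w a; Q)_k (a / w; Q)_k, and (Q; Q)_k² by (w Q; Q)_k (Q / w; Q)_k, changes S and T by multiples of E² only.
-- After the replacement the two sides are equal: this is a limiting case of Watson's transformation of a
-- terminating very-well-poised ₈φ₇, obtained by inserting the q-Pfaff–Saalschütz sum into the left-hand side,
-- exchanging the summations and evaluating the inner very-well-poised sum.  Hence S ≡ T modulo E².
--
-- Finally, if N > 0 then T is a multiple of 1 + q^n: its denominators contain the factor 1 - q^n at most once,
-- and no other factor that meets Φ_n(q) Φ_n(-q), while [n]_(q²) contains 1 - q^(2n).  So
-- S³ - T³ = (S - T)(S² + S T + T²) is a multiple of E² (1 + q^n)², which is a multiple of Φ_n(q)² Φ_n(-q)³.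
-- If N = 0 then both sides are 1.
--
-- Rational functions are represented by power series in q; O is the ring of those whose denominator is
-- coprime to the modulus.

open import Algebra.Bundles using (CommutativeRing; RawRing)
import Algebra.Construct.Pointwise as Pointwise
import Algebra.Morphism.RingMonomorphism as RingMonomorphism
open import Algebra.Morphism.Structures using (module RingMorphisms)
import Algebra.Properties.Ring
import Algebra.Properties.Semiring.Exp
import Algebra.Properties.Semiring.Mult.TCOptimised
import Algebra.Solver.Ring
open import Algebra.Solver.Ring.AlmostCommutativeRing
  using (fromCommutativeRing; _-Raw-AlmostCommutative⟶_)
open import Data.Bool using (if_then_else_)
open import Data.Integer as ℤ using (ℤ; +_; -[1+_]; 0ℤ; 1ℤ; -1ℤ)
import Data.Integer.Properties as ℤ
open import Data.Integer.Solver using () renaming (module +-*-Solver to ℤ-Solver)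
open import Data.List using (List; []; _∷_)
open import Data.Maybe using (Maybe; just; nothing)
open import Data.Nat as ℕ using (ℕ; zero; suc; z≤n; s≤s)
import Data.Nat.Coprimality as Coprimality
open import Data.Nat.Divisibility
  using (_∣_; divides; _∣?_; _∣0; ∣-refl; ∣-trans; ∣⇒≤; >⇒∤; 0∣⇒≡0; ∣1⇒≡1; ∣m+n∣m⇒∣n; ∣n⇒∣m*n; ∣m⇒∣m*n)
open import Data.Nat.GCD using (gcd; gcd[m,n]∣m; gcd[m,n]∣n; gcd-GCD; module Bézout)
import Data.Nat.Properties as ℕ
open import Data.Nat.Solver using () renaming (module +-*-Solver to ℕ-Solver)
open import Data.Product using (Σ; _×_; _,_; ∃; proj₁; proj₂)
open import Data.Sum using (_⊎_; inj₁; inj₂; [_,_]′)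
open import Function using (_∘_)
open import Level using (Level; 0ℓ; _⊔_)
import Relation.Binary.PropositionalEquality as ≡
open ≡ using (_≡_; _≢_)
import Relation.Binary.Reasoning.Setoid
open import Relation.Nullary using (¬_; contradiction; does; yes; no)
open import Relation.Nullary.Decidable using (dec-true; dec-false)

open ℕ-Solver using () renaming (_:+_ to _:+ₙ_; _:*_ to _:*ₙ_; _:=_ to _:=ₙ_; con to conₙ)
open ℤ-Solver using () renaming (_:+_ to _:+ᵢ_; _:*_ to _:*ᵢ_; :-_ to :-ᵢ_; _:=_ to _:=ᵢ_; con to conᵢ)

-- The value w is special: a / w = Q^(-N), so the replaced sums end at N by themselves and fall
-- under Watson's transformation. The replaced products (w u; Q)_k (u / w; Q)_k are symmetric under
-- w ↦ 1 / w, so no term of first order in 1 - w survives; this is where the square of E comes from.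
--
-- The main obstacle is that the exact identities contain inverses of 1 - q^n and 1 - q^(2n), which
-- do not exist modulo the modulus. They are therefore proved among power series, where each 1 - q^e
-- with e > 0 is a unit, and membership in O is tracked separately. Each factor with a negative
-- power of Q is reversed beforehand, so the hypergeometric part makes sense in any commutative ring
-- with the inverses supplied as data.
--
-- Cyclotomic polynomials are given only through their product formula. Coprimality is derived from
-- it by explicit Bezout relations; their right-hand sides are nonzero integers instead of 1,
-- because the polynomials have integer coefficients.

-- Integer coefficients for the ring solver

module IntegerCoefficients {c ℓ : Level} (R : CommutativeRing c ℓ) where
  open CommutativeRing R
  open Algebra.Properties.Ring ring
  open Algebra.Properties.Semiring.Mult.TCOptimised semiring renaming (_×_ to infixl 8 _×ₙ_)
  open Relation.Binary.Reasoning.Setoid setoid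

  -- Equality of power series cannot be decided, so the solver compares coefficients in ℤ and
  -- reaches the ring through this canonical homomorphism.
  ι : ℤ → Carrier
  ι (+ n)    = n ×ₙ 1#
  ι -[1+ n ] = - (suc n ×ₙ 1#)

  private
    x-0≈x : ∀ x → x - 0# ≈ x
    x-0≈x x = trans (+-congˡ -0#≈0#) (+-identityʳ x)

    cancel-1 : ∀ x y → (1# + x) - (1# + y) ≈ x - y
    cancel-1 x y = begin
      (1# + x) - (1# + y)       ≈⟨ +-cong (+-comm 1# x) (sym (-‿+-comm 1# y)) ⟩
      (x + 1#) + (- 1# + - y)   ≈⟨ +-assoc x 1# _ ⟩
      x + (1# + (- 1# + - y))   ≈⟨ +-congˡ (sym (+-assoc 1# (- 1#) (- y))) ⟩
      x + ((1# - 1#) + - y)     ≈⟨ +-congˡ (+-congʳ (-‿inverseʳ 1#)) ⟩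
      x + (0# + - y)            ≈⟨ +-congˡ (+-identityˡ (- y)) ⟩
      x - y                     ∎

    ι-⊖ : ∀ m n → ι (m ℤ.⊖ n) ≈ m ×ₙ 1# - n ×ₙ 1#
    ι-⊖ m       zero    = sym (x-0≈x _)
    ι-⊖ zero    (suc n) = sym (+-identityˡ _)
    ι-⊖ (suc m) (suc n) = begin
      ι (suc m ℤ.⊖ suc n)               ≡⟨ ≡.cong ι (ℤ.[1+m]⊖[1+n]≡m⊖n m n) ⟩
      ι (m ℤ.⊖ n)                       ≈⟨ ι-⊖ m n ⟩
      m ×ₙ 1# - n ×ₙ 1#                   ≈⟨ cancel-1 _ _ ⟨
      (1# + m ×ₙ 1#) - (1# + n ×ₙ 1#)     ≈⟨ +-cong (sym (×-homo-+ 1# 1 m)) (-‿cong (sym (×-homo-+ 1# 1 n))) ⟩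
      suc m ×ₙ 1# - suc n ×ₙ 1#           ∎

  ι-+ : ∀ i j → ι (i ℤ.+ j) ≈ ι i + ι j
  ι-+ (+ m)    (+ n)    = ×-homo-+ 1# m n
  ι-+ (+ m)    -[1+ n ] = ι-⊖ m (suc n)
  ι-+ -[1+ m ] (+ n)    = trans (ι-⊖ n (suc m)) (+-comm _ _)
  ι-+ -[1+ m ] -[1+ n ] = begin
    - (suc (suc (m ℕ.+ n)) ×ₙ 1#)        ≡⟨ ≡.cong (λ k → - (suc k ×ₙ 1#)) (≡.sym (ℕ.+-suc m n)) ⟩
    - ((suc m ℕ.+ suc n) ×ₙ 1#)          ≈⟨ -‿cong (×-homo-+ 1# (suc m) (suc n)) ⟩
    - (suc m ×ₙ 1# + suc n ×ₙ 1#)         ≈⟨ -‿+-comm _ _ ⟨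
    - (suc m ×ₙ 1#) + - (suc n ×ₙ 1#)       ∎

  ι-neg : ∀ i → ι (ℤ.- i) ≈ - ι i
  ι-neg (+ zero)  = sym -0#≈0#
  ι-neg (+ suc n) = refl
  ι-neg -[1+ n ]  = sym (-‿involutive _)

  ι-* : ∀ i j → ι (i ℤ.* j) ≈ ι i * ι j
  ι-* (+ m) (+ n) = begin
    ι (+ m ℤ.* + n)        ≡⟨ ≡.cong ι (≡.sym (ℤ.pos-* m n)) ⟩
    (m ℕ.* n) ×ₙ 1#         ≈⟨ ×1-homo-* m n ⟩
    m ×ₙ 1# * n ×ₙ 1#        ∎
  ι-* (+ m) -[1+ n ] = begin
    ι (+ m ℤ.* -[1+ n ])      ≡⟨ ≡.cong ι (≡.sym (ℤ.neg-distribʳ-* (+ m) (+ suc n))) ⟩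
    ι (ℤ.- (+ m ℤ.* + suc n)) ≈⟨ ι-neg (+ m ℤ.* + suc n) ⟩
    - ι (+ m ℤ.* + suc n)     ≈⟨ -‿cong (ι-* (+ m) (+ suc n)) ⟩
    - (m ×ₙ 1# * (suc n ×ₙ 1#)) ≈⟨ -‿distribʳ-* _ _ ⟩
    ι (+ m) * ι -[1+ n ]      ∎
  ι-* -[1+ m ] (+ n) = begin
    ι (-[1+ m ] ℤ.* + n)      ≡⟨ ≡.cong ι (≡.sym (ℤ.neg-distribˡ-* (+ suc m) (+ n))) ⟩
    ι (ℤ.- (+ suc m ℤ.* + n)) ≈⟨ ι-neg (+ suc m ℤ.* + n) ⟩
    - ι (+ suc m ℤ.* + n)     ≈⟨ -‿cong (ι-* (+ suc m) (+ n)) ⟩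
    - (suc m ×ₙ 1# * (n ×ₙ 1#)) ≈⟨ -‿distribˡ-* _ _ ⟩
    ι -[1+ m ] * ι (+ n)      ∎
  ι-* -[1+ m ] -[1+ n ] = begin
    (suc m ℕ.* suc n) ×ₙ 1#              ≈⟨ ×1-homo-* (suc m) (suc n) ⟩
    suc m ×ₙ 1# * (suc n ×ₙ 1#)           ≈⟨ -‿involutive _ ⟨
    - - (suc m ×ₙ 1# * (suc n ×ₙ 1#))     ≈⟨ -‿cong (-‿distribʳ-* _ _) ⟩
    - (suc m ×ₙ 1# * - (suc n ×ₙ 1#))     ≈⟨ -‿distribˡ-* _ _ ⟩
    - (suc m ×ₙ 1#) * - (suc n ×ₙ 1#)     ∎

  private
    morphism : ℤ.+-*-rawRing -Raw-AlmostCommutative⟶ fromCommutativeRing R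
    morphism = record
      { ⟦_⟧ = ι ; +-homo = ι-+ ; *-homo = ι-* ; -‿homo = ι-neg ; 0-homo = refl ; 1-homo = refl }

    _coeff≟_ : (i j : ℤ) → Maybe (ι i ≈ ι j)
    i coeff≟ j with i ℤ.≟ j
    ... | yes i≡j = just (reflexive (≡.cong ι i≡j))
    ... | no  _   = nothing

  open Algebra.Solver.Ring ℤ.+-*-rawRing (fromCommutativeRing R) morphism _coeff≟_ public
    using (Polynomial; solve; _:=_; con; _:+_; _:*_; _:-_; :-_)

-- Finite products, sums and sums over antidiagonals

module SumsAndProducts {c ℓ : Level} (R : CommutativeRing c ℓ) where
  open CommutativeRing R
  open IntegerCoefficients R
  open Algebra.Properties.Semiring.Exp semiring
  open Relation.Binary.Reasoning.Setoid setoid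

  infixl 7 _⟨*⟩_
  _⟨*⟩_ : ∀ {u v w z} → u ≈ v → w ≈ z → u * w ≈ v * z
  _⟨*⟩_ = *-cong

  unit-cancel : ∀ {u u⁻¹ v w} → u * u⁻¹ ≈ 1# → u * v ≈ u * w → v ≈ w
  unit-cancel {u} {u⁻¹} {v} {w} inv eq = begin
    v               ≈⟨ insert v ⟩
    u⁻¹ * (u * v)   ≈⟨ *-congˡ eq ⟩
    u⁻¹ * (u * w)   ≈⟨ insert w ⟨
    w               ∎
    where
    insert : ∀ t → t ≈ u⁻¹ * (u * t)
    insert t = begin
      t               ≈⟨ *-identityˡ t ⟨
      1# * t          ≈⟨ *-congʳ inv ⟨
      u * u⁻¹ * t     ≈⟨ solve 3 (λ a b z → a :* b :* z := b :* (a :* z)) refl u u⁻¹ t ⟩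
      u⁻¹ * (u * t)   ∎

  Π : (ℕ → Carrier) → ℕ → Carrier
  Π f zero    = 1#
  Π f (suc n) = Π f n * f n

  Π-cong< : ∀ {f g} n → (∀ i → i ℕ.< n → f i ≈ g i) → Π f n ≈ Π g n
  Π-cong< zero    eq = refl
  Π-cong< (suc n) eq = Π-cong< n (λ i i<n → eq i (ℕ.m<n⇒m<1+n i<n)) ⟨*⟩ eq n (ℕ.n<1+n n)

  Π-cong : ∀ {f g} n → (∀ i → f i ≈ g i) → Π f n ≈ Π g n
  Π-cong n eq = Π-cong< n (λ i _ → eq i)

  Π-* : ∀ f g n → Π (λ i → f i * g i) n ≈ Π f n * Π g n
  Π-* f g zero    = sym (*-identityˡ 1#)
  Π-* f g (suc n) = trans (*-congʳ (Π-* f g n))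
    (solve 4 (λ a b c d → a :* b :* (c :* d) := a :* c :* (b :* d)) refl _ _ _ _)

  Π-1 : ∀ {f} n → (∀ i → f i ≈ 1#) → Π f n ≈ 1#
  Π-1 zero    eq = refl
  Π-1 (suc n) eq = trans (Π-1 n eq ⟨*⟩ eq n) (*-identityˡ 1#)

  Π-inverse : ∀ f g n → (∀ i → f i * g i ≈ 1#) → Π f n * Π g n ≈ 1#
  Π-inverse f g n eq = trans (sym (Π-* f g n)) (Π-1 n eq)

  Π-+ : ∀ f m n → Π f (m ℕ.+ n) ≈ Π f m * Π (λ i → f (m ℕ.+ i)) n
  Π-+ f m zero    = trans (reflexive (≡.cong (Π f) (ℕ.+-identityʳ m))) (sym (*-identityʳ _))
  Π-+ f m (suc n) = begin
    Π f (m ℕ.+ suc n)                                      ≡⟨ ≡.cong (Π f) (ℕ.+-suc m n) ⟩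
    Π f (m ℕ.+ n) * f (m ℕ.+ n)                            ≈⟨ *-congʳ (Π-+ f m n) ⟩
    Π f m * Π (λ i → f (m ℕ.+ i)) n * f (m ℕ.+ n)          ≈⟨ *-assoc _ _ _ ⟩
    Π f m * Π (λ i → f (m ℕ.+ i)) (suc n)                  ∎

  Π-head : ∀ f n → Π f (suc n) ≈ f 0 * Π (f ∘ suc) n
  Π-head f n = trans (Π-+ f 1 n) (*-congʳ (*-identityˡ _))

  -- Up to a sign and a power of Q, (Q^(-N); Q)_k consists of the last k factors of (Q; Q)_N;
  -- reading a product from its end is how negative powers are avoided.
  Π-reverse : ∀ f k l → Π f (k ℕ.+ l) ≈ Π f l * Π (λ i → f (k ℕ.+ l ℕ.∸ suc i)) k
  Π-reverse f zero    l = sym (*-identityʳ _)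
  Π-reverse f (suc k) l = begin
    Π f (k ℕ.+ l) * f (k ℕ.+ l)                                            ≈⟨ *-congʳ (Π-reverse f k l) ⟩
    Π f l * Π (λ i → f (k ℕ.+ l ℕ.∸ suc i)) k * f (k ℕ.+ l)                ≈⟨ solve 3 (λ a b c → a :* b :* c := a :* (c :* b)) refl _ _ _ ⟩
    Π f l * (f (k ℕ.+ l) * Π (λ i → f (k ℕ.+ l ℕ.∸ suc i)) k)              ≈⟨ *-congˡ (Π-head (λ i → f (suc k ℕ.+ l ℕ.∸ suc i)) k) ⟨
    Π f l * Π (λ i → f (suc k ℕ.+ l ℕ.∸ suc i)) (suc k)                    ∎

  -- Brings products of inverses of different lengths to the longest one, so that neighbouring terms
  -- of a recurrence differ by polynomial factors.
  Π-unfold : ∀ (u i : ℕ → Carrier) → (∀ n → u n * i n ≈ 1#) → ∀ n → Π i n ≈ Π i (suc n) * u n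
  Π-unfold u i inv n = begin
    Π i n                 ≈⟨ *-identityʳ _ ⟨
    Π i n * 1#            ≈⟨ *-congˡ (inv n) ⟨
    Π i n * (u n * i n)   ≈⟨ solve 3 (λ p u i → p :* (u :* i) := p :* i :* u) refl _ _ _ ⟩
    Π i (suc n) * u n     ∎

  Π-const : ∀ z n → Π (λ _ → z) n ≈ z ^ n
  Π-const z zero    = refl
  Π-const z (suc n) = trans (*-congʳ (Π-const z n)) (*-comm _ _)

  Σ< : (ℕ → Carrier) → ℕ → Carrier
  Σ< f zero    = 0#
  Σ< f (suc n) = Σ< f n + f n

  Σ<-cong : ∀ {f g} n → (∀ i → i ℕ.< n → f i ≈ g i) → Σ< f n ≈ Σ< g n
  Σ<-cong zero    eq = refl
  Σ<-cong (suc n) eq = +-cong (Σ<-cong n (λ i i<n → eq i (ℕ.m<n⇒m<1+n i<n))) (eq n (ℕ.n<1+n n))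

  Σ<-head : ∀ f n → Σ< f (suc n) ≈ f 0 + Σ< (f ∘ suc) n
  Σ<-head f zero    = +-comm _ _
  Σ<-head f (suc n) = trans (+-congʳ (Σ<-head f n)) (+-assoc _ _ _)

  Σ<-*ˡ : ∀ z f n → z * Σ< f n ≈ Σ< (λ i → z * f i) n
  Σ<-*ˡ z f zero    = zeroʳ z
  Σ<-*ˡ z f (suc n) = trans (distribˡ z _ _) (+-congʳ (Σ<-*ˡ z f n))

  -- asum f n is the sum of f i j over the antidiagonal i + j = n.
  asum : (ℕ → ℕ → Carrier) → ℕ → Carrier
  asum f zero    = f 0 0
  asum f (suc n) = f 0 (suc n) + asum (f ∘ suc) n

  asum-cong : ∀ {f g} n → (∀ i j → i ℕ.+ j ≡ n → f i j ≈ g i j) → asum f n ≈ asum g n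
  asum-cong zero    eq = eq 0 0 ≡.refl
  asum-cong (suc n) eq = +-cong (eq 0 (suc n) ≡.refl)
    (asum-cong n (λ i j i+j≡n → eq (suc i) j (≡.cong suc i+j≡n)))

  asum-*ˡ : ∀ z f n → z * asum f n ≈ asum (λ i j → z * f i j) n
  asum-*ˡ z f zero    = refl
  asum-*ˡ z f (suc n) = trans (distribˡ z _ _) (+-congˡ (asum-*ˡ z (f ∘ suc) n))

  asum-+ : ∀ f g n → asum f n + asum g n ≈ asum (λ i j → f i j + g i j) n
  asum-+ f g zero    = refl
  asum-+ f g (suc n) = trans
    (solve 4 (λ a b c d → a :+ b :+ (c :+ d) := a :+ c :+ (b :+ d)) refl _ _ _ _)
    (+-congˡ (asum-+ (f ∘ suc) (g ∘ suc) n))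

  asum-Σ< : ∀ f n → asum f n ≈ Σ< (λ i → f i (n ℕ.∸ i)) (suc n)
  asum-Σ< f zero    = sym (+-identityˡ _)
  asum-Σ< f (suc n) = trans (+-congˡ (asum-Σ< (f ∘ suc) n)) (sym (Σ<-head _ (suc n)))

  -- The exchange of summations in Watson's transformation: both sides run over j + m + l = n.
  asum-assoc : ∀ (f : ℕ → ℕ → ℕ → Carrier) n →
    asum (λ k l → asum (λ j m → f j m l) k) n ≈ asum (λ j r → asum (λ m l → f j m l) r) n
  asum-assoc f zero    = refl
  asum-assoc f (suc n) = begin
    f 0 0 (suc n) + asum (λ k l → f 0 (suc k) l + asum (λ j m → f (suc j) m l) k) n
      ≈⟨ +-congˡ (asum-+ (λ k l → f 0 (suc k) l) _ n) ⟨
    f 0 0 (suc n) + (asum (λ k l → f 0 (suc k) l) n + asum (λ k l → asum (λ j m → f (suc j) m l) k) n)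
      ≈⟨ +-assoc _ _ _ ⟨
    asum (f 0) (suc n) + asum (λ k l → asum (λ j m → f (suc j) m l) k) n
      ≈⟨ +-congˡ (asum-assoc (f ∘ suc) n) ⟩
    asum (f 0) (suc n) + asum (λ j r → asum (f (suc j)) r) n  ∎

  -- h is the certificate; h′ is h moved one step along the antidiagonal.
  asum-telescope : ∀ (f g h h′ : ℕ → ℕ → Carrier) n →
    (∀ i j → i ℕ.+ j ≡ n → f i (suc j) ≈ g i j + (h i j - h′ i j)) →
    (∀ i j → h′ (suc i) j ≈ h i (suc j)) →
    f (suc n) 0 ≈ - h n 0 →
    asum f (suc n) ≈ asum g n - h′ 0 n
  asum-telescope f g h h′ zero step move last = begin
    f 0 1 + f 1 0                        ≈⟨ +-cong (step 0 0 ≡.refl) last ⟩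
    g 0 0 + (h 0 0 - h′ 0 0) - h 0 0     ≈⟨ solve 3 (λ a b c → a :+ (b :- c) :- b := a :- c) refl _ _ _ ⟩
    g 0 0 - h′ 0 0                       ∎
  asum-telescope f g h h′ (suc n) step move last = begin
    f 0 (suc (suc n)) + asum (f ∘ suc) (suc n)
      ≈⟨ +-cong (step 0 (suc n) ≡.refl)
                (asum-telescope (f ∘ suc) (g ∘ suc) (h ∘ suc) (h′ ∘ suc) n
                  (λ i j e → step (suc i) j (≡.cong suc e)) (λ i j → move (suc i) j) last) ⟩
    g 0 (suc n) + (h 0 (suc n) - h′ 0 (suc n)) + (asum (g ∘ suc) n - h′ 1 n)
      ≈⟨ +-congˡ (+-congˡ (-‿cong (move 0 n))) ⟩
    g 0 (suc n) + (h 0 (suc n) - h′ 0 (suc n)) + (asum (g ∘ suc) n - h 0 (suc n))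
      ≈⟨ solve 4 (λ a b c d → a :+ (b :- c) :+ (d :- b) := a :+ d :- c) refl _ _ _ _ ⟩
    g 0 (suc n) + asum (g ∘ suc) n - h′ 0 (suc n)  ∎

-- q-shifted factorials, two summation theorems and Watson's transformation

module QShifted {c ℓ : Level} (R : CommutativeRing c ℓ) (Q : CommutativeRing.Carrier R) where
  open CommutativeRing R
  open SumsAndProducts R
  open Algebra.Properties.Semiring.Exp semiring

  poch : Carrier → ℕ → Carrier
  poch a = Π (λ i → 1# - a * Q ^ i)

  -- Q ^ (n (n - 1) / 2)
  Q^tri : ℕ → Carrier
  Q^tri = Π (Q ^_)

  sgn : ℕ → Carrier
  sgn n = (- 1#) ^ n

  poch-cong : ∀ {a b} n → a ≈ b → poch a n ≈ poch b n
  poch-cong n a≈b = Π-cong n (λ i → +-congˡ (-‿cong (*-congʳ a≈b)))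

  poch-+ : ∀ a m n → poch a (m ℕ.+ n) ≈ poch a m * poch (a * Q ^ m) n
  poch-+ a m n = trans (Π-+ _ m n) (*-congˡ (Π-cong n (λ i → +-congˡ (-‿cong
    (trans (*-congˡ (^-homo-* Q m i)) (sym (*-assoc _ _ _)))))))

  poch-head : ∀ a n → poch a (suc n) ≈ (1# - a) * poch (a * Q) n
  poch-head a n = trans (poch-+ a 1 n)
    (trans (*-congʳ (*-identityˡ _)) (+-congˡ (-‿cong (*-identityʳ a)) ⟨*⟩ poch-cong n (*-congˡ (*-identityʳ Q))))


-- The balanced ₃φ₂(Q^(-k), x² Q^k, y; x y, x y²; Q, Q) in base Q = y², divided by (Q; Q)_k and multiplied by
-- Q^(k (k - 1) / 2), so that no negative powers occur.  Here and below iQ, iB, iC, ia are the inverses of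
-- the factors 1 - u Q^i for u = Q, x y, x y², x².
module QPfaffSaalschütz {c ℓ : Level} (R : CommutativeRing c ℓ) (x y : CommutativeRing.Carrier R)
  (iQ iB iC : ℕ → CommutativeRing.Carrier R) where
  open CommutativeRing R
  open IntegerCoefficients R
  open SumsAndProducts R
  open QShifted R (y * y)
  open Algebra.Properties.Semiring.Exp semiring
  open Relation.Binary.Reasoning.Setoid setoid

  private
    Q = y * y
    a = x * x

  φ : ℕ → Carrier
  φ = Π iQ

  B : ℕ → Carrier
  B n = Π iB n * Π iC n

  -- For k = j + m, (Q^(-k); Q)_j Q^j Q^(k (k - 1) / 2) / (Q; Q)_k equals (-1)^j Q^(m (m - 1) / 2) /
  -- (Q; Q)_m, hence `sgn j`, `Q^tri m` and `φ m`; `φ j` and `B j` are the denominators of the ₃φ₂.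
  term : ℕ → ℕ → Carrier
  term j m = sgn j * Q^tri m * φ j * φ m * poch y j * poch (a * (Q ^ j * Q ^ m)) j * B j

  -- The Wilf–Zeilberger certificate for the recurrence in k = j + m.
  cert : ℕ → ℕ → Carrier
  cert j m = sgn j * (Q^tri m * Q ^ m) * φ j * φ m * (poch y j * (1# - y * Q ^ j))
    * poch (a * Q * (Q ^ j * Q ^ m)) j * B j * (1# - a * Q * (Q ^ j * Q ^ m) * (Q ^ j * Q ^ m))

  module _ (iQ-inv : ∀ i → (1# - Q * Q ^ i) * iQ i ≈ 1#)
           (iB-inv : ∀ i → (1# - x * y * Q ^ i) * iB i ≈ 1#)
           (iC-inv : ∀ i → (1# - x * y * y * Q ^ i) * iC i ≈ 1#) where

    φ-unfold : ∀ n → φ n ≈ φ (suc n) * (1# - Q * Q ^ n)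
    φ-unfold = Π-unfold _ iQ iQ-inv

    B-unfold : ∀ n → B n ≈ B (suc n) * ((1# - x * y * Q ^ n) * (1# - x * y * y * Q ^ n))
    B-unfold n = trans (Π-unfold _ iB iB-inv n ⟨*⟩ Π-unfold _ iC iC-inv n)
      (solve 4 (λ a b c d → a :* b :* (c :* d) := a :* c :* (b :* d)) refl _ _ _ _)

    -- For κ = Q^k, V / W is the quotient of consecutive values of the closed form. Both carry an
    -- extra factor 1 - x y κ, with which the termwise relation telescopes and which `summation`
    -- cancels as a unit.
    W V : Carrier → Carrier
    W κ = (1# - Q * κ) * ((1# - x * y * κ) * (1# - x * y * y * κ))
    V κ = κ * y * (1# - x * κ) * (1# - x * y * κ)

    step : ∀ i m → W (Q ^ suc i * Q ^ m) * term (suc i) (suc m) ≈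
           V (Q ^ suc i * Q ^ m) * term (suc i) m + (cert (suc i) m - cert i (suc m))
    step i m = begin
      W κ * term (suc i) (suc m)
        ≈⟨ *-congˡ (refl ⟨*⟩ refl ⟨*⟩ refl ⟨*⟩ refl ⟨*⟩ refl ⟨*⟩ (*-congʳ (poch-cong i eq₁)) ⟨*⟩ refl) ⟩
      -- All products now have matching lengths and count as unknowns; what remains is a polynomial
      -- identity between the factors by which the four terms differ.
      _ ≈⟨ solve 11 (λ s p f g u b P x y A M →
            let o = con 1ℤ ; Q = y :* y ; a = x :* x ; κ = Q :* A :* M in
            (o :- Q :* κ) :* ((o :- x :* y :* κ) :* (o :- x :* y :* y :* κ))
              :* ((:- o :* s) :* (p :* M) :* f :* g :* (u :* (o :- y :* A)) :* (P :* (o :- a :* (Q :* A :* (Q :* M)) :* A)) :* b)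
            :=
            κ :* y :* (o :- x :* κ) :* (o :- x :* y :* κ)
              :* ((:- o :* s) :* p :* f :* (g :* (o :- Q :* M)) :* (u :* (o :- y :* A)) :* ((o :- a :* κ) :* P) :* b)
            :+ ((:- o :* s) :* (p :* M) :* f :* (g :* (o :- Q :* M)) :* (u :* (o :- y :* A) :* (o :- y :* (Q :* A)))
                  :* (P :* (o :- a :* Q :* κ :* A)) :* b :* (o :- a :* Q :* κ :* κ)
             :- s :* (p :* M :* (Q :* M)) :* (f :* (o :- Q :* A)) :* g :* (u :* (o :- y :* A)) :* P
                  :* (b :* ((o :- x :* y :* A) :* (o :- x :* y :* y :* A))) :* (o :- a :* Q :* κ :* κ)))
            refl _ _ _ _ _ _ _ _ _ _ _ ⟩
      _ ≈⟨ +-cong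
            (*-congˡ (refl ⟨*⟩ sym (φ-unfold m) ⟨*⟩ refl ⟨*⟩ sym (trans (poch-head _ i) (*-congˡ (poch-cong i eq₂))) ⟨*⟩ refl))
            (+-cong (refl ⟨*⟩ sym (φ-unfold m) ⟨*⟩ refl ⟨*⟩ refl ⟨*⟩ refl ⟨*⟩ refl)
              (-‿cong (refl ⟨*⟩ sym (φ-unfold i) ⟨*⟩ refl ⟨*⟩ refl ⟨*⟩ sym (poch-cong i eq₃) ⟨*⟩ sym (B-unfold i) ⟨*⟩ eq₄))) ⟩
      V κ * term (suc i) m + (cert (suc i) m - cert i (suc m))  ∎
      where
      κ = Q ^ suc i * Q ^ m
      eq₁ : a * (Q ^ suc i * Q ^ suc m) ≈ a * Q * κ
      eq₁ = solve 4 (λ a Q A M → a :* (Q :* A :* (Q :* M)) := a :* Q :* (Q :* A :* M)) refl _ _ _ _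
      eq₂ : a * κ * Q ≈ a * Q * κ
      eq₂ = solve 3 (λ a κ Q → a :* κ :* Q := a :* Q :* κ) refl _ _ _
      eq₃ : a * Q * (Q ^ i * Q ^ suc m) ≈ a * Q * κ
      eq₃ = solve 4 (λ a Q A M → a :* Q :* (A :* (Q :* M)) := a :* Q :* (Q :* A :* M)) refl _ _ _ _
      eq₄ : 1# - a * Q * κ * κ ≈ 1# - a * Q * (Q ^ i * Q ^ suc m) * (Q ^ i * Q ^ suc m)
      eq₄ = solve 4 (λ a Q A M → con 1ℤ :- a :* Q :* (Q :* A :* M) :* (Q :* A :* M)
               := con 1ℤ :- a :* Q :* (A :* (Q :* M)) :* (A :* (Q :* M))) refl _ _ _ _

    -- At j = 0 the shifted certificate would contain 1 / (Q; Q)_(-1) = 0, hence the `0#`.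
    step-zero : ∀ m → W (Q ^ 0 * Q ^ m) * term 0 (suc m) ≈ V (Q ^ 0 * Q ^ m) * term 0 m + (cert 0 m - 0#)
    step-zero m = begin
      W (Q ^ 0 * Q ^ m) * term 0 (suc m)
        ≈⟨ solve 6 (λ x y M p g b →
            let o = con 1ℤ ; Q = y :* y ; a = x :* x ; κ = o :* M in
            (o :- Q :* κ) :* ((o :- x :* y :* κ) :* (o :- x :* y :* y :* κ)) :* (o :* (p :* M) :* o :* g :* o :* o :* b)
            := κ :* y :* (o :- x :* κ) :* (o :- x :* y :* κ) :* (o :* p :* o :* (g :* (o :- Q :* M)) :* o :* o :* b)
            :+ (o :* (p :* M) :* o :* (g :* (o :- Q :* M)) :* (o :* (o :- y :* o)) :* o :* b :* (o :- a :* Q :* κ :* κ) :- con 0ℤ))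
            refl _ _ _ _ _ _ ⟩
      _ ≈⟨ +-cong (*-congˡ (refl ⟨*⟩ sym (φ-unfold m) ⟨*⟩ refl ⟨*⟩ refl ⟨*⟩ refl))
             (+-congʳ (refl ⟨*⟩ sym (φ-unfold m) ⟨*⟩ refl ⟨*⟩ refl ⟨*⟩ refl ⟨*⟩ refl)) ⟩
      V (Q ^ 0 * Q ^ m) * term 0 m + (cert 0 m - 0#)  ∎

    -- At the end of the longer antidiagonal m would be -1: the term of the shorter sum and the
    -- unshifted certificate vanish, and only the shifted certificate remains.
    step-last : ∀ n → W (Q ^ n) * term (suc n) 0 ≈ - cert n 0
    step-last n = begin
      W (Q ^ n) * term (suc n) 0
        ≈⟨ *-congˡ (refl ⟨*⟩ (*-congʳ (poch-cong n eq)) ⟨*⟩ refl) ⟩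
      _ ≈⟨ solve 8 (λ x y A s f u P b →
            let o = con 1ℤ ; Q = y :* y ; a = x :* x in
            (o :- Q :* A) :* ((o :- x :* y :* A) :* (o :- x :* y :* y :* A))
              :* (:- o :* s :* o :* f :* o :* (u :* (o :- y :* A)) :* (P :* (o :- a :* (Q :* A :* o) :* A)) :* b)
            := :- (s :* (o :* o) :* (f :* (o :- Q :* A)) :* o :* (u :* (o :- y :* A)) :* P
              :* (b :* ((o :- x :* y :* A) :* (o :- x :* y :* y :* A))) :* (o :- a :* Q :* (A :* o) :* (A :* o))))
            refl _ _ _ _ _ _ _ _ ⟩
      _ ≈⟨ -‿cong (refl ⟨*⟩ sym (φ-unfold n) ⟨*⟩ refl ⟨*⟩ refl ⟨*⟩ refl ⟨*⟩ sym (B-unfold n) ⟨*⟩ refl) ⟩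
      - cert n 0  ∎
      where
      eq : a * (Q ^ suc n * Q ^ 0) ≈ a * Q * (Q ^ n * Q ^ 0)
      eq = solve 3 (λ a Q A → a :* (Q :* A :* con 1ℤ) := a :* Q :* (A :* con 1ℤ)) refl _ _ _

    recurrence : ∀ k → W (Q ^ k) * asum term (suc k) ≈ V (Q ^ k) * asum term k
    recurrence k = begin
      W (Q ^ k) * asum term (suc k)               ≈⟨ asum-*ˡ _ term (suc k) ⟩
      asum (λ j m → W (Q ^ k) * term j m) (suc k) ≈⟨ asum-telescope (λ j m → W (Q ^ k) * term j m) (λ j m → V (Q ^ k) * term j m) cert cert′ k
                                                       step′ (λ _ _ → refl) (step-last k) ⟩
      asum (λ j m → V (Q ^ k) * term j m) k - 0#  ≈⟨ solve 1 (λ z → z :- con 0ℤ := z) refl _ ⟩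
      asum (λ j m → V (Q ^ k) * term j m) k       ≈⟨ asum-*ˡ _ term k ⟨
      V (Q ^ k) * asum term k                     ∎
      where
      cert′ : ℕ → ℕ → Carrier
      cert′ zero    m = 0#
      cert′ (suc j) m = cert j (suc m)

      W-cong : ∀ {κ κ′} → κ ≈ κ′ → W κ ≈ W κ′
      W-cong e = +-congˡ (-‿cong (*-congˡ e)) ⟨*⟩ (+-congˡ (-‿cong (*-congˡ e)) ⟨*⟩ +-congˡ (-‿cong (*-congˡ e)))

      V-cong : ∀ {κ κ′} → κ ≈ κ′ → V κ ≈ V κ′
      V-cong e = *-congʳ e ⟨*⟩ +-congˡ (-‿cong (*-congˡ e)) ⟨*⟩ +-congˡ (-‿cong (*-congˡ e))

      transport : ∀ {t t′ z} j m → j ℕ.+ m ≡ k → W (Q ^ j * Q ^ m) * t ≈ V (Q ^ j * Q ^ m) * t′ + z →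
        W (Q ^ k) * t ≈ V (Q ^ k) * t′ + z
      transport j m ≡.refl e = trans (*-congʳ (W-cong (^-homo-* Q j m)))
        (trans e (+-congʳ (*-congʳ (V-cong (sym (^-homo-* Q j m))))))

      step′ : ∀ j m → j ℕ.+ m ≡ k →
        W (Q ^ k) * term j (suc m) ≈ V (Q ^ k) * term j m + (cert j m - cert′ j m)
      step′ zero    m e = transport 0 m e (step-zero m)
      step′ (suc j) m e = transport (suc j) m e (step j m)

    -- Because Q = y², the factors (x y; Q)_k of the q-Pfaff-Saalschütz product cancel, and (x; Q)_k
    -- / (x Q; Q)_k collapses to (1 - x) / (1 - x Q^k), whose denominator is kept on the left.
    summation : ∀ k → (1# - x * Q ^ k) * asum term k ≈ (1# - x) * (Q^tri k * y ^ k) * φ k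
    summation zero = solve 1 (λ x → let o = con 1ℤ in
      (o :- x :* o) :* (o :* o :* o :* o :* o :* o :* (o :* o)) := (o :- x) :* (o :* o) :* o) refl x
    summation (suc k) = unit-cancel unit (begin
      (1# - x * y * κ) * (1# - Q * κ) * ((1# - x * (Q * κ)) * asum term (suc k))
        ≈⟨ solve 4 (λ x y κ t → let o = con 1ℤ ; Q = y :* y in
             (o :- x :* y :* κ) :* (o :- Q :* κ) :* ((o :- x :* (Q :* κ)) :* t)
             := (o :- Q :* κ) :* ((o :- x :* y :* κ) :* (o :- x :* y :* y :* κ)) :* t) refl _ _ _ _ ⟩
      W κ * asum term (suc k)
        ≈⟨ recurrence k ⟩
      V κ * asum term k
        ≈⟨ solve 4 (λ x y κ t → let o = con 1ℤ in
             κ :* y :* (o :- x :* κ) :* (o :- x :* y :* κ) :* t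
             := κ :* y :* (o :- x :* y :* κ) :* ((o :- x :* κ) :* t)) refl _ _ _ _ ⟩
      κ * y * (1# - x * y * κ) * ((1# - x * κ) * asum term k)
        ≈⟨ *-congˡ (trans (summation k) (*-congˡ (φ-unfold k))) ⟩
      κ * y * (1# - x * y * κ) * ((1# - x) * (Q^tri k * y ^ k) * (φ (suc k) * (1# - Q * κ)))
        ≈⟨ solve 6 (λ x y κ p z f → let o = con 1ℤ ; Q = y :* y in
             κ :* y :* (o :- x :* y :* κ) :* ((o :- x) :* (p :* z) :* (f :* (o :- Q :* κ)))
             := (o :- x :* y :* κ) :* (o :- Q :* κ) :* ((o :- x) :* (p :* κ :* (y :* z)) :* f)) refl _ _ _ _ _ _ ⟩
      (1# - x * y * κ) * (1# - Q * κ) * ((1# - x) * (Q^tri (suc k) * y ^ suc k) * φ (suc k))  ∎)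
      where
      κ = Q ^ k
      unit : (1# - x * y * κ) * (1# - Q * κ) * (iB k * iQ k) ≈ 1#
      unit = trans (solve 4 (λ a b c d → a :* b :* (c :* d) := a :* c :* (b :* d)) refl _ _ _ _)
        (trans (iB-inv k ⟨*⟩ iQ-inv k) (*-identityˡ 1#))

-- The terminating very-well-poised ₆φ₅ in base Q with leading parameter b and further parameters Q^(-n),
-- a b Q^n and ∞, up to a factor that clears the negative powers.
module VeryWellPoised {c ℓ : Level} (R : CommutativeRing c ℓ) (Q a b : CommutativeRing.Carrier R)
  (iQ ib : ℕ → CommutativeRing.Carrier R) where
  open CommutativeRing R
  open IntegerCoefficients R
  open SumsAndProducts R
  open QShifted R Q
  open Algebra.Properties.Semiring.Exp semiring
  open Relation.Binary.Reasoning.Setoid setoid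

  private
    φ = Π iQ

  -- With n = m + l, `poch a l` comes from the denominator (Q^(1 - n) / a; Q)_m by reversal, and the
  -- inverses of length n + m + 1 are those of (b; Q)_(n + 1) and of the denominator (b Q^(n + 1);
  -- Q)_m.
  term : ℕ → ℕ → Carrier
  term m l = sgn m * Q^tri m * φ m * φ l * (1# - b * (Q ^ m * Q ^ m)) * poch b m * poch a l
    * poch (a * b * (Q ^ m * Q ^ l)) m * Π ib (suc (m ℕ.+ m ℕ.+ l))

  -- The Wilf–Zeilberger certificate for the recurrence in n = m + l.
  cert : ℕ → ℕ → Carrier
  cert m l = sgn m * (Q^tri m * Q ^ m) * φ m * φ l * (poch b m * (1# - b * Q ^ m)) * poch a l
    * poch (a * b * Q * (Q ^ m * Q ^ l)) m * (1# - a * b * Q * (Q ^ m * Q ^ l) * (Q ^ m * Q ^ l))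
    * Π ib (suc (suc (m ℕ.+ m ℕ.+ l)))

  module _ (iQ-inv : ∀ i → (1# - Q * Q ^ i) * iQ i ≈ 1#)
           (ib-inv : ∀ i → (1# - b * Q ^ i) * ib i ≈ 1#) where

    private
      φ-unfold : ∀ n → φ n ≈ φ (suc n) * (1# - Q * Q ^ n)
      φ-unfold = Π-unfold _ iQ iQ-inv

      V : Carrier → Carrier
      V κ = - (a * κ)

      step : ∀ i l → (1# - Q * (Q ^ suc i * Q ^ l)) * term (suc i) (suc l) ≈
             V (Q ^ suc i * Q ^ l) * term (suc i) l + (cert (suc i) l - cert i (suc l))
      step i l = begin
        (1# - Q * κ) * term (suc i) (suc l)
          ≈⟨ *-congˡ (refl ⟨*⟩ (*-congʳ (poch-cong i eq₁)) ⟨*⟩ reflexive (≡.cong (Π ib) idx₁)) ⟩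
        _ ≈⟨ solve 13 (λ s p f g u v P n Q A L a b →
               let o = con 1ℤ ; κ = Q :* A :* L ; m = Q :* A
                   Z = o :- b :* (Q :* (Q :* (Q :* (A :* A :* L)))) in
               (o :- Q :* κ) :* ((:- o :* s) :* p :* f :* g :* (o :- b :* (m :* m)) :* u :* (v :* (o :- a :* L))
                 :* (P :* (o :- a :* b :* (m :* (Q :* L)) :* A)) :* n)
               := :- (a :* κ) :* ((:- o :* s) :* p :* f :* (g :* (o :- Q :* L)) :* (o :- b :* (m :* m)) :* u :* v
                 :* ((o :- a :* b :* κ) :* P) :* (n :* Z))
               :+ ((:- o :* s) :* (p :* m) :* f :* (g :* (o :- Q :* L)) :* (u :* (o :- b :* m)) :* v
                 :* (P :* (o :- a :* b :* Q :* κ :* A)) :* (o :- a :* b :* Q :* κ :* κ) :* n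
               :- s :* p :* (f :* (o :- Q :* A)) :* g :* u :* (v :* (o :- a :* L))
                 :* P :* (o :- a :* b :* Q :* κ :* κ) :* (n :* Z)))
               refl _ _ _ _ _ _ _ _ _ _ _ _ _ ⟩
        _ ≈⟨ +-cong
               (*-congˡ (refl ⟨*⟩ sym (φ-unfold l) ⟨*⟩ refl ⟨*⟩ refl ⟨*⟩ refl
                 ⟨*⟩ sym (trans (poch-head _ i) (*-congˡ (poch-cong i eq₂))) ⟨*⟩ sym (ib-unfold idx₂)))
               (+-cong (refl ⟨*⟩ sym (φ-unfold l) ⟨*⟩ refl ⟨*⟩ refl ⟨*⟩ refl ⟨*⟩ refl
                   ⟨*⟩ reflexive (≡.cong (Π ib) (≡.sym idx₃)))
                 (-‿cong (refl ⟨*⟩ sym (φ-unfold i) ⟨*⟩ refl ⟨*⟩ refl ⟨*⟩ refl ⟨*⟩ sym (poch-cong i eq₃) ⟨*⟩ eq₄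
                   ⟨*⟩ sym (ib-unfold idx₄)))) ⟩
        V κ * term (suc i) l + (cert (suc i) l - cert i (suc l))  ∎
        where
        κ = Q ^ suc i * Q ^ l
        eq₁ : a * b * (Q ^ suc i * Q ^ suc l) ≈ a * b * Q * κ
        eq₁ = solve 4 (λ c Q A M → c :* (Q :* A :* (Q :* M)) := c :* Q :* (Q :* A :* M)) refl _ _ _ _
        e = i ℕ.+ i ℕ.+ l
        idx₁ : suc (suc i ℕ.+ suc i ℕ.+ suc l) ≡ 4 ℕ.+ e
        idx₁ = ≡.cong (suc ∘ suc) (≡.trans (ℕ.+-suc (i ℕ.+ suc i) l) (≡.cong (λ z → suc (z ℕ.+ l)) (ℕ.+-suc i i)))
        idx₂ : suc (suc i ℕ.+ suc i ℕ.+ l) ≡ 3 ℕ.+ e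
        idx₂ = ≡.cong (λ z → suc (suc (z ℕ.+ l))) (ℕ.+-suc i i)
        idx₃ : suc (suc (suc i ℕ.+ suc i ℕ.+ l)) ≡ 4 ℕ.+ e
        idx₃ = ≡.cong suc idx₂
        idx₄ : suc (suc (i ℕ.+ i ℕ.+ suc l)) ≡ 3 ℕ.+ e
        idx₄ = ≡.cong (suc ∘ suc) (ℕ.+-suc (i ℕ.+ i) l)
        eq₂ : a * b * κ * Q ≈ a * b * Q * κ
        eq₂ = solve 3 (λ a κ Q → a :* κ :* Q := a :* Q :* κ) refl _ _ _
        eq₃ : a * b * Q * (Q ^ i * Q ^ suc l) ≈ a * b * Q * κ
        eq₃ = solve 4 (λ a Q A M → a :* Q :* (A :* (Q :* M)) := a :* Q :* (Q :* A :* M)) refl _ _ _ _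
        eq₄ : 1# - a * b * Q * κ * κ ≈ 1# - a * b * Q * (Q ^ i * Q ^ suc l) * (Q ^ i * Q ^ suc l)
        eq₄ = solve 4 (λ a Q A M → con 1ℤ :- a :* Q :* (Q :* A :* M) :* (Q :* A :* M)
                 := con 1ℤ :- a :* Q :* (A :* (Q :* M)) :* (A :* (Q :* M))) refl _ _ _ _
        ib-unfold : ∀ {n} → n ≡ 3 ℕ.+ e →
          Π ib n ≈ Π ib (4 ℕ.+ e) * (1# - b * (Q * (Q * (Q * (Q ^ i * Q ^ i * Q ^ l)))))
        ib-unfold ≡.refl = trans (Π-unfold _ ib ib-inv (3 ℕ.+ e)) (*-congˡ (+-congˡ (-‿cong (*-congˡ (*-congˡ (*-congˡ (*-congˡ
          (trans (^-homo-* Q (i ℕ.+ i) l) (*-congʳ (^-homo-* Q i i))))))))))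

      step-zero : ∀ l → (1# - Q * (Q ^ 0 * Q ^ l)) * term 0 (suc l) ≈
        V (Q ^ 0 * Q ^ l) * term 0 l + (cert 0 l - 0#)
      step-zero l = begin
        (1# - Q * (Q ^ 0 * Q ^ l)) * term 0 (suc l)
          ≈⟨ solve 7 (λ g v n Q L a b →
               let o = con 1ℤ ; κ = o :* L ; Z = o :- b :* (Q :* L) in
               (o :- Q :* κ) :* (o :* o :* o :* g :* (o :- b :* (o :* o)) :* o :* (v :* (o :- a :* L)) :* o :* n)
               := :- (a :* κ) :* (o :* o :* o :* (g :* (o :- Q :* L)) :* (o :- b :* (o :* o)) :* o :* v :* o :* (n :* Z))
               :+ (o :* (o :* o) :* o :* (g :* (o :- Q :* L)) :* (o :* (o :- b :* o)) :* v :* o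
                   :* (o :- a :* b :* Q :* κ :* κ) :* n :- con 0ℤ)) refl _ _ _ _ _ _ _ ⟩
        _ ≈⟨ +-cong (*-congˡ (refl ⟨*⟩ sym (φ-unfold l) ⟨*⟩ refl ⟨*⟩ refl ⟨*⟩ refl ⟨*⟩ refl
                      ⟨*⟩ sym (Π-unfold _ ib ib-inv (suc l))))
                    (+-congʳ (refl ⟨*⟩ sym (φ-unfold l) ⟨*⟩ refl ⟨*⟩ refl ⟨*⟩ refl ⟨*⟩ refl ⟨*⟩ refl)) ⟩
        V (Q ^ 0 * Q ^ l) * term 0 l + (cert 0 l - 0#)  ∎

      step-last : ∀ n → (1# - Q * Q ^ n) * term (suc n) 0 ≈ - cert n 0
      step-last n = begin
        (1# - Q * Q ^ n) * term (suc n) 0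
          ≈⟨ *-congˡ (refl ⟨*⟩ (*-congʳ (poch-cong n eq)) ⟨*⟩ reflexive (≡.cong (Π ib) idx)) ⟩
        _ ≈⟨ solve 10 (λ s p f u P n Q A a b → let o = con 1ℤ in
               (o :- Q :* A) :* (:- o :* s :* (p :* A) :* f :* o :* (o :- b :* (Q :* A :* (Q :* A)))
                 :* (u :* (o :- b :* A)) :* o :* (P :* (o :- a :* b :* (Q :* A :* o) :* A)) :* n)
               := :- (s :* (p :* A) :* (f :* (o :- Q :* A)) :* o :* (u :* (o :- b :* A)) :* o :* P
                 :* (o :- a :* b :* Q :* (A :* o) :* (A :* o)) :* (n :* (o :- b :* (Q :* (Q :* (A :* A :* o)))))))
               refl _ _ _ _ _ _ _ _ _ _ ⟩
        _ ≈⟨ -‿cong (refl ⟨*⟩ sym (φ-unfold n) ⟨*⟩ refl ⟨*⟩ refl ⟨*⟩ refl ⟨*⟩ refl ⟨*⟩ refl ⟨*⟩ sym ib-unfold) ⟩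
        - cert n 0  ∎
        where
        eq : a * b * (Q ^ suc n * Q ^ 0) ≈ a * b * Q * (Q ^ n * Q ^ 0)
        eq = solve 3 (λ a Q A → a :* (Q :* A :* con 1ℤ) := a :* Q :* (A :* con 1ℤ)) refl _ _ _
        idx : suc (suc n ℕ.+ suc n ℕ.+ 0) ≡ 3 ℕ.+ (n ℕ.+ n ℕ.+ 0)
        idx = ≡.cong (λ z → suc (suc (z ℕ.+ 0))) (ℕ.+-suc n n)
        ib-unfold : Π ib (2 ℕ.+ (n ℕ.+ n ℕ.+ 0)) ≈
          Π ib (3 ℕ.+ (n ℕ.+ n ℕ.+ 0)) * (1# - b * (Q * (Q * (Q ^ n * Q ^ n * Q ^ 0))))
        ib-unfold = trans (Π-unfold _ ib ib-inv (2 ℕ.+ (n ℕ.+ n ℕ.+ 0))) (*-congˡ (+-congˡ (-‿cong (*-congˡ (*-congˡ (*-congˡ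
          (trans (^-homo-* Q (n ℕ.+ n) 0) (*-congʳ (^-homo-* Q n n)))))))))

      recurrence : ∀ k → (1# - Q * Q ^ k) * asum term (suc k) ≈ V (Q ^ k) * asum term k
      recurrence k = begin
        (1# - Q * Q ^ k) * asum term (suc k)
          ≈⟨ asum-*ˡ _ term (suc k) ⟩
        asum (λ j m → (1# - Q * Q ^ k) * term j m) (suc k)
          ≈⟨ asum-telescope (λ j m → (1# - Q * Q ^ k) * term j m) (λ j m → V (Q ^ k) * term j m) cert cert′ k
               step′ (λ _ _ → refl) (step-last k) ⟩
        asum (λ j m → V (Q ^ k) * term j m) k - 0#  ≈⟨ solve 1 (λ z → z :- con 0ℤ := z) refl _ ⟩
        asum (λ j m → V (Q ^ k) * term j m) k       ≈⟨ asum-*ˡ _ term k ⟨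
        V (Q ^ k) * asum term k                     ∎
        where
        cert′ : ℕ → ℕ → Carrier
        cert′ zero    m = 0#
        cert′ (suc j) m = cert j (suc m)

        transport : ∀ {t t′ z} j m → j ℕ.+ m ≡ k →
          (1# - Q * (Q ^ j * Q ^ m)) * t ≈ V (Q ^ j * Q ^ m) * t′ + z →
          (1# - Q * Q ^ k) * t ≈ V (Q ^ k) * t′ + z
        transport j m ≡.refl e = trans (*-congʳ (+-congˡ (-‿cong (*-congˡ (^-homo-* Q j m)))))
          (trans e (+-congʳ (*-congʳ (-‿cong (*-congˡ (sym (^-homo-* Q j m)))))))

        step′ : ∀ j m → j ℕ.+ m ≡ k →
          (1# - Q * Q ^ k) * term j (suc m) ≈ V (Q ^ k) * term j m + (cert j m - cert′ j m)
        step′ zero    m e = transport 0 m e (step-zero m)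
        step′ (suc j) m e = transport (suc j) m e (step j m)

    -- The value is independent of b, so in Watson's transformation the leading parameter a Q^(2 j)
    -- of the inner sum leaves only the length of that sum behind.
    summation : ∀ n → asum term n ≈ (- a) ^ n * Q^tri n * φ n
    summation zero = trans (solve 2 (λ b i → let o = con 1ℤ in
        o :* o :* o :* o :* (o :- b :* (o :* o)) :* o :* o :* o :* (o :* i) := (o :- b :* o) :* i) refl b (ib 0))
      (trans (ib-inv 0) (solve 0 (con 1ℤ := con 1ℤ :* con 1ℤ :* con 1ℤ) refl))
    summation (suc n) = unit-cancel (iQ-inv n) (begin
      (1# - Q * Q ^ n) * asum term (suc n)
        ≈⟨ recurrence n ⟩
      - (a * Q ^ n) * asum term n
        ≈⟨ *-congˡ (trans (summation n) (*-congˡ (φ-unfold n))) ⟩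
      - (a * Q ^ n) * ((- a) ^ n * Q^tri n * (φ (suc n) * (1# - Q * Q ^ n)))
        ≈⟨ solve 6 (λ a A an t f Q → let o = con 1ℤ in
             :- (a :* A) :* (an :* t :* (f :* (o :- Q :* A))) := (o :- Q :* A) :* ((:- a) :* an :* (t :* A) :* f))
             refl _ _ _ _ _ _ ⟩
      (1# - Q * Q ^ n) * ((- a) ^ suc n * Q^tri (suc n) * φ (suc n))  ∎)

-- Watson's transformation of an ₈φ₇ in base Q = y² with leading parameter a = x² and further parameters
-- x, x y, a² Q^N, Q^(-N) and ∞, up to a factor that clears the negative powers.
module Watson {c ℓ : Level} (R : CommutativeRing c ℓ) (x y : CommutativeRing.Carrier R)
  (iQ iB iC ia : ℕ → CommutativeRing.Carrier R) where
  open CommutativeRing R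
  open IntegerCoefficients R
  open SumsAndProducts R
  open QShifted R (y * y)
  open Algebra.Properties.Semiring.Exp semiring
  open Relation.Binary.Reasoning.Setoid setoid
  module PS = QPfaffSaalschütz R x y iQ iB iC
  open PS using (φ; B) public

  private
    Q = y * y
    a = x * x

  -- The parameter x contributes (x; Q)_k / (x Q; Q)_k = (1 - x) / (1 - x Q^k), which removes one
  -- half of 1 - a Q^(2 k) = (1 - x Q^k) (1 + x Q^k). The parameter x y is paired with a Q / (x y) =
  -- x y and drops out.
  lhsTerm rhsTerm : Carrier → ℕ → ℕ → Carrier
  lhsTerm d k l = sgn k * (Q^tri k * y ^ k) * ((1# - x) * (1# + x * Q ^ k)) * φ k * φ l
    * poch a k * poch a l * poch d k * Π ia (suc (k ℕ.+ k ℕ.+ l))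
  rhsTerm d j r = (- a) ^ r * Q^tri r * φ j * φ r * poch d j * poch y j * B j

  module _ (iQ-inv : ∀ i → (1# - Q * Q ^ i) * iQ i ≈ 1#)
           (iB-inv : ∀ i → (1# - x * y * Q ^ i) * iB i ≈ 1#)
           (iC-inv : ∀ i → (1# - x * y * y * Q ^ i) * iC i ≈ 1#)
           (ia-inv : ∀ i → (1# - a * Q ^ i) * ia i ≈ 1#) where

    private
      sgn-square : ∀ j → sgn j * sgn j ≈ 1#
      sgn-square zero    = *-identityˡ 1#
      sgn-square (suc j) = trans (solve 1 (λ s → (:- con 1ℤ :* s) :* (:- con 1ℤ :* s) := s :* s) refl _) (sgn-square j)

      inner : Carrier → ℕ → ℕ → ℕ → Carrier
      inner d j m l = sgn (j ℕ.+ m) * (1# - a * (Q ^ (j ℕ.+ m) * Q ^ (j ℕ.+ m))) * φ l * poch a (j ℕ.+ m) * poch a l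
        * poch d (j ℕ.+ m) * Π ia (suc (j ℕ.+ m ℕ.+ (j ℕ.+ m) ℕ.+ l)) * PS.term j m

      expand : ∀ d k l → lhsTerm d k l ≈ asum (λ j m → inner d j m l) k
      expand d k l = begin
        lhsTerm d k l
          ≈⟨ solve 10 (λ s t x κ f g u v w i → let o = con 1ℤ in
               s :* t :* ((o :- x) :* (o :+ x :* κ)) :* f :* g :* u :* v :* w :* i
               := s :* (o :+ x :* κ) :* g :* u :* v :* w :* i :* ((o :- x) :* t :* f))
               refl _ _ _ _ _ _ _ _ _ _ ⟩
        sgn k * (1# + x * Q ^ k) * φ l * poch a k * poch a l * poch d k * Π ia (suc (k ℕ.+ k ℕ.+ l))
          * ((1# - x) * (Q^tri k * y ^ k) * φ k)
          -- The q-Pfaff-Saalschütz sum is read from right to left; its factor 1 - x Q^k restores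
          -- the very-well-poised 1 - a Q^(2 k).
          ≈⟨ *-congˡ (PS.summation iQ-inv iB-inv iC-inv k) ⟨
        _ ≈⟨ solve 9 (λ s x κ g u v w i z → let o = con 1ℤ in
               s :* (o :+ x :* κ) :* g :* u :* v :* w :* i :* ((o :- x :* κ) :* z)
               := s :* (o :- x :* x :* (κ :* κ)) :* g :* u :* v :* w :* i :* z)
               refl _ _ _ _ _ _ _ _ _ ⟩
        sgn k * (1# - a * (Q ^ k * Q ^ k)) * φ l * poch a k * poch a l * poch d k * Π ia (suc (k ℕ.+ k ℕ.+ l))
          * asum PS.term k
          ≈⟨ asum-*ˡ _ PS.term k ⟩
        _ ≈⟨ asum-cong k (λ { j m ≡.refl → refl }) ⟩
        asum (λ j m → inner d j m l) k  ∎

      module VWP (j : ℕ) = VeryWellPoised R Q a (a * Q ^ (j ℕ.+ j)) iQ (λ i → ia (j ℕ.+ j ℕ.+ i))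

      outer : Carrier → ℕ → Carrier
      outer d j = φ j * poch d j * poch y j * B j

      collect : ∀ N j m l → j ℕ.+ (m ℕ.+ l) ≡ N →
        inner (a * a * Q ^ N) j m l ≈ outer (a * a * Q ^ N) j * VWP.term j m l
      collect N j m l ≡.refl = begin
        inner d j m l
          ≈⟨ ^-homo-* (- 1#) j m ⟨*⟩ +-congˡ (-‿cong eq₁) ⟨*⟩ refl ⟨*⟩ refl ⟨*⟩ refl ⟨*⟩ poch-+ d j m
             ⟨*⟩ trans (reflexive (≡.cong (Π ia) idx)) (Π-+ ia (j ℕ.+ j) _) ⟨*⟩ refl ⟩
        _ ≈⟨ solve 16 (λ sj sm z g aj e al dj dm i₁ i₂ t f h p B →
               sj :* sm :* z :* g :* aj :* al :* (dj :* dm) :* (i₁ :* i₂) :* (sj :* t :* f :* h :* p :* e :* B)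
               := (sj :* sj) :* (aj :* e :* i₁) :* (f :* dj :* p :* B :* (sm :* t :* h :* g :* z :* al :* dm :* i₂)))
               refl (sgn j) _ _ _ _ (poch (a * (Q ^ j * Q ^ m)) j) _ _ _ (Π ia (j ℕ.+ j)) _ _ _ _ _ _ ⟩
        _ ≈⟨ sgn-square j ⟨*⟩ eq₂ ⟨*⟩ refl ⟩
        _ ≈⟨ solve 13 (λ f dj p B sm t h g z al r dm i →
               con 1ℤ :* r :* (f :* dj :* p :* B :* (sm :* t :* h :* g :* z :* al :* dm :* i))
               := f :* dj :* p :* B :* (sm :* t :* h :* g :* z :* r :* al :* dm :* i)) refl _ _ _ _ _ _ _ _ _ _ _ _ _ ⟩
        _ ≈⟨ *-congˡ (refl ⟨*⟩ poch-cong m eq₃ ⟨*⟩ refl) ⟩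
        outer d j * VWP.term j m l  ∎
        where
        d = a * a * Q ^ (j ℕ.+ (m ℕ.+ l))
        b = a * Q ^ (j ℕ.+ j)
        eq₁ : a * (Q ^ (j ℕ.+ m) * Q ^ (j ℕ.+ m)) ≈ b * (Q ^ m * Q ^ m)
        eq₁ = trans (*-congˡ (^-homo-* Q j m ⟨*⟩ ^-homo-* Q j m))
          (trans (solve 3 (λ a J M → a :* (J :* M :* (J :* M)) := a :* (J :* J) :* (M :* M)) refl _ _ _)
                 (*-congʳ (*-congˡ (sym (^-homo-* Q j j)))))
        -- (a; Q)_(j + m) (a Q^(j + m); Q)_j = (a; Q)_(2 j + m), of which the inverses remove the
        -- first 2 j factors.
        eq₂ : poch a (j ℕ.+ m) * poch (a * (Q ^ j * Q ^ m)) j * Π ia (j ℕ.+ j) ≈ poch b m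
        eq₂ = begin
          poch a (j ℕ.+ m) * poch (a * (Q ^ j * Q ^ m)) j * Π ia (j ℕ.+ j)
            ≈⟨ *-congʳ (*-congˡ (poch-cong j (*-congˡ (sym (^-homo-* Q j m))))) ⟩
          poch a (j ℕ.+ m) * poch (a * Q ^ (j ℕ.+ m)) j * Π ia (j ℕ.+ j)
            ≈⟨ *-congʳ (poch-+ a (j ℕ.+ m) j) ⟨
          poch a (j ℕ.+ m ℕ.+ j) * Π ia (j ℕ.+ j)
            ≈⟨ *-congʳ (trans (reflexive (≡.cong (poch a) (swap j m))) (poch-+ a (j ℕ.+ j) m)) ⟩
          poch a (j ℕ.+ j) * poch b m * Π ia (j ℕ.+ j)
            ≈⟨ solve 3 (λ p q r → p :* q :* r := p :* r :* q) refl _ _ _ ⟩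
          poch a (j ℕ.+ j) * Π ia (j ℕ.+ j) * poch b m
            ≈⟨ trans (*-congʳ (Π-inverse _ ia (j ℕ.+ j) ia-inv)) (*-identityˡ _) ⟩
          poch b m  ∎
          where
          swap : ∀ j m → j ℕ.+ m ℕ.+ j ≡ j ℕ.+ j ℕ.+ m
          swap = ℕ-Solver.solve 2 (λ j m → j :+ₙ m :+ₙ j :=ₙ j :+ₙ j :+ₙ m) ≡.refl
        -- This is the reason for d = a² Q^N: d Q^j must be the parameter a b Q^r of the inner sum,
        -- where r = m + l and b = a Q^(2 j).
        eq₃ : d * Q ^ j ≈ a * b * (Q ^ m * Q ^ l)
        eq₃ = trans (*-congʳ (*-congˡ (trans (^-homo-* Q j (m ℕ.+ l)) (*-congˡ (^-homo-* Q m l)))))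
          (trans (solve 4 (λ a J M L → a :* a :* (J :* (M :* L)) :* J := a :* (a :* (J :* J)) :* (M :* L)) refl _ _ _ _)
                 (*-congʳ (*-congˡ (*-congˡ (sym (^-homo-* Q j j))))))
        idx : suc (j ℕ.+ m ℕ.+ (j ℕ.+ m) ℕ.+ l) ≡ j ℕ.+ j ℕ.+ suc (m ℕ.+ m ℕ.+ l)
        idx = ℕ-Solver.solve 3 (λ j m l → conₙ 1 :+ₙ (j :+ₙ m :+ₙ (j :+ₙ m) :+ₙ l)
                :=ₙ j :+ₙ j :+ₙ (conₙ 1 :+ₙ (m :+ₙ m :+ₙ l))) ≡.refl j m l

    transformation : ∀ N → asum (lhsTerm (a * a * Q ^ N)) N ≈ asum (rhsTerm (a * a * Q ^ N)) N
    transformation N = begin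
      asum (lhsTerm d) N
        ≈⟨ asum-cong N (λ k l _ → expand d k l) ⟩
      asum (λ k l → asum (λ j m → inner d j m l) k) N
        ≈⟨ asum-assoc (inner d) N ⟩
      asum (λ j r → asum (λ m l → inner d j m l) r) N
        ≈⟨ asum-cong N sumInner ⟩
      asum (rhsTerm d) N  ∎
      where
      d = a * a * Q ^ N
      sumInner : ∀ j r → j ℕ.+ r ≡ N → asum (λ m l → inner d j m l) r ≈ rhsTerm d j r
      sumInner j r j+r≡N = begin
        asum (λ m l → inner d j m l) r
          ≈⟨ asum-cong r (λ { m l ≡.refl → collect N j m l j+r≡N }) ⟩
        asum (λ m l → outer d j * VWP.term j m l) r
          ≈⟨ asum-*ˡ (outer d j) (VWP.term j) r ⟨
        outer d j * asum (VWP.term j) r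
          ≈⟨ *-congˡ (VWP.summation j iQ-inv shifted-inv r) ⟩
        outer d j * ((- a) ^ r * Q^tri r * φ r)
          ≈⟨ solve 7 (λ f d p B s t g → f :* d :* p :* B :* (s :* t :* g) := s :* t :* f :* g :* d :* p :* B)
               refl _ _ _ _ _ _ _ ⟩
        rhsTerm d j r  ∎
        where
        shifted-inv : ∀ i → (1# - a * Q ^ (j ℕ.+ j) * Q ^ i) * ia (j ℕ.+ j ℕ.+ i) ≈ 1#
        shifted-inv i = trans (*-congʳ (+-congˡ (-‿cong (trans (*-assoc _ _ _) (*-congˡ (sym (^-homo-* Q (j ℕ.+ j) i)))))))
          (ia-inv (j ℕ.+ j ℕ.+ i))

-- Which exponents of q are divisible by n

module Residues (d N : ℕ) (0<d : 0 ℕ.< d) (2∤n : ¬ (2 ∣ suc (N ℕ.* d))) where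

  private
    n = suc (N ℕ.* d)

  ∣∧<⇒≡0 : ∀ {m k} → k ∣ m → m ℕ.< k → m ≡ 0
  ∣∧<⇒≡0 {zero}  k∣m m<k = ≡.refl
  ∣∧<⇒≡0 {suc m} k∣m m<k = contradiction k∣m (>⇒∤ m<k)

  coprime-d : Coprimality.Coprime n d
  coprime-d {i} (i∣n , i∣d) = ∣1⇒≡1 (∣m+n∣m⇒∣n (≡.subst (i ∣_) (ℕ.+-comm 1 (N ℕ.* d)) i∣n) (∣n⇒∣m*n N i∣d))

  coprime-2 : Coprimality.Coprime n 2
  coprime-2 {zero}              (_ , 0∣2) = contradiction (0∣⇒≡0 0∣2) λ ()
  coprime-2 {suc zero}          _         = ≡.refl
  coprime-2 {suc (suc zero)}    (2∣n , _) = contradiction 2∣n 2∤n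
  coprime-2 {suc (suc (suc i))} (_ , i∣2) = contradiction i∣2 (>⇒∤ (s≤s (s≤s (s≤s z≤n))))

  N≤N*d : N ℕ.≤ N ℕ.* d
  N≤N*d = ℕ.m≤m*n N d {{ℕ.>-nonZero 0<d}}

  n∤2dj : ∀ {j} → 0 ℕ.< j → j ℕ.< n → ¬ (n ∣ 2 ℕ.* d ℕ.* j)
  n∤2dj {j} 0<j j<n n∣ = >⇒∤ {{ℕ.>-nonZero 0<j}} j<n (Coprimality.coprime-divisor coprime-d (Coprimality.coprime-divisor coprime-2
    (≡.subst (n ∣_) (ℕ.*-assoc 2 d j) n∣)))

  -- Halving is allowed because n is odd, and 1 + d m lies strictly between 0 and n.
  n∤2+2dm : ∀ {m} → m ℕ.< N → ¬ (n ∣ 2 ℕ.+ 2 ℕ.* d ℕ.* m)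
  n∤2+2dm {m} m<N n∣ = >⇒∤ (s≤s dm<Nd) (Coprimality.coprime-divisor coprime-2 (≡.subst (n ∣_) eq n∣))
    where
    dm<Nd : d ℕ.* m ℕ.< N ℕ.* d
    dm<Nd = ≡.subst (ℕ._< N ℕ.* d) (ℕ.*-comm m d) (ℕ.*-monoˡ-< d {{ℕ.>-nonZero 0<d}} m<N)
    eq : 2 ℕ.+ 2 ℕ.* d ℕ.* m ≡ 2 ℕ.* suc (d ℕ.* m)
    eq = ℕ-Solver.solve 2 (λ d m → conₙ 2 :+ₙ conₙ 2 :*ₙ d :*ₙ m :=ₙ conₙ 2 :*ₙ (conₙ 1 :+ₙ d :*ₙ m)) ≡.refl d m

  -- Since 2 + 2 d N = 2 n, the factors of (a; Q) beyond index N have, modulo n, the exponents of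
  -- (Q; Q).
  n∣2n+ : ∀ {m} → n ∣ 2 ℕ.+ 2 ℕ.* d ℕ.* (N ℕ.+ m) → n ∣ 2 ℕ.* d ℕ.* m
  n∣2n+ {m} n∣ = ∣m+n∣m⇒∣n (≡.subst (n ∣_) eq n∣) (∣n⇒∣m*n 2 (∣-refl {n}))
    where
    eq : 2 ℕ.+ 2 ℕ.* d ℕ.* (N ℕ.+ m) ≡ 2 ℕ.* n ℕ.+ 2 ℕ.* d ℕ.* m
    eq = ℕ-Solver.solve 3 (λ d N m → conₙ 2 :+ₙ conₙ 2 :*ₙ d :*ₙ (N :+ₙ m)
           :=ₙ conₙ 2 :*ₙ (conₙ 1 :+ₙ N :*ₙ d) :+ₙ conₙ 2 :*ₙ d :*ₙ m) ≡.refl d N m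

  -- N d ≡ -1 modulo n, so d j + 1 ≡ 0 forces j ≡ N.
  n∤dj+1 : ∀ {j} → j ℕ.≤ N ℕ.+ N → j ≢ N → ¬ (n ∣ d ℕ.* j ℕ.+ 1)
  n∤dj+1 {j} j≤2N j≢N n∣ with ℕ.≤-total j N
  ... | inj₁ j≤N = j≢N (ℕ.≤-antisym j≤N (ℕ.m∸n≡0⇒m≤n (∣∧<⇒≡0
      (∣m+n∣m⇒∣n (≡.subst (n ∣_) eq (∣n⇒∣m*n N n∣)) (∣m⇒∣m*n j (∣-refl {n})))
      (s≤s (ℕ.≤-trans (ℕ.m∸n≤m N j) N≤N*d)))))
    where
    eq : N ℕ.* (d ℕ.* j ℕ.+ 1) ≡ n ℕ.* j ℕ.+ (N ℕ.∸ j)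
    eq = ≡.trans (expand (≡.sym (ℕ.m+[n∸m]≡n j≤N)))
      (ℕ-Solver.solve 4 (λ N d j k → N :*ₙ (d :*ₙ j) :+ₙ (j :+ₙ k) :=ₙ (conₙ 1 :+ₙ N :*ₙ d) :*ₙ j :+ₙ k) ≡.refl N d j (N ℕ.∸ j))
      where
      expand : ∀ {k} → N ≡ k → N ℕ.* (d ℕ.* j ℕ.+ 1) ≡ N ℕ.* (d ℕ.* j) ℕ.+ k
      expand N≡k = ≡.trans (ℕ-Solver.solve 2 (λ N e → N :*ₙ (e :+ₙ conₙ 1) :=ₙ N :*ₙ e :+ₙ N) ≡.refl N (d ℕ.* j))
        (≡.cong (N ℕ.* (d ℕ.* j) ℕ.+_) N≡k)
  ... | inj₂ N≤j = j≢N (ℕ.≤-antisym (ℕ.m∸n≡0⇒m≤n (∣∧<⇒≡0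
      (∣m+n∣m⇒∣n (≡.subst (n ∣_) eq (∣m⇒∣m*n j (∣-refl {n}))) (∣n⇒∣m*n N n∣))
      (s≤s (ℕ.≤-trans (ℕ.m≤n+o⇒m∸n≤o j N j≤2N) N≤N*d)))) N≤j)
    where
    eq : n ℕ.* j ≡ N ℕ.* (d ℕ.* j ℕ.+ 1) ℕ.+ (j ℕ.∸ N)
    eq = ≡.trans (≡.cong (ℕ._+ N ℕ.* d ℕ.* j) (≡.sym (ℕ.m+[n∸m]≡n N≤j)))
      (ℕ-Solver.solve 4 (λ N d j k → N :+ₙ k :+ₙ N :*ₙ d :*ₙ j :=ₙ N :*ₙ (d :*ₙ j :+ₙ conₙ 1) :+ₙ k) ≡.refl N d j (j ℕ.∸ N))

-- Congruences with cofactors in a subring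

record IsSubring {c ℓ o : Level} (R : CommutativeRing c ℓ) (O : CommutativeRing.Carrier R → Set o) : Set (c ⊔ ℓ ⊔ o) where
  open CommutativeRing R
  field
    resp     : ∀ {u v} → u ≈ v → O u → O v
    1-closed : O 1#
    +-closed : ∀ {u v} → O u → O v → O (u + v)
    *-closed : ∀ {u v} → O u → O v → O (u * v)
    -‿closed : ∀ {u} → O u → O (- u)

module Ideals {c ℓ o : Level} (R : CommutativeRing c ℓ) (O : CommutativeRing.Carrier R → Set o)
  (isSubring : IsSubring R O) where
  open CommutativeRing R
  open IntegerCoefficients R
  open SumsAndProducts R
  open Algebra.Properties.Ring ring
  open Algebra.Properties.Semiring.Exp semiring
  open IsSubring isSubring public

  0-closed : O 0#
  0-closed = resp (-‿inverseʳ 1#) (+-closed 1-closed (-‿closed 1-closed))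

  ^-closed : ∀ {u} n → O u → O (u ^ n)
  ^-closed zero    ou = 1-closed
  ^-closed (suc n) ou = *-closed ou (^-closed n ou)

  Π-closed : ∀ {f} n → (∀ i → i ℕ.< n → O (f i)) → O (Π f n)
  Π-closed zero    of = 1-closed
  Π-closed (suc n) of = *-closed (Π-closed n (λ i i<n → of i (ℕ.m<n⇒m<1+n i<n))) (of n (ℕ.n<1+n n))

  -- The one factor outside O is repaired by z. `O z` is asked for as well, since i₀ may lie beyond
  -- the range of the product.
  Π-closed-except : ∀ {f z} n i₀ → (∀ i → i ℕ.< n → i ≢ i₀ → O (f i)) → O z → O (z * f i₀) → O (z * Π f n)
  Π-closed-except {f} {z} zero    i₀ of oz ozf = *-closed oz 1-closed
  Π-closed-except {f} {z} (suc n) i₀ of oz ozf with n ℕ.≟ i₀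
  ... | yes ≡.refl = resp (solve 3 (λ z p g → p :* (z :* g) := z :* (p :* g)) refl z (Π f n) (f n))
          (*-closed (Π-closed n (λ i i<n → of i (ℕ.m<n⇒m<1+n i<n) (ℕ.<⇒≢ i<n))) ozf)
  ... | no n≢i₀    = resp (*-assoc z _ _) (*-closed
          (Π-closed-except n i₀ (λ i i<n → of i (ℕ.m<n⇒m<1+n i<n)) oz ozf) (of n (ℕ.n<1+n n) n≢i₀))

  infix 4 _∈⟨_⟩ _≡_[_]

  -- The cofactor has to lie in O: among power series E is a unit, so membership in the ideal it
  -- generates there would say nothing.
  _∈⟨_⟩ : Carrier → Carrier → Set (c ⊔ ℓ ⊔ o)
  u ∈⟨ e ⟩ = Σ Carrier λ v → O v × u ≈ e * v

  _≡_[_] : Carrier → Carrier → Carrier → Set (c ⊔ ℓ ⊔ o)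
  u ≡ v [ e ] = u - v ∈⟨ e ⟩

  ∈-resp : ∀ {u v e} → u ≈ v → u ∈⟨ e ⟩ → v ∈⟨ e ⟩
  ∈-resp u≈v (w , ow , eq) = w , ow , trans (sym u≈v) eq

  ∈-0 : ∀ {e} → 0# ∈⟨ e ⟩
  ∈-0 = 0# , 0-closed , sym (zeroʳ _)

  ∈-+ : ∀ {u v e} → u ∈⟨ e ⟩ → v ∈⟨ e ⟩ → u + v ∈⟨ e ⟩
  ∈-+ (w , ow , p) (z , oz , r) = w + z , +-closed ow oz , trans (+-cong p r) (sym (distribˡ _ _ _))

  ∈-* : ∀ {u v e f} → u ∈⟨ e ⟩ → v ∈⟨ f ⟩ → u * v ∈⟨ e * f ⟩
  ∈-* (w , ow , p) (z , oz , r) = w * z , *-closed ow oz , trans (p ⟨*⟩ r)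
    (solve 4 (λ e w f z → e :* w :* (f :* z) := e :* f :* (w :* z)) refl _ _ _ _)

  ∈-*ʳ : ∀ {u v e} → u ∈⟨ e ⟩ → O v → u * v ∈⟨ e ⟩
  ∈-*ʳ {v = v} (w , ow , p) ov = w * v , *-closed ow ov , trans (*-congʳ p) (*-assoc _ _ _)

  ∈-*ˡ : ∀ {u v e} → O u → v ∈⟨ e ⟩ → u * v ∈⟨ e ⟩
  ∈-*ˡ ou v∈ = ∈-resp (*-comm _ _) (∈-*ʳ v∈ ou)

  ∈-Σ< : ∀ {f e} n → (∀ i → i ℕ.< n → f i ∈⟨ e ⟩) → Σ< f n ∈⟨ e ⟩
  ∈-Σ< zero    f∈ = ∈-0
  ∈-Σ< (suc n) f∈ = ∈-+ (∈-Σ< n (λ i i<n → f∈ i (ℕ.m<n⇒m<1+n i<n))) (f∈ n (ℕ.n<1+n n))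

  ≡[]-reflexive : ∀ {u v e} → u ≈ v → u ≡ v [ e ]
  ≡[]-reflexive {v = v} u≈v = ∈-resp (sym (trans (+-congʳ u≈v) (-‿inverseʳ v))) ∈-0

  ≡[]-sym : ∀ {u v e} → u ≡ v [ e ] → v ≡ u [ e ]
  ≡[]-sym {u} {v} (w , ow , p) = - w , -‿closed ow , trans (solve 2 (λ u v → v :- u := :- (u :- v)) refl u v)
    (trans (-‿cong p) (-‿distribʳ-* _ _))

  ≡[]-trans : ∀ {u v w e} → u ≡ v [ e ] → v ≡ w [ e ] → u ≡ w [ e ]
  ≡[]-trans p r = ∈-resp (solve 3 (λ u v w → (u :- v) :+ (v :- w) := u :- w) refl _ _ _) (∈-+ p r)

  ≡[]-+ : ∀ {u u′ v v′ e} → u ≡ u′ [ e ] → v ≡ v′ [ e ] → u + v ≡ u′ + v′ [ e ]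
  ≡[]-+ p r = ∈-resp (solve 4 (λ u u′ v v′ → (u :- u′) :+ (v :- v′) := (u :+ v) :- (u′ :+ v′)) refl _ _ _ _) (∈-+ p r)

  ≡[]-* : ∀ {u u′ v v′ e} → O v → O u′ → u ≡ u′ [ e ] → v ≡ v′ [ e ] → u * v ≡ u′ * v′ [ e ]
  ≡[]-* ov ou′ p r = ∈-resp (solve 4 (λ u u′ v v′ → (u :- u′) :* v :+ u′ :* (v :- v′) := u :* v :- u′ :* v′) refl _ _ _ _)
    (∈-+ (∈-*ʳ p ov) (∈-*ˡ ou′ r))

  ≡[]-*ˡ : ∀ {u v w e} → O w → u ≡ v [ e ] → w * u ≡ w * v [ e ]
  ≡[]-*ˡ ow p = ∈-resp (solve 3 (λ u v w → w :* (u :- v) := w :* u :- w :* v) refl _ _ _) (∈-*ˡ ow p)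

  ≡[]-Σ< : ∀ {f g e} n → (∀ i → i ℕ.< n → f i ≡ g i [ e ]) → Σ< f n ≡ Σ< g n [ e ]
  ≡[]-Σ< zero    eq = ≡[]-reflexive refl
  ≡[]-Σ< (suc n) eq = ≡[]-+ (≡[]-Σ< n (λ i i<n → eq i (ℕ.m<n⇒m<1+n i<n))) (eq n (ℕ.n<1+n n))

  ≡[]-Π : ∀ {f g e} n → (∀ i → i ℕ.< n → O (f i)) → (∀ i → i ℕ.< n → O (g i)) →
    (∀ i → i ℕ.< n → f i ≡ g i [ e ]) → Π f n ≡ Π g n [ e ]
  ≡[]-Π zero    of og eq = ≡[]-reflexive refl
  ≡[]-Π (suc n) of og eq = ≡[]-* (of n (ℕ.n<1+n n)) (Π-closed n (λ i → og i ∘ ℕ.m<n⇒m<1+n))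
    (≡[]-Π n (λ i → of i ∘ ℕ.m<n⇒m<1+n) (λ i → og i ∘ ℕ.m<n⇒m<1+n) (λ i → eq i ∘ ℕ.m<n⇒m<1+n)) (eq n (ℕ.n<1+n n))

  ≡[]-truncate : ∀ {f e} m n → m ℕ.≤ n → (∀ i → m ℕ.≤ i → i ℕ.< n → f i ∈⟨ e ⟩) → Σ< f n ≡ Σ< f m [ e ]
  ≡[]-truncate m zero    ℕ.z≤n f∈ = ≡[]-reflexive refl
  ≡[]-truncate {f} m (suc n) m≤1+n f∈ with ℕ.m≤n⇒m<n∨m≡n m≤1+n
  ... | inj₂ ≡.refl      = ≡[]-reflexive refl
  ... | inj₁ (ℕ.s≤s m≤n) = ∈-resp (solve 3 (λ s g t → (s :- t) :+ g := (s :+ g) :- t) refl _ _ _)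
          (∈-+ (≡[]-truncate m n m≤n (λ i m≤i i<n → f∈ i m≤i (ℕ.m<n⇒m<1+n i<n))) (f∈ n m≤n (ℕ.n<1+n n)))

parity : ∀ n → ∃ λ m → n ≡ 2 ℕ.* m ⊎ n ≡ suc (2 ℕ.* m)
parity zero    = 0 , inj₁ ≡.refl
parity (suc n) with parity n
... | m , inj₁ e = m , inj₂ (≡.cong suc e)
... | m , inj₂ e = suc m , inj₁ (≡.trans (≡.cong suc e) (≡.sym (ℕ.*-suc 2 m)))

-- The congruence for the triple sum

module TruncatedSum {ℓ₁ ℓ₂ o : Level} (R : CommutativeRing ℓ₁ ℓ₂) (O : CommutativeRing.Carrier R → Set o)
  (isSubring : IsSubring R O) (q : CommutativeRing.Carrier R) (inv : ℕ → CommutativeRing.Carrier R) (d N : ℕ) where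
  open CommutativeRing R
  open IntegerCoefficients R
  open SumsAndProducts R
  open Ideals R O isSubring
  open Algebra.Properties.Semiring.Exp semiring
  open Relation.Binary.Reasoning.Setoid setoid

  n : ℕ
  n = suc (N ℕ.* d)

  y Q a ρ w E : Carrier
  y = q ^ d
  Q = y * y
  a = q * q
  ρ = q ^ (2 ℕ.* (d ℕ.∸ 1))
  w = a * Q ^ N
  E = 1# - w

  iQ iB iC ia : ℕ → Carrier
  iQ i = inv (2 ℕ.* d ℕ.+ 2 ℕ.* d ℕ.* i)
  iB i = inv (d ℕ.+ 1 ℕ.+ 2 ℕ.* d ℕ.* i)
  iC i = inv (2 ℕ.* d ℕ.+ 1 ℕ.+ 2 ℕ.* d ℕ.* i)
  ia i = inv (2 ℕ.+ 2 ℕ.* d ℕ.* i)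

  open QShifted R Q public
  module W = Watson R q y iQ iB iC ia
  open W using (φ; B)

  -- `inv 2` inverts 1 - q², so (1 - q) `inv 2` stands for 1 / (1 + q). The last bracket holds the
  -- two copies of (a; Q)_k and of 1 / (Q; Q)_k that will be replaced, together with the power of ρ.
  c : ℕ → Carrier
  c k = sgn k * (Q^tri k * y ^ k) * ((1# + q * Q ^ k) * (1# - q) * inv 2) * φ k * poch a k
    * (poch a k * poch a k * (φ k * φ k) * ρ ^ k)

  t : ℕ → Carrier
  t k = poch a k * poch a k * poch y k * ρ ^ k * (B k * φ k)

  [n] : Carrier
  [n] = E * inv 2

  S rhs : Carrier
  S = Σ< c (suc N)
  rhs = [n] * ((- a) ^ N * Q^tri N) * Σ< t (suc N)

  tripleSum : ℕ → Carrier
  tripleSum n = Σ< (λ i → Σ< (λ j → Σ< (λ s → c i * c j * c s) (n ℕ.∸ i ℕ.∸ j)) (n ℕ.∸ i)) n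

  private
    -- This is w a, the partner of a / w = Q^(-N), and at the same time the parameter a² Q^N of
    -- Watson's transformation.
    D : Carrier
    D = a * a * Q ^ N

    -- Since a / w = Q^(-N), the factors 1 - (a / w) Q^i and 1 - (Q / w) Q^i are monomials times 1 -
    -- Q σ and 1 - a σ. The quotient of the two monomials is a / Q, which ρ cancels; hence no ρ in
    -- `g̃` and `h̃`.
    σ : ℕ → Carrier
    σ i = Q ^ (N ℕ.∸ suc i)

    -- g and h are the factors of the given terms, g̃ and h̃ those of the terms after the replacement.
    base : ℕ → Carrier
    base k = sgn k * (Q^tri k * y ^ k) * ((1# + q * Q ^ k) * (1# - q) * inv 2) * φ k * poch a k

    g g̃ : ℕ → Carrier
    g i = (1# - a * Q ^ i) * (1# - a * Q ^ i) * (iQ i * iQ i) * ρ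
    g̃ i = (1# - Q * σ i) * (1# - D * Q ^ i) * (ia (N ℕ.∸ suc i) * ia (suc N ℕ.+ i))

    h h̃ : ℕ → Carrier
    h i = - a * σ i * ((1# - a * Q ^ i) * (1# - a * Q ^ i)) * ρ
    h̃ i = (1# - Q * σ i) * (1# - D * Q ^ i)

    -- `[n]` is grouped with `B k` because `B k` alone may contain the inverse of 1 - q^n.
    base′ : ℕ → ℕ → Carrier
    base′ k l = (- a) ^ l * Q^tri l * φ k * poch y k * ([n] * B k)

    -- The identity for s v = w is used twice: with s = Q σ, v = a A in the numerators and with s =
    -- a σ, v = Q A in the denominators. Apart from multiples of the square there remains ρ a σ - Q
    -- σ, which ρ a = Q annihilates.
    key : ∀ σ Q A a ρ W X₁ X₂ Y → W ≈ σ * (Q * A) → ρ * a ≈ Q →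
      (1# - a * σ) * X₁ ≈ 1# → (1# - a * (Q * W * A)) * X₂ ≈ 1# → (1# - Q * A) * Y ≈ 1# →
      (1# - Q * σ) * (1# - a * a * W * A) * (X₁ * X₂) - (1# - a * A) * (1# - a * A) * (Y * Y) * ρ
      ≈ (1# - a * W) * (1# - a * W)
        * (X₁ * X₂ * (Y * Y) * ((1# - Q * A) * (1# - Q * A) - ρ * ((1# - a * A) * (1# - a * A))))
    key σ Q A a ρ W X₁ X₂ Y W≈ ρa≈Q i₁ i₂ i₃ = begin
      (1# - Q * σ) * (1# - a * a * W * A) * (X₁ * X₂) - (1# - a * A) * (1# - a * A) * (Y * Y) * ρ
        ≈⟨ +-cong (sym (*-identityʳ _)) (-‿cong (sym (*-identityʳ _))) ⟩
      (1# - Q * σ) * (1# - a * a * W * A) * (X₁ * X₂) * 1# - (1# - a * A) * (1# - a * A) * (Y * Y) * ρ * 1#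
        -- Each 1 is expanded into the denominators of the other fraction, multiplied by their
        -- inverses, so that both fractions get a common denominator.
        ≈⟨ +-cong ((*-congʳ (*-congˡ (+-congˡ (-‿cong (*-congʳ (*-congˡ W≈)))))) ⟨*⟩ sym (one i₃ i₃))
             (-‿cong (*-congˡ (sym (one i₁ (trans (*-congʳ (+-congˡ (-‿cong (*-congˡ (*-congʳ (*-congˡ (sym W≈))))))) i₂))))) ⟩
      -- The solver cannot use ρ a = Q, so this equation enters through an explicit multiple of ρ a
      -- - Q.
      _ ≈⟨ solve 8 (λ σ Q A a ρ X₁ X₂ Y → let o = con 1ℤ ; W = σ :* (Q :* A) in
             (o :- Q :* σ) :* (o :- a :* a :* W :* A) :* (X₁ :* X₂) :* ((o :- Q :* A) :* Y :* ((o :- Q :* A) :* Y))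
               :- (o :- a :* A) :* (o :- a :* A) :* (Y :* Y) :* ρ
                  :* ((o :- a :* σ) :* X₁ :* ((o :- a :* (Q :* W :* A)) :* X₂))
             := (o :- a :* W) :* (o :- a :* W)
                  :* (X₁ :* X₂ :* (Y :* Y) :* ((o :- Q :* A) :* (o :- Q :* A) :- ρ :* ((o :- a :* A) :* (o :- a :* A))))
               :+ (ρ :* a :- Q) :* (σ :* X₁ :* X₂ :* (Y :* Y)
                  :* ((o :- a :* A) :* (o :- a :* A) :* ((o :- Q :* A) :* (o :- Q :* A)))))
             refl σ Q A a ρ X₁ X₂ Y ⟩
      _ ≈⟨ +-cong (*-congʳ (sym eW ⟨*⟩ sym eW)) (*-congʳ (trans (+-congʳ ρa≈Q) (-‿inverseʳ Q))) ⟩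
      _ ≈⟨ solve 2 (λ u v → u :+ con 0ℤ :* v := u) refl _ _ ⟩
      (1# - a * W) * (1# - a * W)
        * (X₁ * X₂ * (Y * Y) * ((1# - Q * A) * (1# - Q * A) - ρ * ((1# - a * A) * (1# - a * A))))  ∎
      where
      one : ∀ {u v} → u ≈ 1# → v ≈ 1# → u * v ≈ 1#
      one p r = trans (p ⟨*⟩ r) (*-identityˡ 1#)
      eW : 1# - a * W ≈ 1# - a * (σ * (Q * A))
      eW = +-congˡ (-‿cong (*-congˡ W≈))

    key′ : ∀ σ Q A a ρ W → W ≈ σ * (Q * A) → ρ * a ≈ Q →
      (1# - Q * σ) * (1# - a * a * W * A) - - a * σ * ((1# - a * A) * (1# - a * A)) * ρ
      ≈ (1# - a * W) * (1# - a * W) * 1#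
    key′ σ Q A a ρ W W≈ ρa≈Q = begin
      (1# - Q * σ) * (1# - a * a * W * A) - - a * σ * ((1# - a * A) * (1# - a * A)) * ρ
        ≈⟨ +-congʳ (*-congˡ (+-congˡ (-‿cong (*-congʳ (*-congˡ W≈))))) ⟩
      _ ≈⟨ solve 5 (λ σ Q A a ρ → let o = con 1ℤ ; W = σ :* (Q :* A) in
             (o :- Q :* σ) :* (o :- a :* a :* W :* A) :- :- a :* σ :* ((o :- a :* A) :* (o :- a :* A)) :* ρ
             := (o :- a :* W) :* (o :- a :* W) :* o :+ (ρ :* a :- Q) :* (σ :* ((o :- a :* A) :* (o :- a :* A))))
             refl σ Q A a ρ ⟩
      _ ≈⟨ +-cong (*-congʳ (sym eW ⟨*⟩ sym eW)) (*-congʳ (trans (+-congʳ ρa≈Q) (-‿inverseʳ Q))) ⟩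
      _ ≈⟨ solve 2 (λ u v → u :+ con 0ℤ :* v := u) refl _ _ ⟩
      (1# - a * W) * (1# - a * W) * 1#  ∎
      where
      eW : 1# - a * W ≈ 1# - a * (σ * (Q * A))
      eW = +-congˡ (-‿cong (*-congˡ W≈))

    σ-spec : ∀ {i} → i ℕ.< N → Q ^ N ≈ σ i * (Q * Q ^ i)
    σ-spec {i} i<N = trans (reflexive (≡.cong (Q ^_) (≡.sym (ℕ.m∸n+n≡m i<N)))) (^-homo-* Q (N ℕ.∸ suc i) (suc i))

  module _ (inverse : ∀ e → 0 ℕ.< e → (1# - q ^ e) * inv e ≈ 1#) (3≤d : 3 ℕ.≤ d) where

    private
      0<d : 0 ℕ.< d
      0<d = ℕ.≤-trans (s≤s z≤n) 3≤d

      ρa≈Q : ρ * a ≈ Q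
      ρa≈Q = begin
        q ^ (2 ℕ.* (d ℕ.∸ 1)) * (q * q)           ≈⟨ *-congˡ (*-congˡ (*-identityʳ q)) ⟨
        q ^ (2 ℕ.* (d ℕ.∸ 1)) * q ^ 2             ≈⟨ ^-homo-* q (2 ℕ.* (d ℕ.∸ 1)) 2 ⟨
        q ^ (2 ℕ.* (d ℕ.∸ 1) ℕ.+ 2)               ≡⟨ ≡.cong (q ^_) (eq d 0<d) ⟩
        q ^ (d ℕ.+ d)                             ≈⟨ ^-homo-* q d d ⟩
        Q                                         ∎
        where
        eq : ∀ d → 0 ℕ.< d → 2 ℕ.* (d ℕ.∸ 1) ℕ.+ 2 ≡ d ℕ.+ d
        eq (suc d) _ = ℕ-Solver.solve 1 (λ d → conₙ 2 :*ₙ d :+ₙ conₙ 2 :=ₙ (conₙ 1 :+ₙ d) :+ₙ (conₙ 1 :+ₙ d)) ≡.refl d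

    power-2d : q ^ (2 ℕ.* d) ≈ Q
    power-2d = trans (reflexive (≡.cong (λ z → q ^ (d ℕ.+ z)) (ℕ.+-identityʳ d))) (^-homo-* q d d)

    power-+2d* : ∀ e i → q ^ (e ℕ.+ 2 ℕ.* d ℕ.* i) ≈ q ^ e * Q ^ i
    power-+2d* e i = trans (^-homo-* q e _) (*-congˡ (trans (sym (^-assocʳ q (2 ℕ.* d) i)) (^-congˡ i power-2d)))

    power-2 : q ^ 2 ≈ a
    power-2 = *-congˡ (*-identityʳ q)

    power-d+1 : q ^ (d ℕ.+ 1) ≈ q * y
    power-d+1 = reflexive (≡.cong (q ^_) (ℕ.+-comm d 1))

    power-2d+1 : q ^ (2 ℕ.* d ℕ.+ 1) ≈ q * y * y
    power-2d+1 = trans (reflexive (≡.cong (q ^_) (ℕ.+-comm (2 ℕ.* d) 1)))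
      (trans (*-congˡ power-2d) (sym (*-assoc q y y)))

    private
      inverse′ : ∀ {u} e i → 0 ℕ.< e → q ^ e ≈ u → (1# - u * Q ^ i) * inv (e ℕ.+ 2 ℕ.* d ℕ.* i) ≈ 1#
      inverse′ e i 0<e e≈u = trans (*-congʳ (+-congˡ (-‿cong (trans (*-congʳ (sym e≈u)) (sym (power-+2d* e i))))))
        (inverse _ (ℕ.<-≤-trans 0<e (ℕ.m≤m+n e _)))

      0<+1 : ∀ e → 0 ℕ.< e ℕ.+ 1
      0<+1 e = ℕ.m≤n+m 1 e

      iQ-inv : ∀ i → (1# - Q * Q ^ i) * iQ i ≈ 1#
      iQ-inv i = inverse′ (2 ℕ.* d) i (ℕ.<-≤-trans 0<d (ℕ.m≤m+n d _)) power-2d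

      iB-inv : ∀ i → (1# - q * y * Q ^ i) * iB i ≈ 1#
      iB-inv i = inverse′ (d ℕ.+ 1) i (0<+1 d) power-d+1

      iC-inv : ∀ i → (1# - q * y * y * Q ^ i) * iC i ≈ 1#
      iC-inv i = inverse′ (2 ℕ.* d ℕ.+ 1) i (0<+1 (2 ℕ.* d)) power-2d+1

      ia-inv : ∀ i → (1# - a * Q ^ i) * ia i ≈ 1#
      ia-inv i = inverse′ 2 i (s≤s z≤n) power-2

      ρ^ : ∀ k → Π (λ _ → ρ) k ≈ ρ ^ k
      ρ^ = Π-const ρ

      reverse : ∀ k l → k ℕ.+ l ≡ N → ∀ f → Π f N ≈ Π f l * Π (λ i → f (N ℕ.∸ suc i)) k
      reverse k l ≡.refl f = Π-reverse f k l

      c-factor : ∀ k → c k ≈ base k * Π g k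
      c-factor k = *-congˡ (sym (begin
        Π g k
          ≈⟨ trans (Π-* _ _ k) (*-cong (trans (Π-* _ _ k) (*-cong (Π-* _ _ k) (Π-* _ _ k))) (ρ^ k)) ⟩
        poch a k * poch a k * (φ k * φ k) * ρ ^ k  ∎))

      -- (Q; Q)_N splits into (Q; Q)_l, which cancels `φ l`, and the factors 1 - Q σ. The inverses
      -- split into those of (a; Q)_l, of the 1 - a σ, of index N, which cancels E in `[n]`, and of
      -- the indices beyond N.
      c̃-factor : ∀ k l → k ℕ.+ l ≡ N → [n] * poch Q N * W.lhsTerm D k l ≈ base k * Π g̃ k
      c̃-factor k l k+l≡N = begin
        [n] * poch Q N * W.lhsTerm D k l
          ≈⟨ *-congˡ (reverse k l k+l≡N (λ i → 1# - Q * Q ^ i)) ⟨*⟩ *-congˡ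
               (trans (reflexive (≡.cong (Π ia) idx)) (trans (Π-+ ia (suc N) k) (*-congʳ (*-congʳ (reverse k l k+l≡N ia))))) ⟩
        _ ≈⟨ solve 17 (λ e i₂ pl px s z x κ f fl p al D X₁ ial iN X₂ → let o = con 1ℤ in
               e :* i₂ :* (pl :* px) :* (s :* z :* ((o :- x) :* (o :+ x :* κ)) :* f :* fl :* p :* al :* D :* (ial :* X₁ :* iN :* X₂))
               := (e :* iN) :* (pl :* fl) :* (al :* ial)
                 :* (s :* z :* ((o :+ x :* κ) :* (o :- x) :* i₂) :* f :* p :* (px :* D :* (X₁ :* X₂))))
               refl _ _ (poch Q l) _ _ _ _ _ _ _ _ (poch a l) _ _ _ _ _ ⟩
        _ ≈⟨ ia-inv N ⟨*⟩ Π-inverse _ iQ l iQ-inv ⟨*⟩ Π-inverse _ ia l ia-inv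
             ⟨*⟩ *-congˡ (sym (trans (Π-* _ _ k) (*-cong (Π-* _ _ k) (Π-* _ _ k)))) ⟩
        1# * 1# * 1# * (base k * Π g̃ k)
          ≈⟨ solve 1 (λ z → con 1ℤ :* con 1ℤ :* con 1ℤ :* z := z) refl _ ⟩
        base k * Π g̃ k  ∎
        where
        idx : suc (k ℕ.+ k ℕ.+ l) ≡ suc N ℕ.+ k
        idx = ≡.trans (ℕ-Solver.solve 2 (λ k l → conₙ 1 :+ₙ (k :+ₙ k :+ₙ l) :=ₙ conₙ 1 :+ₙ (k :+ₙ l) :+ₙ k) ≡.refl k l)
                (≡.cong (λ M → suc M ℕ.+ k) k+l≡N)

      r̃-factor : ∀ k l → k ℕ.+ l ≡ N → [n] * poch Q N * W.rhsTerm D k l ≈ base′ k l * Π h̃ k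
      r̃-factor k l k+l≡N = begin
        [n] * poch Q N * W.rhsTerm D k l
          ≈⟨ *-congʳ (*-congˡ (reverse k l k+l≡N (λ i → 1# - Q * Q ^ i))) ⟩
        _ ≈⟨ solve 10 (λ n pl px s t f fl D z b →
               n :* (pl :* px) :* (s :* t :* f :* fl :* D :* z :* b)
               := (pl :* fl) :* (s :* t :* f :* z :* (n :* b) :* (px :* D)))
               refl _ (poch Q l) _ _ _ _ _ _ _ _ ⟩
        _ ≈⟨ Π-inverse _ iQ l iQ-inv ⟨*⟩ *-congˡ (sym (Π-* _ _ k)) ⟩
        1# * (base′ k l * Π h̃ k)
          ≈⟨ *-identityˡ _ ⟩
        base′ k l * Π h̃ k  ∎

      -- (-a)^N Q^(N (N - 1) / 2) is the product of all -a Q^i with i < N; its last k factors,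
      -- reversed, are the -a σ in `h`.
      r-factor : ∀ k l → k ℕ.+ l ≡ N → [n] * ((- a) ^ N * Q^tri N) * t k ≈ base′ k l * Π h k
      r-factor k l k+l≡N = begin
        [n] * ((- a) ^ N * Q^tri N) * t k
          ≈⟨ *-congʳ (*-congˡ (begin
               (- a) ^ N * Q^tri N                     ≈⟨ powers N ⟨
               Π (λ i → - a * Q ^ i) N                 ≈⟨ reverse k l k+l≡N _ ⟩
               Π (λ i → - a * Q ^ i) l * Π (λ i → - a * σ i) k  ≈⟨ *-congʳ (powers l) ⟩
               (- a) ^ l * Q^tri l * Π (λ i → - a * σ i) k      ∎)) ⟩
        _ ≈⟨ solve 9 (λ n s t u p z r b f →
               n :* (s :* t :* u) :* (p :* p :* z :* r :* (b :* f)) := s :* t :* f :* z :* (n :* b) :* (u :* (p :* p) :* r))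
               refl _ _ _ _ _ _ _ _ _ ⟩
        _ ≈⟨ *-congˡ (sym (trans (Π-* _ _ k) (*-cong (trans (Π-* _ _ k) (*-congˡ (Π-* _ _ k))) (ρ^ k)))) ⟩
        base′ k l * Π h k  ∎
        where
        powers : ∀ m → Π (λ i → - a * Q ^ i) m ≈ (- a) ^ m * Q^tri m
        powers m = trans (Π-* _ _ m) (*-congʳ (Π-const (- a) m))

    qPochhammer : ℕ → ℕ → Carrier
    qPochhammer e = Π (λ i → 1# - q ^ (e ℕ.+ 2 ℕ.* d ℕ.* i))

    private
      qPochhammer≈ : ∀ {u} e k → q ^ e ≈ u → qPochhammer e k ≈ poch u k
      qPochhammer≈ e k e≈u = Π-cong k (λ i → +-congˡ (-‿cong (trans (power-+2d* e i) (*-congʳ e≈u))))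

      Q^tri-y^ : ∀ k → Q^tri k * y ^ k ≈ q ^ (d ℕ.* k ℕ.* k)
      Q^tri-y^ zero    = trans (*-identityʳ 1#) (reflexive (≡.cong (q ^_) (≡.sym (ℕ.*-zeroʳ (d ℕ.* 0)))))
      Q^tri-y^ (suc k) = begin
        Q^tri k * Q ^ k * (y * y ^ k)
          ≈⟨ solve 4 (λ t κ y z → t :* κ :* (y :* z) := t :* z :* (y :* κ)) refl _ _ _ _ ⟩
        Q^tri k * y ^ k * (y * Q ^ k)
          ≈⟨ *-cong (Q^tri-y^ k) (sym (power-+2d* d k)) ⟩
        q ^ (d ℕ.* k ℕ.* k) * q ^ (d ℕ.+ 2 ℕ.* d ℕ.* k)
          ≈⟨ ^-homo-* q (d ℕ.* k ℕ.* k) (d ℕ.+ 2 ℕ.* d ℕ.* k) ⟨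
        q ^ (d ℕ.* k ℕ.* k ℕ.+ (d ℕ.+ 2 ℕ.* d ℕ.* k))
          ≡⟨ ≡.cong (q ^_) (ℕ-Solver.solve 2 (λ d k → d :*ₙ k :*ₙ k :+ₙ (d :+ₙ conₙ 2 :*ₙ d :*ₙ k)
               :=ₙ d :*ₙ (conₙ 1 :+ₙ k) :*ₙ (conₙ 1 :+ₙ k)) ≡.refl d k) ⟩
        q ^ (d ℕ.* suc k ℕ.* suc k)  ∎

      ρ^≈ : ∀ k → q ^ (2 ℕ.* (d ℕ.∸ 1) ℕ.* k) ≈ ρ ^ k
      ρ^≈ k = sym (^-assocʳ q (2 ℕ.* (d ℕ.∸ 1)) k)

      [1-a]inv2 : (1# - a) * inv 2 ≈ 1#
      [1-a]inv2 = trans (*-congʳ (+-congˡ (-‿cong (sym power-2)))) (inverse 2 (s≤s z≤n))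

    c-fraction : ∀ k → sgn k * ((1# + q ^ (2 ℕ.* d ℕ.* k ℕ.+ 1)) * qPochhammer 2 k ^ 3
        * q ^ (d ℕ.* k ℕ.* k ℕ.+ 2 ℕ.* k ℕ.* (d ℕ.∸ 1)))
      ≈ c k * ((1# + q ^ 1) * qPochhammer (2 ℕ.* d) k ^ 3)
    c-fraction k = begin
      sgn k * ((1# + q ^ (2 ℕ.* d ℕ.* k ℕ.+ 1)) * qPochhammer 2 k ^ 3 * q ^ (d ℕ.* k ℕ.* k ℕ.+ 2 ℕ.* k ℕ.* (d ℕ.∸ 1)))
        ≈⟨ *-congˡ (+-congˡ eq₁ ⟨*⟩ ^-congˡ 3 (qPochhammer≈ 2 k power-2) ⟨*⟩ eq₂) ⟩
      _ ≈⟨ solve 6 (λ s x κ p z r → let o = con 1ℤ in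
             s :* ((o :+ x :* κ) :* (p :* (p :* (p :* o))) :* (z :* r))
             := o :* (o :* o :* o) :* (s :* ((o :+ x :* κ) :* (p :* (p :* (p :* o))) :* (z :* r)))) refl _ _ _ _ _ _ ⟩
      -- Every denominator is inserted together with its inverse; the inverses go into `c k`, the
      -- denominators stay behind.
      _ ≈⟨ *-congʳ (sym [1-a]inv2 ⟨*⟩ (sym (PQφ k) ⟨*⟩ sym (PQφ k) ⟨*⟩ sym (PQφ k))) ⟩
      _ ≈⟨ solve 9 (λ s x κ p z r i f P → let o = con 1ℤ in
             (o :- x :* x) :* i :* (P :* f :* (P :* f) :* (P :* f)) :* (s :* ((o :+ x :* κ) :* (p :* (p :* (p :* o))) :* (z :* r)))
             := s :* z :* ((o :+ x :* κ) :* (o :- x) :* i) :* f :* p :* (p :* p :* (f :* f) :* r)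
                :* ((o :+ x :* o) :* (P :* (P :* (P :* o))))) refl _ _ _ _ _ _ _ _ _ ⟩
      c k * ((1# + q ^ 1) * poch Q k ^ 3)
        ≈⟨ *-congˡ (*-congˡ (^-congˡ 3 (qPochhammer≈ (2 ℕ.* d) k power-2d))) ⟨
      c k * ((1# + q ^ 1) * qPochhammer (2 ℕ.* d) k ^ 3)  ∎
      where
      PQφ : ∀ k → poch Q k * φ k ≈ 1#
      PQφ k = Π-inverse _ iQ k iQ-inv
      eq₁ : q ^ (2 ℕ.* d ℕ.* k ℕ.+ 1) ≈ q * Q ^ k
      eq₁ = trans (reflexive (≡.cong (q ^_) (ℕ.+-comm (2 ℕ.* d ℕ.* k) 1))) (*-congˡ (trans (sym (^-assocʳ q (2 ℕ.* d) k)) (^-congˡ k power-2d)))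
      eq₂ : q ^ (d ℕ.* k ℕ.* k ℕ.+ 2 ℕ.* k ℕ.* (d ℕ.∸ 1)) ≈ Q^tri k * y ^ k * ρ ^ k
      eq₂ = trans (^-homo-* q (d ℕ.* k ℕ.* k) (2 ℕ.* k ℕ.* (d ℕ.∸ 1))) (*-cong (sym (Q^tri-y^ k)) (trans (reflexive (≡.cong (q ^_)
        (ℕ-Solver.solve 2 (λ k e → conₙ 2 :*ₙ k :*ₙ e :=ₙ conₙ 2 :*ₙ e :*ₙ k) ≡.refl k (d ℕ.∸ 1)))) (ρ^≈ k)))

    t-fraction : ∀ k → qPochhammer 2 k ^ 2 * qPochhammer d k * q ^ (2 ℕ.* (d ℕ.∸ 1) ℕ.* k)
      ≈ t k * (qPochhammer (d ℕ.+ 1) k * qPochhammer (2 ℕ.* d) k * qPochhammer (2 ℕ.* d ℕ.+ 1) k)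
    t-fraction k = begin
      qPochhammer 2 k ^ 2 * qPochhammer d k * q ^ (2 ℕ.* (d ℕ.∸ 1) ℕ.* k)
        ≈⟨ ^-congˡ 2 (qPochhammer≈ 2 k power-2) ⟨*⟩ qPochhammer≈ d k refl ⟨*⟩ ρ^≈ k ⟩
      _ ≈⟨ solve 3 (λ p u r → let o = con 1ℤ in p :* (p :* o) :* u :* r := (o :* o :* o) :* (p :* p :* u :* r)) refl _ _ _ ⟩
      _ ≈⟨ *-congʳ (sym (Π-inverse _ iQ k iQ-inv) ⟨*⟩ sym (Π-inverse _ iB k iB-inv) ⟨*⟩ sym (Π-inverse _ iC k iC-inv)) ⟩
      _ ≈⟨ solve 9 (λ P f P₁ f₁ P₂ f₂ p u r → P :* f :* (P₁ :* f₁) :* (P₂ :* f₂) :* (p :* p :* u :* r)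
             := p :* p :* u :* r :* (f₁ :* f₂ :* f) :* (P₁ :* P :* P₂)) refl _ _ _ _ _ _ _ _ _ ⟩
      t k * (poch (q * y) k * poch Q k * poch (q * y * y) k)
        ≈⟨ *-congˡ (qPochhammer≈ (d ℕ.+ 1) k power-d+1 ⟨*⟩ qPochhammer≈ (2 ℕ.* d) k power-2d ⟨*⟩ qPochhammer≈ (2 ℕ.* d ℕ.+ 1) k power-2d+1) ⟨
      t k * (qPochhammer (d ℕ.+ 1) k * qPochhammer (2 ℕ.* d) k * qPochhammer (2 ℕ.* d ℕ.+ 1) k)  ∎

    private
      -- The exponent of q in a^m Q^(m (m - 1) / 2), by recursion because the closed form m (m d + 2
      -- - d) involves a truncated subtraction.
      exponent : ℕ → ℕ
      exponent zero    = 0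
      exponent (suc m) = exponent m ℕ.+ (2 ℕ.+ 2 ℕ.* d ℕ.* m)

      exponent-suc : ∀ m → exponent (suc m) ≡ suc m ℕ.* (m ℕ.* d ℕ.+ 2)
      exponent-suc zero    = ≡.cong (2 ℕ.+_) (ℕ.*-zeroʳ (2 ℕ.* d))
      exponent-suc (suc m) = ≡.trans (≡.cong (ℕ._+ (2 ℕ.+ 2 ℕ.* d ℕ.* suc m)) (exponent-suc m))
        (ℕ-Solver.solve 2 (λ m d → let s = conₙ 1 :+ₙ m in s :*ₙ (m :*ₙ d :+ₙ conₙ 2) :+ₙ (conₙ 2 :+ₙ conₙ 2 :*ₙ d :*ₙ s)
          :=ₙ (conₙ 1 :+ₙ s) :*ₙ (s :*ₙ d :+ₙ conₙ 2)) ≡.refl m d)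

      exponent≡ : ∀ m → exponent m ≡ m ℕ.* (suc (m ℕ.* d) ℕ.+ 1 ℕ.∸ d)
      exponent≡ zero    = ≡.refl
      exponent≡ (suc m) = ≡.trans (exponent-suc m) (≡.cong (suc m ℕ.*_) (≡.sym (≡.trans
        (≡.cong (ℕ._∸ d) (ℕ-Solver.solve 2 (λ m d → conₙ 1 :+ₙ (d :+ₙ m :*ₙ d) :+ₙ conₙ 1 :=ₙ m :*ₙ d :+ₙ conₙ 2 :+ₙ d) ≡.refl m d))
        (ℕ.m+n∸n≡m _ d))))

      a^Q^tri : ∀ m → (- a) ^ m * Q^tri m ≈ sgn m * q ^ exponent m
      a^Q^tri zero    = refl
      a^Q^tri (suc m) = begin
        - a * (- a) ^ m * (Q^tri m * Q ^ m)
          ≈⟨ solve 4 (λ a z t κ → :- a :* z :* (t :* κ) := :- con 1ℤ :* (z :* t) :* (a :* κ)) refl _ _ _ _ ⟩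
        - 1# * ((- a) ^ m * Q^tri m) * (a * Q ^ m)
          ≈⟨ *-cong (*-congˡ (a^Q^tri m)) (trans (*-congʳ (sym power-2)) (sym (power-+2d* 2 m))) ⟩
        - 1# * (sgn m * q ^ exponent m) * q ^ (2 ℕ.+ 2 ℕ.* d ℕ.* m)
          ≈⟨ solve 3 (λ s u v → :- con 1ℤ :* (s :* u) :* v := :- con 1ℤ :* s :* (u :* v)) refl _ _ _ ⟩
        sgn (suc m) * (q ^ exponent m * q ^ (2 ℕ.+ 2 ℕ.* d ℕ.* m))
          ≈⟨ *-congˡ (^-homo-* q (exponent m) (2 ℕ.+ 2 ℕ.* d ℕ.* m)) ⟨
        sgn (suc m) * q ^ exponent (suc m)  ∎

      [n]-sum : Σ< (λ i → q ^ (2 ℕ.* i)) n ≈ [n]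
      [n]-sum = begin
        Σ< (λ i → q ^ (2 ℕ.* i)) n                        ≈⟨ *-identityʳ _ ⟨
        Σ< (λ i → q ^ (2 ℕ.* i)) n * 1#                   ≈⟨ *-congˡ [1-a]inv2 ⟨
        Σ< (λ i → q ^ (2 ℕ.* i)) n * ((1# - a) * inv 2)   ≈⟨ *-assoc _ _ _ ⟨
        Σ< (λ i → q ^ (2 ℕ.* i)) n * (1# - a) * inv 2     ≈⟨ *-congʳ (telescope n) ⟩
        (1# - q ^ (2 ℕ.* n)) * inv 2                      ≈⟨ *-congʳ (+-congˡ (-‿cong 2n)) ⟩
        [n]                                               ∎
        where
        telescope : ∀ m → Σ< (λ i → q ^ (2 ℕ.* i)) m * (1# - a) ≈ 1# - q ^ (2 ℕ.* m)
        telescope zero    = solve 1 (λ a → con 0ℤ :* (con 1ℤ :- a) := con 1ℤ :- con 1ℤ) refl a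
        telescope (suc m) = begin
          (Σ< (λ i → q ^ (2 ℕ.* i)) m + q ^ (2 ℕ.* m)) * (1# - a)
            ≈⟨ trans (distribʳ _ _ _) (+-congʳ (telescope m)) ⟩
          1# - q ^ (2 ℕ.* m) + q ^ (2 ℕ.* m) * (1# - a)
            ≈⟨ solve 2 (λ u q → con 1ℤ :- u :+ u :* (con 1ℤ :- q :* q) := con 1ℤ :- q :* (q :* con 1ℤ) :* u) refl _ q ⟩
          1# - q ^ 2 * q ^ (2 ℕ.* m)
            ≈⟨ +-congˡ (-‿cong (trans (sym (^-homo-* q 2 (2 ℕ.* m))) (reflexive (≡.cong (q ^_) (≡.sym (ℕ.*-suc 2 m)))))) ⟩
          1# - q ^ (2 ℕ.* suc m)  ∎
        2n : q ^ (2 ℕ.* n) ≈ w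
        2n = trans (reflexive (≡.cong (q ^_) (ℕ-Solver.solve 2 (λ N d → conₙ 2 :*ₙ (conₙ 1 :+ₙ N :*ₙ d)
               :=ₙ conₙ 2 :+ₙ conₙ 2 :*ₙ d :*ₙ N) ≡.refl N d)))
          (trans (power-+2d* 2 N) (*-congʳ power-2))

    prefactor-cube : let u = [n] * ((- a) ^ N * Q^tri N) in
      sgn (3 ℕ.* N) * (Σ< (λ i → q ^ (2 ℕ.* i)) n ^ 3 * q ^ (3 ℕ.* N ℕ.* (n ℕ.+ 1 ℕ.∸ d))) ≈ u * u * u
    prefactor-cube = begin
      sgn (3 ℕ.* N) * (Σ< (λ i → q ^ (2 ℕ.* i)) n ^ 3 * q ^ (3 ℕ.* N ℕ.* (n ℕ.+ 1 ℕ.∸ d)))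
        ≈⟨ (cube (- 1#)) ⟨*⟩ (^-congˡ 3 [n]-sum ⟨*⟩ trans (reflexive (≡.cong (q ^_) eq)) (^-3 q (exponent N))) ⟩
      _ ≈⟨ solve 3 (λ s m u → let o = con 1ℤ in
             s :* s :* s :* (m :* (m :* (m :* o)) :* (u :* u :* u))
             := m :* (s :* u) :* (m :* (s :* u)) :* (m :* (s :* u))) refl _ _ _ ⟩
      _ ≈⟨ one ⟨*⟩ one ⟨*⟩ one ⟩
      [n] * ((- a) ^ N * Q^tri N) * ([n] * ((- a) ^ N * Q^tri N)) * ([n] * ((- a) ^ N * Q^tri N))  ∎
      where
      ^-3 : ∀ z m → z ^ (3 ℕ.* m) ≈ z ^ m * z ^ m * z ^ m
      ^-3 z m = trans (reflexive (≡.cong (z ^_) (ℕ.*-comm 3 m))) (trans (sym (^-assocʳ z m 3))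
        (solve 1 (λ u → u :* (u :* (u :* con 1ℤ)) := u :* u :* u) refl _))
      cube : ∀ z → z ^ (3 ℕ.* N) ≈ z ^ N * z ^ N * z ^ N
      cube z = ^-3 z N
      eq : 3 ℕ.* N ℕ.* (n ℕ.+ 1 ℕ.∸ d) ≡ 3 ℕ.* exponent N
      eq = ≡.trans (ℕ.*-assoc 3 N _) (≡.cong (3 ℕ.*_) (≡.sym (exponent≡ N)))
      one : [n] * (sgn N * q ^ exponent N) ≈ [n] * ((- a) ^ N * Q^tri N)
      one = *-congˡ (sym (a^Q^tri N))

    base-case : N ≡ 0 → tripleSum n ≈ rhs * rhs * rhs
    base-case N≡0 = begin
      tripleSum n                                  ≡⟨ ≡.cong (λ M → tripleSum (suc (M ℕ.* d))) N≡0 ⟩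
      0# + (0# + (0# + c 0 * c 0 * c 0))           ≈⟨ +-congˡ (+-congˡ (+-congˡ (c0 ⟨*⟩ c0 ⟨*⟩ c0))) ⟩
      0# + (0# + (0# + 1# * 1# * 1#))              ≈⟨ solve 0 (let o = con 1ℤ ; z = con 0ℤ in z :+ (z :+ (z :+ o :* o :* o)) := o :* o :* o) refl ⟩
      1# * 1# * 1#                                 ≈⟨ rhs≈1 ⟨*⟩ rhs≈1 ⟨*⟩ rhs≈1 ⟨
      rhs * rhs * rhs                              ∎
      where
      c0 : c 0 ≈ 1#
      c0 = trans (solve 2 (λ x i → let o = con 1ℤ in o :* (o :* o) :* ((o :+ x :* o) :* (o :- x) :* i) :* o :* o :* (o :* o :* (o :* o) :* o)
                             := (o :- x :* x) :* i) refl q (inv 2)) [1-a]inv2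
      rhs≈1 : rhs ≈ 1#
      rhs≈1 = begin
        rhs  ≡⟨ ≡.cong (λ M → (1# - a * Q ^ M) * inv 2 * ((- a) ^ M * Q^tri M) * Σ< t (suc M)) N≡0 ⟩
        _    ≈⟨ solve 2 (λ a i → let o = con 1ℤ in (o :- a :* o) :* i :* (o :* o) :* (con 0ℤ :+ (o :* o :* o :* o :* (o :* o :* o)))
                  := (o :- a) :* i) refl a (inv 2) ⟩
        (1# - a) * inv 2  ≈⟨ [1-a]inv2 ⟩
        1#   ∎

    transformed : Σ< (λ k → base k * Π g̃ k) (suc N) ≈ Σ< (λ k → base′ k (N ℕ.∸ k) * Π h̃ k) (suc N)
    transformed = begin
      Σ< (λ k → base k * Π g̃ k) (suc N)
        ≈⟨ Σ<-cong (suc N) (λ { k (s≤s k≤N) → sym (c̃-factor k (N ℕ.∸ k) (ℕ.m+[n∸m]≡n k≤N)) }) ⟩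
      Σ< (λ k → [n] * poch Q N * W.lhsTerm D k (N ℕ.∸ k)) (suc N)
        ≈⟨ trans (*-congˡ (asum-Σ< (W.lhsTerm D) N)) (Σ<-*ˡ _ _ (suc N)) ⟨
      [n] * poch Q N * asum (W.lhsTerm D) N
        ≈⟨ *-congˡ (W.transformation iQ-inv iB-inv iC-inv ia-inv N) ⟩
      [n] * poch Q N * asum (W.rhsTerm D) N
        ≈⟨ trans (*-congˡ (asum-Σ< (W.rhsTerm D) N)) (Σ<-*ˡ _ _ (suc N)) ⟩
      Σ< (λ k → [n] * poch Q N * W.rhsTerm D k (N ℕ.∸ k)) (suc N)
        ≈⟨ Σ<-cong (suc N) (λ { k (s≤s k≤N) → r̃-factor k (N ℕ.∸ k) (ℕ.m+[n∸m]≡n k≤N) }) ⟩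
      Σ< (λ k → base′ k (N ℕ.∸ k) * Π h̃ k) (suc N)  ∎

    module _ (0<N : 0 ℕ.< N) (2∤n : ¬ (2 ∣ n)) (q∈O : O q) (inv∈O : ∀ e → ¬ (n ∣ e) → O (inv e)) where

      open Residues d N 0<d 2∤n

      private
        N<n : N ℕ.< n
        N<n = s≤s N≤N*d

        q^∈O : ∀ e → O (q ^ e)
        q^∈O e = ^-closed e q∈O

        y∈O : O y
        y∈O = q^∈O d

        a∈O : O a
        a∈O = *-closed q∈O q∈O

        Q^∈O : ∀ i → O (Q ^ i)
        Q^∈O i = ^-closed i (*-closed y∈O y∈O)

        1-∈O : ∀ {u} → O u → O (1# - u)
        1-∈O ou = +-closed 1-closed (-‿closed ou)

        poch∈O : ∀ {u} k → O u → O (poch u k)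
        poch∈O k ou = Π-closed k (λ i _ → 1-∈O (*-closed ou (Q^∈O i)))

        Q^tri∈O : ∀ k → O (Q^tri k)
        Q^tri∈O k = Π-closed k (λ i _ → Q^∈O i)

        inv2∈O : O (inv 2)
        inv2∈O = inv∈O 2 (λ n∣2 → n∤2+2dm 0<N (≡.subst (n ∣_) (≡.cong (2 ℕ.+_) (≡.sym (ℕ.*-zeroʳ (2 ℕ.* d)))) n∣2))

        iQ∈O : ∀ i → suc i ℕ.< n → O (iQ i)
        iQ∈O i 1+i<n = inv∈O _ (λ n∣ → n∤2dj (s≤s z≤n) 1+i<n (≡.subst (n ∣_) (≡.sym (ℕ.*-suc (2 ℕ.* d) i)) n∣))

        ia<∈O : ∀ i → i ℕ.< N → O (ia i)
        ia<∈O i i<N = inv∈O _ (n∤2+2dm i<N)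

        -- Between this and `ia<∈O` the index N is left out: `ia N` inverts E, and `c̃-factor` has
        -- already cancelled it.
        ia>∈O : ∀ i → suc i ℕ.< n → O (ia (suc N ℕ.+ i))
        ia>∈O i 1+i<n = inv∈O _ (λ n∣ → n∤2dj (s≤s z≤n) 1+i<n (n∣2n+ (≡.subst (λ m → n ∣ 2 ℕ.+ 2 ℕ.* d ℕ.* m) (≡.sym (ℕ.+-suc N i)) n∣)))

        φ∈O : ∀ k → k ℕ.< n → O (φ k)
        φ∈O k k<n = Π-closed k (λ i i<k → iQ∈O i (ℕ.≤-<-trans i<k k<n))

        head∈O : ∀ k → k ℕ.< n → O (sgn k * (Q^tri k * y ^ k) * ((1# + q * Q ^ k) * (1# - q) * inv 2) * φ k)
        head∈O k k<n = *-closed (*-closed (*-closed (^-closed k (-‿closed 1-closed))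
            (*-closed (Q^tri∈O k) (^-closed k y∈O)))
          (*-closed (*-closed (+-closed 1-closed (*-closed q∈O (Q^∈O k))) (1-∈O q∈O)) inv2∈O)) (φ∈O k k<n)

        base∈O : ∀ k → k ℕ.< n → O (base k)
        base∈O k k<n = *-closed (head∈O k k<n) (poch∈O k a∈O)

        square∈O : ∀ {u} → O u → O (u * u)
        square∈O ou = *-closed ou ou

        ρ∈O : O ρ
        ρ∈O = q^∈O (2 ℕ.* (d ℕ.∸ 1))

        1-aQ∈O : ∀ i → O (1# - a * Q ^ i)
        1-aQ∈O i = 1-∈O (*-closed a∈O (Q^∈O i))

        g∈O : ∀ i → suc i ℕ.< n → O (g i)
        g∈O i i<n = *-closed (*-closed (square∈O (1-aQ∈O i)) (square∈O (iQ∈O i i<n))) ρ∈O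

        h̃∈O : ∀ i → O (h̃ i)
        h̃∈O i = *-closed (1-∈O (*-closed (*-closed y∈O y∈O) (Q^∈O (N ℕ.∸ suc i))))
          (1-∈O (*-closed (*-closed (*-closed a∈O a∈O) (Q^∈O N)) (Q^∈O i)))

        h∈O : ∀ i → O (h i)
        h∈O i = *-closed (*-closed (*-closed (-‿closed a∈O) (Q^∈O (N ℕ.∸ suc i))) (square∈O (1-aQ∈O i))) ρ∈O

        <N⇒1+<n : ∀ {i} → i ℕ.< N → suc i ℕ.< n
        <N⇒1+<n i<N = ℕ.≤-<-trans i<N N<n

        ia*ia∈O : ∀ i → i ℕ.< N → O (ia (N ℕ.∸ suc i) * ia (suc N ℕ.+ i))
        ia*ia∈O i i<N = *-closed (ia<∈O _ (ℕ.∸-monoʳ-< (s≤s z≤n) i<N)) (ia>∈O i (<N⇒1+<n i<N))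

        g̃∈O : ∀ i → i ℕ.< N → O (g̃ i)
        g̃∈O i i<N = *-closed (h̃∈O i) (ia*ia∈O i i<N)

        g-congruent : ∀ i → i ℕ.< N → g̃ i ≡ g i [ E * E ]
        g-congruent i i<N = _ ,
          *-closed (*-closed (ia*ia∈O i i<N) (square∈O (iQ∈O i (<N⇒1+<n i<N))))
            (+-closed (square∈O (1-∈O (*-closed (*-closed y∈O y∈O) (Q^∈O i))))
                      (-‿closed (*-closed ρ∈O (square∈O (1-aQ∈O i))))) ,
          key (σ i) Q (Q ^ i) a ρ (Q ^ N) (ia (N ℕ.∸ suc i)) (ia (suc N ℕ.+ i)) (iQ i) (σ-spec i<N) ρa≈Q
            (ia-inv (N ℕ.∸ suc i))
            (trans (*-congʳ (+-congˡ (-‿cong (*-congˡ (sym (^-homo-* Q (suc N) i)))))) (ia-inv (suc N ℕ.+ i)))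
            (iQ-inv i)

        h-congruent : ∀ i → i ℕ.< N → h̃ i ≡ h i [ E * E ]
        h-congruent i i<N = 1# , 1-closed , key′ (σ i) Q (Q ^ i) a ρ (Q ^ N) (σ-spec i<N) ρa≈Q

        c-congruent : ∀ k → k ℕ.≤ N → c k ≡ base k * Π g̃ k [ E * E ]
        c-congruent k k≤N = ≡[]-trans (≡[]-reflexive (c-factor k)) (≡[]-*ˡ (base∈O k (ℕ.≤-<-trans k≤N N<n))
          (≡[]-sym (≡[]-Π k (λ i i<k → g̃∈O i (ℕ.<-≤-trans i<k k≤N)) (λ i i<k → g∈O i (<N⇒1+<n (ℕ.<-≤-trans i<k k≤N)))
            (λ i i<k → g-congruent i (ℕ.<-≤-trans i<k k≤N)))))

        E≈ : E ≈ (1# + q ^ n) * (1# - q ^ n)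
        E≈ = trans (+-congˡ (-‿cong w≈)) (solve 1 (λ z → con 1ℤ :- z :* z := (con 1ℤ :+ z) :* (con 1ℤ :- z)) refl _)
          where
          w≈ : w ≈ q ^ n * q ^ n
          w≈ = trans (trans (*-congʳ (sym power-2)) (sym (power-+2d* 2 N)))
            (trans (reflexive (≡.cong (q ^_) (ℕ-Solver.solve 2 (λ d N → conₙ 2 :+ₙ conₙ 2 :*ₙ d :*ₙ N
               :=ₙ conₙ 1 :+ₙ N :*ₙ d :+ₙ (conₙ 1 :+ₙ N :*ₙ d)) ≡.refl d N))) (^-homo-* q n n))

        top : ∀ {j} → j ≡ N → d ℕ.* j ℕ.+ 1 ≡ n
        top ≡.refl = ≡.trans (ℕ.+-comm _ 1) (≡.cong suc (ℕ.*-comm d N))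

        -- The exponents in B are d j + 1 with odd j from `iB` and even j from `iC`, so the parity
        -- of N decides which product may contain the inverse of 1 - q^n.
        iB-exponent : ∀ i → d ℕ.+ 1 ℕ.+ 2 ℕ.* d ℕ.* i ≡ d ℕ.* suc (2 ℕ.* i) ℕ.+ 1
        iB-exponent = ℕ-Solver.solve 2 (λ d i → d :+ₙ conₙ 1 :+ₙ conₙ 2 :*ₙ d :*ₙ i
          :=ₙ d :*ₙ (conₙ 1 :+ₙ conₙ 2 :*ₙ i) :+ₙ conₙ 1) ≡.refl d

        iC-exponent : ∀ i → 2 ℕ.* d ℕ.+ 1 ℕ.+ 2 ℕ.* d ℕ.* i ≡ d ℕ.* (2 ℕ.* suc i) ℕ.+ 1
        iC-exponent = ℕ-Solver.solve 2 (λ d i → conₙ 2 :*ₙ d :+ₙ conₙ 1 :+ₙ conₙ 2 :*ₙ d :*ₙ i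
          :=ₙ d :*ₙ (conₙ 2 :*ₙ (conₙ 1 :+ₙ i)) :+ₙ conₙ 1) ≡.refl d

        2[1+i]≤2N : ∀ {i} → i ℕ.< N → 2 ℕ.* suc i ℕ.≤ N ℕ.+ N
        2[1+i]≤2N {i} i<N = ℕ.+-mono-≤ i<N (≡.subst (ℕ._≤ N) (≡.sym (ℕ.+-identityʳ (suc i))) i<N)

        iB∈O : ∀ i → i ℕ.< N → suc (2 ℕ.* i) ≢ N → O (iB i)
        iB∈O i i<N ≢N = inv∈O _ (λ n∣ → n∤dj+1 (ℕ.≤-trans (ℕ.n≤1+n _)
          (≡.subst (ℕ._≤ N ℕ.+ N) (ℕ.*-suc 2 i) (2[1+i]≤2N i<N))) ≢N (≡.subst (n ∣_) (iB-exponent i) n∣))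

        iC∈O : ∀ i → i ℕ.< N → 2 ℕ.* suc i ≢ N → O (iC i)
        iC∈O i i<N ≢N = inv∈O _ (λ n∣ → n∤dj+1 (2[1+i]≤2N i<N) ≢N (≡.subst (n ∣_) (iC-exponent i) n∣))

        -- Of the exponents d j + 1 with 1 ≤ j ≤ 2 k in B k, only j = N gives a multiple of n, namely n itself.
        [1-qⁿ]B∈O : ∀ k → k ℕ.≤ N → O ((1# - q ^ n) * B k)
        [1-qⁿ]B∈O k k≤N with parity N
        ... | m , inj₂ N-odd = resp (*-assoc _ _ _) (*-closed
                (Π-closed-except k m (λ i i<k i≢m → iB∈O i (ℕ.<-≤-trans i<k k≤N)
                    (λ e → i≢m (ℕ.*-cancelˡ-≡ i m 2 (ℕ.suc-injective (≡.trans e N-odd)))))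
                  (1-∈O (q^∈O n)) (resp (sym special) 1-closed))
                (Π-closed k (λ i i<k → iC∈O i (ℕ.<-≤-trans i<k k≤N) (λ e → ℕ.even≢odd (suc i) m (≡.trans e N-odd)))))
          where
          special : (1# - q ^ n) * iB m ≈ 1#
          special = trans (*-congˡ (reflexive (≡.cong inv (≡.trans (iB-exponent m) (top (≡.sym N-odd)))))) (inverse n (s≤s z≤n))
        ... | zero  , inj₁ N≡0    = contradiction (≡.sym N≡0) (ℕ.<⇒≢ 0<N)
        ... | suc m , inj₁ N-even = resp (solve 3 (λ z b c → b :* (z :* c) := z :* (b :* c)) refl _ _ _) (*-closed
                (Π-closed k (λ i i<k → iB∈O i (ℕ.<-≤-trans i<k k≤N)
                  (λ e → ℕ.even≢odd (suc m) i (≡.sym (≡.trans e N-even)))))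
                (Π-closed-except k m (λ i i<k i≢m → iC∈O i (ℕ.<-≤-trans i<k k≤N)
                    (λ e → i≢m (ℕ.suc-injective (ℕ.*-cancelˡ-≡ (suc i) (suc m) 2 (≡.trans e N-even)))))
                  (1-∈O (q^∈O n)) (resp (sym special) 1-closed)))
          where
          special : (1# - q ^ n) * iC m ≈ 1#
          special = trans (*-congˡ (reflexive (≡.cong inv (≡.trans (iC-exponent m) (top (≡.sym N-even)))))) (inverse n (s≤s z≤n))

        -- E = (1 + q^n) (1 - q^n): the second factor is spent on the denominator 1 - q^n that `B k`
        -- may contain, the first remains.
        base′∈ : ∀ k l → k ℕ.≤ N → base′ k l ∈⟨ 1# + q ^ n ⟩
        base′∈ k l k≤N = ∈-*ˡ (*-closed (*-closed (*-closed (^-closed l (-‿closed a∈O)) (Q^tri∈O l))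
            (φ∈O k (ℕ.≤-<-trans k≤N N<n))) (poch∈O k y∈O))
          (_ , *-closed ([1-qⁿ]B∈O k k≤N) inv2∈O , trans (*-congʳ (*-congʳ E≈))
            (solve 4 (λ u v i b → u :* v :* i :* b := u :* (v :* b :* i)) refl _ _ _ _))

        ∈⇒O : ∀ {u e} → O e → u ∈⟨ e ⟩ → O u
        ∈⇒O oe (v , ov , p) = resp (sym p) (*-closed oe ov)

        1+qⁿ∈O : O (1# + q ^ n)
        1+qⁿ∈O = +-closed 1-closed (q^∈O n)

        r-congruent : ∀ k → k ℕ.≤ N → base′ k (N ℕ.∸ k) * Π h̃ k ≡ [n] * ((- a) ^ N * Q^tri N) * t k [ E * E ]
        r-congruent k k≤N = ≡[]-trans (≡[]-*ˡ (∈⇒O 1+qⁿ∈O (base′∈ k (N ℕ.∸ k) k≤N))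
            (≡[]-Π k (λ i _ → h̃∈O i) (λ i _ → h∈O i) (λ i i<k → h-congruent i (ℕ.<-≤-trans i<k k≤N))))
          (≡[]-reflexive (sym (r-factor k (N ℕ.∸ k) (ℕ.m+[n∸m]≡n k≤N))))

        rhs-Σ : Σ< (λ k → [n] * ((- a) ^ N * Q^tri N) * t k) (suc N) ≈ rhs
        rhs-Σ = sym (Σ<-*ˡ _ t (suc N))

      S≡rhs : S ≡ rhs [ E * E ]
      S≡rhs = ≡[]-trans (≡[]-Σ< (suc N) (λ { k (s≤s k≤N) → c-congruent k k≤N }))
        (≡[]-trans (≡[]-reflexive transformed)
        (≡[]-trans (≡[]-Σ< (suc N) (λ { k (s≤s k≤N) → r-congruent k k≤N })) (≡[]-reflexive rhs-Σ)))

      rhs∈ : rhs ∈⟨ 1# + q ^ n ⟩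
      rhs∈ = ∈-resp rhs-Σ (∈-Σ< (suc N) (λ { k (s≤s k≤N) → ∈-resp (sym (r-factor k (N ℕ.∸ k) (ℕ.m+[n∸m]≡n k≤N)))
        (∈-*ʳ (base′∈ k (N ℕ.∸ k) k≤N) (Π-closed k (λ i _ → h∈O i))) }))

      c∈O : ∀ k → k ℕ.< n → O (c k)
      c∈O k k<n = resp (sym (c-factor k)) (*-closed (base∈O k k<n) (Π-closed k (λ i i<k → g∈O i (ℕ.≤-<-trans i<k k<n))))

      private
        -- The factor of index N is 1 - a Q^N = E.
        poch-E : ∀ k → N ℕ.< k → poch a k ∈⟨ E ⟩
        poch-E k N<k = ∈-resp (reflexive (≡.cong (poch a) (ℕ.m+[n∸m]≡n N<k)))
          (∈-resp (sym (poch-+ a (suc N) (k ℕ.∸ suc N)))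
            (∈-*ʳ (_ , poch∈O N a∈O , *-comm _ _) (poch∈O (k ℕ.∸ suc N) (*-closed a∈O (Q^∈O (suc N))))))

        c∈E³ : ∀ k → N ℕ.< k → k ℕ.< n → c k ∈⟨ E * (E * E) ⟩
        c∈E³ k N<k k<n = ∈-* (∈-*ˡ (head∈O k k<n) (poch-E k N<k))
          (∈-*ʳ (∈-*ʳ (∈-* (poch-E k N<k) (poch-E k N<k)) (square∈O (φ∈O k k<n))) (^-closed k ρ∈O))

        -- i, j ≤ N leaves n - i - j > N because 3 N < n; this is where d ≥ 3 is needed.
        room : ∀ {i j} → i ℕ.≤ N → j ℕ.≤ N → N ℕ.< n ℕ.∸ i ℕ.∸ j
        room {i} {j} i≤N j≤N = ℕ.m+n≤o⇒m≤o∸n (suc N) (ℕ.m+n≤o⇒m≤o∸n (suc N ℕ.+ j)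
          (ℕ.≤-trans (ℕ.+-mono-≤ (ℕ.+-monoʳ-≤ (suc N) j≤N) i≤N)
            (ℕ.≤-trans (ℕ.≤-reflexive (ℕ-Solver.solve 1 (λ N → conₙ 1 :+ₙ N :+ₙ N :+ₙ N :=ₙ conₙ 1 :+ₙ N :*ₙ conₙ 3) ≡.refl N))
              (s≤s (ℕ.*-monoʳ-≤ N 3≤d)))))

        j<n∸i⇒j<n : ∀ {j} i → j ℕ.< n ℕ.∸ i → j ℕ.< n
        j<n∸i⇒j<n i j<n∸i = ℕ.<-≤-trans j<n∸i (ℕ.m∸n≤m n i)

        s<n∸i∸j⇒s<n : ∀ {s} i j → s ℕ.< n ℕ.∸ i ℕ.∸ j → s ℕ.< n
        s<n∸i∸j⇒s<n i j s<n∸i∸j = j<n∸i⇒j<n i (ℕ.<-≤-trans s<n∸i∸j (ℕ.m∸n≤m (n ℕ.∸ i) j))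

        inner-sum : ∀ i j → i ℕ.≤ N → j ℕ.≤ N →
          Σ< (λ s → c i * c j * c s) (n ℕ.∸ i ℕ.∸ j) ≡ c i * c j * S [ E * (E * E) ]
        inner-sum i j i≤N j≤N = ≡[]-trans
          (≡[]-truncate (suc N) _ (room i≤N j≤N) (λ s N<s s< →
            ∈-*ˡ (*-closed (c∈O i (ℕ.≤-<-trans i≤N N<n)) (c∈O j (ℕ.≤-<-trans j≤N N<n))) (c∈E³ s N<s (s<n∸i∸j⇒s<n i j s<))))
          (≡[]-reflexive (sym (Σ<-*ˡ _ c (suc N))))

        middle-sum : ∀ i → i ℕ.≤ N →
          Σ< (λ j → Σ< (λ s → c i * c j * c s) (n ℕ.∸ i ℕ.∸ j)) (n ℕ.∸ i) ≡ c i * S * S [ E * (E * E) ]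
        middle-sum i i≤N = ≡[]-trans
          (≡[]-truncate (suc N) _ (room i≤N z≤n) (λ j N<j j< → ∈-Σ< _ (λ s s< →
            ∈-*ʳ (∈-*ˡ (c∈O i (ℕ.≤-<-trans i≤N N<n)) (c∈E³ j N<j (j<n∸i⇒j<n i j<))) (c∈O s (s<n∸i∸j⇒s<n i j s<)))))
          (≡[]-trans (≡[]-Σ< (suc N) (λ { j (s≤s j≤N) → inner-sum i j i≤N j≤N }))
            (≡[]-reflexive (begin
              Σ< (λ j → c i * c j * S) (suc N)      ≈⟨ Σ<-cong (suc N) (λ j _ → solve 3 (λ u v w → u :* v :* w := u :* w :* v) refl _ _ _) ⟩
              Σ< (λ j → c i * S * c j) (suc N)      ≈⟨ Σ<-*ˡ _ c (suc N) ⟨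
              c i * S * S                           ∎)))

      triple≡S³ : tripleSum n ≡ S * S * S [ E * (E * E) ]
      triple≡S³ = ≡[]-trans
        (≡[]-truncate (suc N) n N<n (λ i N<i i<n → ∈-Σ< _ (λ j j< → ∈-Σ< _ (λ s s< →
          ∈-*ʳ (∈-*ʳ (c∈E³ i N<i i<n) (c∈O j (j<n∸i⇒j<n i j<))) (c∈O s (s<n∸i∸j⇒s<n i j s<))))))
        (≡[]-trans (≡[]-Σ< (suc N) (λ { i (s≤s i≤N) → middle-sum i i≤N }))
          (≡[]-reflexive (begin
            Σ< (λ i → c i * S * S) (suc N)        ≈⟨ Σ<-cong (suc N) (λ i _ → solve 3 (λ u v w → u :* v :* w := v :* w :* u) refl _ _ _) ⟩
            Σ< (λ i → S * S * c i) (suc N)        ≈⟨ Σ<-*ˡ _ c (suc N) ⟨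
            S * S * S                             ∎)))

      triple≡rhs³ : tripleSum n ≡ rhs * rhs * rhs [ (1# - q ^ n) * (1# - q ^ n) * ((1# + q ^ n) * (1# + q ^ n) * (1# + q ^ n)) ]
      triple≡rhs³ = combine triple≡S³ S≡rhs rhs∈
        where
        combine : tripleSum n ≡ S * S * S [ E * (E * E) ] → S ≡ rhs [ E * E ] → rhs ∈⟨ 1# + q ^ n ⟩ →
          tripleSum n ≡ rhs * rhs * rhs [ (1# - q ^ n) * (1# - q ^ n) * ((1# + q ^ n) * (1# + q ^ n) * (1# + q ^ n)) ]
        combine (u , ou , p) (v , ov , r) (z , oz , s) = _ ,
          +-closed (*-closed (1-∈O (q^∈O n)) ou) (*-closed 1+qⁿ∈O (*-closed ov
            (+-closed (*-closed S′∈O S′∈O) (+-closed (*-closed S′∈O oz) (*-closed oz oz))))) , (begin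
          tripleSum n - rhs * rhs * rhs
            ≈⟨ solve 3 (λ t S r → t :- r :* r :* r := (t :- S :* S :* S) :+ (S :- r) :* (S :* S :+ (S :* r :+ r :* r))) refl _ S _ ⟩
          (tripleSum n - S * S * S) + (S - rhs) * (S * S + (S * rhs + rhs * rhs))
            ≈⟨ +-cong (trans p (*-congʳ (E≈ ⟨*⟩ (E≈ ⟨*⟩ E≈))))
                 (trans r (*-congʳ (E≈ ⟨*⟩ E≈)) ⟨*⟩ +-cong (S≈ ⟨*⟩ S≈) (+-cong (S≈ ⟨*⟩ s) (s ⟨*⟩ s))) ⟩
          _ ≈⟨ solve 6 (λ m l u v k z →
                 -- With l = 1 + q^n and m = 1 - q^n, the first summand carries E³ = l³ m³ and the
                 -- second E² l² = l⁴ m²; l³ m² is common to both.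
                 l :* m :* (l :* m :* (l :* m)) :* u :+ l :* m :* (l :* m) :* v
                   :* (l :* k :* (l :* k) :+ (l :* k :* (l :* z) :+ l :* z :* (l :* z)))
                 := m :* m :* (l :* l :* l) :* (m :* u :+ l :* (v :* (k :* k :+ (k :* z :+ z :* z)))))
                 refl (1# - q ^ n) (1# + q ^ n) u v _ z ⟩
          (1# - q ^ n) * (1# - q ^ n) * ((1# + q ^ n) * (1# + q ^ n) * (1# + q ^ n)) * _  ∎)
          where
          -- The quotient of S by 1 + q^n: both `rhs` and the difference S - `rhs`, a multiple of
          -- E², are divisible by it.
          S′ : Carrier
          S′ = z + (1# + q ^ n) * ((1# - q ^ n) * (1# - q ^ n)) * v
          S′∈O : O S′
          S′∈O = +-closed oz (*-closed (*-closed 1+qⁿ∈O (square∈O (1-∈O (q^∈O n)))) ov)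
          S≈ : S ≈ (1# + q ^ n) * S′
          S≈ = begin
            S              ≈⟨ solve 2 (λ S r → S := r :+ (S :- r)) refl S rhs ⟩
            rhs + (S - rhs) ≈⟨ +-cong s (trans r (*-congʳ (E≈ ⟨*⟩ E≈))) ⟩
            _ ≈⟨ solve 4 (λ l m z v → l :* z :+ l :* m :* (l :* m) :* v := l :* (z :+ l :* (m :* m) :* v)) refl _ _ _ _ ⟩
            (1# + q ^ n) * S′  ∎

-- Bezout relations and cyclotomic polynomials

-- K plays the role of the nonzero constants.
module Comaximal {c ℓ k : Level} (R : CommutativeRing c ℓ) (K : CommutativeRing.Carrier R → Set k)
  (K-* : ∀ {u v} → K u → K v → K (CommutativeRing._*_ R u v)) where
  open CommutativeRing R
  open IntegerCoefficients R
  open SumsAndProducts R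
  open Algebra.Properties.Semiring.Exp semiring

  Coprime : Carrier → Carrier → Set (c ⊔ ℓ ⊔ k)
  Coprime u v = ∃ λ s → ∃ λ t → ∃ λ z → K z × s * u + t * v ≈ z

  coprime-sym : ∀ {u v} → Coprime u v → Coprime v u
  coprime-sym (s , t , z , kz , eq) = t , s , z , kz , trans (+-comm _ _) eq

  coprime-resp : ∀ {u u′ v} → u ≈ u′ → Coprime u v → Coprime u′ v
  coprime-resp u≈u′ (s , t , z , kz , eq) = s , t , z , kz , trans (+-congʳ (*-congˡ (sym u≈u′))) eq

  coprime-*ˡ : ∀ {u u′ v} → Coprime u v → Coprime u′ v → Coprime (u * u′) v
  coprime-*ˡ {u} {u′} {v} (s , t , z , kz , eq) (s′ , t′ , z′ , kz′ , eq′) =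
    s * s′ , s * u * t′ + t * (s′ * u′ + t′ * v) , z * z′ , K-* kz kz′ ,
    trans (solve 7 (λ u u′ v s t s′ t′ →
      s :* s′ :* (u :* u′) :+ (s :* u :* t′ :+ t :* (s′ :* u′ :+ t′ :* v)) :* v
      := (s :* u :+ t :* v) :* (s′ :* u′ :+ t′ :* v)) refl u u′ v s t s′ t′) (eq ⟨*⟩ eq′)

  coprime-*ʳ : ∀ {u v v′} → Coprime u v → Coprime u v′ → Coprime u (v * v′)
  coprime-*ʳ p r = coprime-sym (coprime-*ˡ (coprime-sym p) (coprime-sym r))

  module _ (K-1 : K 1#) where

    coprime-1 : ∀ {v} → Coprime 1# v
    coprime-1 {v} = 1# , 0# , 1# , K-1 , solve 1 (λ v → con 1ℤ :* con 1ℤ :+ con 0ℤ :* v := con 1ℤ) refl v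

    coprime-^ʳ : ∀ {u v} n → Coprime u v → Coprime u (v ^ n)
    coprime-^ʳ zero    p = coprime-sym coprime-1
    coprime-^ʳ (suc n) p = coprime-*ʳ p (coprime-^ʳ n p)

module Cyclotomic {c ℓ k : Level} (R : CommutativeRing c ℓ) (K : CommutativeRing.Carrier R → Set k)
  (K-* : ∀ {u v} → K u → K v → K (CommutativeRing._*_ R u v))
  (q : CommutativeRing.Carrier R) (Φ : ℕ → CommutativeRing.Carrier R) where
  open CommutativeRing R
  open IntegerCoefficients R
  open SumsAndProducts R
  open Comaximal R K K-*
  open Algebra.Properties.Ring ring
  open Algebra.Properties.Semiring.Exp semiring
  open Relation.Binary.Reasoning.Setoid setoid

  -- A copy of `divProd` over an abstract ring, which keeps coefficient lists out of the argument.
  divisorProduct : ℕ → ℕ → Carrier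
  divisorProduct m zero    = 1#
  divisorProduct m (suc e) = if does (suc e ∣? m) then Φ (suc e) * divisorProduct m e else divisorProduct m e

  divisorProduct-yes : ∀ m e → suc e ∣ m → divisorProduct m (suc e) ≈ Φ (suc e) * divisorProduct m e
  divisorProduct-yes m e e∣m = reflexive (≡.cong (λ b → if b then Φ (suc e) * divisorProduct m e else divisorProduct m e)
    (dec-true (suc e ∣? m) e∣m))

  divisorProduct-no : ∀ m e → ¬ (suc e ∣ m) → divisorProduct m (suc e) ≈ divisorProduct m e
  divisorProduct-no m e e∤m = reflexive (≡.cong (λ b → if b then Φ (suc e) * divisorProduct m e else divisorProduct m e)
    (dec-false (suc e ∣? m) e∤m))

  divisorProduct-∣ : ∀ {g m} → g ∣ m → ∀ e → ∃ λ r → divisorProduct m e ≈ divisorProduct g e * r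
  divisorProduct-∣ g∣m zero = 1# , sym (*-identityˡ 1#)
  divisorProduct-∣ {g} {m} g∣m (suc e) with suc e ∣? g | suc e ∣? m | divisorProduct-∣ g∣m e
  ... | yes e∣g | yes e∣m | r , eq = r , trans (divisorProduct-yes m e e∣m)
        (trans (*-congˡ eq) (trans (sym (*-assoc _ _ _)) (*-congʳ (sym (divisorProduct-yes g e e∣g)))))
  ... | yes e∣g | no  e∤m | _      = contradiction (∣-trans e∣g g∣m) e∤m
  ... | no  e∤g | yes e∣m | r , eq = Φ (suc e) * r , trans (divisorProduct-yes m e e∣m)
        (trans (*-congˡ eq) (trans (solve 3 (λ a b c → a :* (b :* c) := b :* (a :* c)) refl _ _ _)
          (*-congʳ (sym (divisorProduct-no g e e∤g)))))
  ... | no  e∤g | no  e∤m | r , eq = r , trans (divisorProduct-no m e e∤m)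
        (trans eq (*-congʳ (sym (divisorProduct-no g e e∤g))))

  divisorProduct-≤ : ∀ m {e e′} → e ℕ.≤′ e′ → ∃ λ r → divisorProduct m e′ ≈ divisorProduct m e * r
  divisorProduct-≤ m ℕ.≤′-refl = 1# , sym (*-identityʳ _)
  divisorProduct-≤ m (ℕ.≤′-step {e′} e≤e′) with suc e′ ∣? m | divisorProduct-≤ m e≤e′
  ... | yes e∣m | r , eq = Φ (suc e′) * r , trans (divisorProduct-yes m e′ e∣m)
        (trans (*-congˡ eq) (solve 3 (λ a b c → a :* (b :* c) := b :* (a :* c)) refl _ _ _))
  ... | no  e∤m | r , eq = r , trans (divisorProduct-no m e′ e∤m) eq

  divisorProduct-diag : ∀ m → divisorProduct (suc m) (suc m) ≈ Φ (suc m) * divisorProduct (suc m) m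
  divisorProduct-diag m = divisorProduct-yes (suc m) m ∣-refl

  nat : ℕ → Carrier
  nat zero    = 0#
  nat (suc k) = 1# + nat k

  geometric : Carrier → ℕ → Carrier
  geometric z zero    = 0#
  geometric z (suc k) = 1# + z * geometric z k

  geometric-sum : ∀ z k → z ^ k - 1# ≈ (z - 1#) * geometric z k
  geometric-sum z zero    = solve 1 (λ z → con 1ℤ :- con 1ℤ := (z :- con 1ℤ) :* con 0ℤ) refl z
  geometric-sum z (suc k) = begin
    z * z ^ k - 1#                            ≈⟨ solve 2 (λ z w → z :* w :- con 1ℤ := z :* (w :- con 1ℤ) :+ (z :- con 1ℤ)) refl _ _ ⟩
    z * (z ^ k - 1#) + (z - 1#)               ≈⟨ +-congʳ (*-congˡ (geometric-sum z k)) ⟩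
    z * ((z - 1#) * geometric z k) + (z - 1#) ≈⟨ solve 2 (λ z g → z :* ((z :- con 1ℤ) :* g) :+ (z :- con 1ℤ) := (z :- con 1ℤ) :* (con 1ℤ :+ z :* g)) refl _ _ ⟩
    (z - 1#) * geometric z (suc k)            ∎

  -- At z = 1 the sum has the value k; this k becomes the nonzero constant of a Bezout relation.
  geometric-mod : ∀ z k → ∃ λ r → geometric z k ≈ nat k + (z - 1#) * r
  geometric-mod z zero    = 0# , solve 1 (λ z → con 0ℤ := con 0ℤ :+ (z :- con 1ℤ) :* con 0ℤ) refl z
  geometric-mod z (suc k) with geometric-mod z k
  ... | r , eq = geometric z k + r , (begin
    1# + z * geometric z k
      ≈⟨ solve 2 (λ z g → con 1ℤ :+ z :* g := con 1ℤ :+ (g :+ (z :- con 1ℤ) :* g)) refl _ _ ⟩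
    1# + (geometric z k + (z - 1#) * geometric z k)
      ≈⟨ +-congˡ (+-congʳ eq) ⟩
    1# + (nat k + (z - 1#) * r + (z - 1#) * geometric z k)
      ≈⟨ solve 4 (λ z m r g → con 1ℤ :+ (m :+ (z :- con 1ℤ) :* r :+ (z :- con 1ℤ) :* g)
                 := con 1ℤ :+ m :+ (z :- con 1ℤ) :* (g :+ r)) refl _ _ _ _ ⟩
    nat (suc k) + (z - 1#) * (geometric z k + r)  ∎)

  power-∣ : ∀ a x → ∃ λ r → q ^ (x ℕ.* a) - 1# ≈ (q ^ a - 1#) * r
  power-∣ a x = geometric (q ^ a) x , trans
    (+-congʳ (trans (reflexive (≡.cong (q ^_) (ℕ.*-comm x a))) (sym (^-assocʳ q a x)))) (geometric-sum (q ^ a) x)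

  odd-power : ∀ z m → ∃ λ r → 1# + z ^ suc (2 ℕ.* m) ≈ (1# + z) * r
  odd-power z m = proj₁ even , (begin
    1# + z * z ^ (2 ℕ.* m)                   ≈⟨ solve 2 (λ z w → con 1ℤ :+ z :* w := (con 1ℤ :+ z) :+ z :* (w :- con 1ℤ)) refl _ _ ⟩
    (1# + z) + z * (z ^ (2 ℕ.* m) - 1#)      ≈⟨ +-congˡ (*-congˡ (trans (+-congʳ (sym (^-assocʳ z 2 m))) (geometric-sum (z ^ 2) m))) ⟩
    (1# + z) + z * ((z ^ 2 - 1#) * geometric (z ^ 2) m) ≈⟨ proj₂ even ⟩
    (1# + z) * proj₁ even                    ∎)
    where
    even : ∃ λ r → (1# + z) + z * ((z ^ 2 - 1#) * geometric (z ^ 2) m) ≈ (1# + z) * r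
    even = 1# + z * ((z - 1#) * geometric (z ^ 2) m) ,
      solve 2 (λ z g → (con 1ℤ :+ z) :+ z :* ((z :* (z :* con 1ℤ) :- con 1ℤ) :* g)
                       := (con 1ℤ :+ z) :* (con 1ℤ :+ z :* ((z :- con 1ℤ) :* g))) refl z _

  module _ (K-1 : K 1#) (K-nat : ∀ m → K (nat (suc m)))
           (cancel : ∀ {u v} g → 0 ℕ.< g → (q ^ g - 1#) * u ≈ (q ^ g - 1#) * v → u ≈ v)
           (divisorProduct≈ : ∀ m → 0 ℕ.< m → divisorProduct m m ≈ q ^ m - 1#) where

    -- The divisors of g are among the divisors of n = m + 1 other than n itself, so q^g - 1 still
    -- splits off after Φ_n has been removed.
    cyclotomic-∣ : ∀ m {g} → g ∣ suc m → g ℕ.< suc m → ∃ λ r → q ^ suc m - 1# ≈ Φ (suc m) * ((q ^ g - 1#) * r)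
    cyclotomic-∣ m {zero} 0∣ _ = contradiction (0∣⇒≡0 0∣) λ ()
    cyclotomic-∣ m {suc g} g∣m (s≤s g≤m)
      with divisorProduct-≤ (suc m) (ℕ.≤⇒≤′ g≤m) | divisorProduct-∣ g∣m (suc g)
    ... | r , eq | r′ , eq′ = r′ * r , (begin
      q ^ suc m - 1#                                   ≈⟨ divisorProduct≈ (suc m) (s≤s z≤n) ⟨
      divisorProduct (suc m) (suc m)                   ≈⟨ divisorProduct-diag m ⟩
      Φ (suc m) * divisorProduct (suc m) m             ≈⟨ *-congˡ (trans eq (*-congʳ (trans eq′ (*-congʳ (divisorProduct≈ (suc g) (s≤s z≤n)))))) ⟩
      Φ (suc m) * ((q ^ suc g - 1#) * r′ * r)          ≈⟨ *-congˡ (*-assoc _ _ _) ⟩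
      Φ (suc m) * ((q ^ suc g - 1#) * (r′ * r))        ∎)

    Φ-∣ : ∀ m → ∃ λ r → q ^ suc m - 1# ≈ Φ (suc m) * r
    Φ-∣ m = _ , trans (sym (divisorProduct≈ (suc m) (s≤s z≤n))) (divisorProduct-diag m)

    -- Let n = m + 1. Modulo q^a - 1 and Φ_n both q^(x a) and q^(y n) are 1, so g + y n = x a forces
    -- q^g = 1. Bezout's identity over ℕ has this form or the one with the roles exchanged.
    gcd-combination : ∀ m a → ∃ λ s → ∃ λ t → q ^ gcd a (suc m) - 1# ≈ s * (q ^ a - 1#) + t * Φ (suc m)
    gcd-combination m a with Φ-∣ m | Bézout.identity (gcd-GCD a (suc m))
    ... | w , eqΦ | Bézout.+- x y eq with power-∣ a x | power-∣ (suc m) y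
    ...   | r , eqa | r′ , eqn = r , - (q ^ g * (w * r′)) , (begin
      q ^ g - 1#
        ≈⟨ solve 2 (λ z u → z :- con 1ℤ := (z :* u :- con 1ℤ) :- z :* (u :- con 1ℤ)) refl _ (q ^ (y ℕ.* suc m)) ⟩
      (q ^ g * q ^ (y ℕ.* suc m) - 1#) - q ^ g * (q ^ (y ℕ.* suc m) - 1#)
        ≈⟨ +-cong (trans (+-congʳ (trans (sym (^-homo-* q g _)) (reflexive (≡.cong (q ^_) eq)))) eqa)
                  (-‿cong (*-congˡ (trans eqn (*-congʳ eqΦ)))) ⟩
      (q ^ a - 1#) * r - q ^ g * (Φ (suc m) * w * r′)
        ≈⟨ solve 6 (λ z r g p w r′ → z :* r :- g :* (p :* w :* r′) := r :* z :+ :- (g :* (w :* r′)) :* p) refl _ _ _ _ _ _ ⟩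
      r * (q ^ a - 1#) + - (q ^ g * (w * r′)) * Φ (suc m)  ∎)
      where g = gcd a (suc m)
    gcd-combination m a | w , eqΦ | Bézout.-+ x y eq with power-∣ a x | power-∣ (suc m) y
    ...   | r , eqa | r′ , eqn = - (q ^ g * r) , w * r′ , (begin
      q ^ g - 1#
        ≈⟨ solve 2 (λ z u → z :- con 1ℤ := (z :* u :- con 1ℤ) :- z :* (u :- con 1ℤ)) refl _ (q ^ (x ℕ.* a)) ⟩
      (q ^ g * q ^ (x ℕ.* a) - 1#) - q ^ g * (q ^ (x ℕ.* a) - 1#)
        ≈⟨ +-cong (trans (+-congʳ (trans (sym (^-homo-* q g _)) (reflexive (≡.cong (q ^_) eq)))) (trans eqn (*-congʳ eqΦ)))
                  (-‿cong (*-congˡ eqa)) ⟩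
      Φ (suc m) * w * r′ - q ^ g * ((q ^ a - 1#) * r)
        ≈⟨ solve 6 (λ z r g p w r′ → p :* w :* r′ :- g :* (z :* r) := :- (g :* r) :* z :+ w :* r′ :* p) refl _ _ _ _ _ _ ⟩
      - (q ^ g * r) * (q ^ a - 1#) + w * r′ * Φ (suc m)  ∎)
      where g = gcd a (suc m)

    -- Write n = m + 1 = g j. The geometric sum (q^n - 1) / (q^g - 1) is a multiple of Φ_n and
    -- congruent to j modulo q^g - 1, which is itself a combination of q^a - 1 and Φ_n; hence so is
    -- j.
    coprime-of-combination : ∀ m a g → g ∣ suc m → g ℕ.< suc m →
      (∃ λ s → ∃ λ t → q ^ g - 1# ≈ s * (q ^ a - 1#) + t * Φ (suc m)) → Coprime (1# - q ^ a) (Φ (suc m))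
    coprime-of-combination m a zero    g∣n _ _ = contradiction (0∣⇒≡0 g∣n) λ ()
    coprime-of-combination m a (suc _) (divides zero ()) _ _
    coprime-of-combination m a g@(suc _) g∣n@(divides (suc j) n≡) g<n (s , t , eq) =
      s * v , u - t * v , nat (suc j) , K-nat j , identity
      where
      factor = cyclotomic-∣ m g∣n g<n
      remainder = geometric-mod (q ^ g) (suc j)
      u = proj₁ factor
      v = proj₁ remainder
      quotient : geometric (q ^ g) (suc j) ≈ Φ (suc m) * u
      quotient = cancel g (s≤s z≤n) (begin
        (q ^ g - 1#) * geometric (q ^ g) (suc j)   ≈⟨ geometric-sum (q ^ g) (suc j) ⟨
        (q ^ g) ^ suc j - 1#                       ≈⟨ +-congʳ (^-assocʳ q g (suc j)) ⟩
        q ^ (g ℕ.* suc j) - 1#                     ≡⟨ ≡.cong (λ e → q ^ e - 1#) (≡.trans (ℕ.*-comm g (suc j)) (≡.sym n≡)) ⟩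
        q ^ suc m - 1#                             ≈⟨ proj₂ factor ⟩
        Φ (suc m) * ((q ^ g - 1#) * u)             ≈⟨ solve 3 (λ a b c → a :* (b :* c) := b :* (a :* c)) refl (Φ (suc m)) (q ^ g - 1#) u ⟩
        (q ^ g - 1#) * (Φ (suc m) * u)             ∎)
      identity : s * v * (1# - q ^ a) + (u - t * v) * Φ (suc m) ≈ nat (suc j)
      identity = begin
        s * v * (1# - q ^ a) + (u - t * v) * Φ (suc m)
          ≈⟨ solve 6 (λ s v z u t p → s :* v :* (con 1ℤ :- z) :+ (u :- t :* v) :* p
                := p :* u :- (s :* (z :- con 1ℤ) :+ t :* p) :* v) refl s v (q ^ a) u t (Φ (suc m)) ⟩
        Φ (suc m) * u - (s * (q ^ a - 1#) + t * Φ (suc m)) * v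
          ≈⟨ +-cong (trans (sym quotient) (proj₂ remainder)) (-‿cong (*-congʳ (sym eq))) ⟩
        (nat (suc j) + (q ^ g - 1#) * v) - (q ^ g - 1#) * v
          ≈⟨ solve 2 (λ a b → (a :+ b) :- b := a) refl (nat (suc j)) ((q ^ g - 1#) * v) ⟩
        nat (suc j)  ∎

    coprime-1-q^ : ∀ m a → ¬ (suc m ∣ a) → Coprime (1# - q ^ a) (Φ (suc m))
    coprime-1-q^ m a n∤a = coprime-of-combination m a (gcd a (suc m)) (gcd[m,n]∣n a (suc m))
      (ℕ.≤∧≢⇒< (∣⇒≤ (gcd[m,n]∣n a (suc m))) (λ g≡n → n∤a (≡.subst (_∣ a) g≡n (gcd[m,n]∣m a (suc m)))))
      (gcd-combination m a)

    -- For odd n, 1 + q^b divides 1 + q^(b n), and q^(b n) is 1 modulo Φ_n; so 2 is a combination.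
    coprime-1+q^ : ∀ m b → Coprime (1# + q ^ b) (Φ (suc (2 ℕ.* m)))
    coprime-1+q^ m b = proj₁ odd , - (proj₁ root * proj₁ multiple) , nat 2 , K-nat 1 , identity
      where
      n = suc (2 ℕ.* m)
      odd = odd-power (q ^ b) m
      multiple = power-∣ n b
      root = Φ-∣ (2 ℕ.* m)
      bn : q ^ (b ℕ.* n) ≈ (q ^ b) ^ n
      bn = sym (^-assocʳ q b n)
      identity : proj₁ odd * (1# + q ^ b) + - (proj₁ root * proj₁ multiple) * Φ n ≈ nat 2
      identity = begin
        proj₁ odd * (1# + q ^ b) + - (proj₁ root * proj₁ multiple) * Φ n
          ≈⟨ solve 5 (λ r z w r′ p → r :* (con 1ℤ :+ z) :+ :- (w :* r′) :* p := (con 1ℤ :+ z) :* r :- p :* w :* r′)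
               refl (proj₁ odd) (q ^ b) (proj₁ root) (proj₁ multiple) (Φ n) ⟩
        (1# + q ^ b) * proj₁ odd - Φ n * proj₁ root * proj₁ multiple
          ≈⟨ +-cong (sym (proj₂ odd)) (-‿cong (trans (*-congʳ (sym (proj₂ root))) (trans (sym (proj₂ multiple)) (+-congʳ bn)))) ⟩
        (1# + (q ^ b) ^ n) - ((q ^ b) ^ n - 1#)
          ≈⟨ solve 1 (λ z → (con 1ℤ :+ z) :- (z :- con 1ℤ) := con 1ℤ :+ (con 1ℤ :+ con 0ℤ)) refl ((q ^ b) ^ n) ⟩
        nat 2  ∎

    module _ (ν : Carrier → Carrier) (ν-cong : ∀ {u v} → u ≈ v → ν u ≈ ν v)
             (ν-+ : ∀ u v → ν (u + v) ≈ ν u + ν v) (ν-* : ∀ u v → ν (u * v) ≈ ν u * ν v)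
             (ν-neg : ∀ u → ν (- u) ≈ - ν u) (ν-1 : ν 1# ≈ 1#) (ν-q : ν q ≈ - q)
             (ν-K : ∀ {z} → K z → K (ν z)) where

      ν-coprime : ∀ {u v} → Coprime u v → Coprime (ν u) (ν v)
      ν-coprime (s , t , z , kz , eq) = ν s , ν t , ν z , ν-K kz ,
        trans (sym (trans (ν-+ _ _) (+-cong (ν-* _ _) (ν-* _ _)))) (ν-cong eq)

      ν-q^ : ∀ e → ν (q ^ e) ≈ (- q) ^ e
      ν-q^ zero    = ν-1
      ν-q^ (suc e) = trans (ν-* _ _) (*-cong ν-q (ν-q^ e))

      even-power : ∀ e → (- q) ^ (2 ℕ.* e) ≈ q ^ (2 ℕ.* e)
      even-power e = trans (sym (^-assocʳ (- q) 2 e)) (trans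
        (^-congˡ e (solve 1 (λ q → :- q :* (:- q :* con 1ℤ) := q :* (q :* con 1ℤ)) refl q)) (^-assocʳ q 2 e))

      ν-q^-odd : ∀ e → ν (q ^ suc (2 ℕ.* e)) ≈ - q ^ suc (2 ℕ.* e)
      ν-q^-odd e = trans (ν-q^ (suc (2 ℕ.* e))) (trans (*-congˡ (even-power e)) (sym (-‿distribˡ-* _ _)))

      -- A Bezout relation for Φ_n(q) is carried to Φ_n(-q) by q ↦ -q. Even powers of q are fixed,
      -- whereas for odd e the factor 1 - q^e is the image of 1 + q^e.
      coprime-1-q^-ν : ∀ m e → ¬ (suc (2 ℕ.* m) ∣ e) → Coprime (1# - q ^ e) (ν (Φ (suc (2 ℕ.* m))))
      coprime-1-q^-ν m e n∤e with parity e
      ... | j , inj₁ ≡.refl = coprime-resp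
              (trans (ν-+ _ _) (+-cong ν-1 (trans (ν-neg _) (-‿cong (trans (ν-q^ (2 ℕ.* j)) (even-power j))))))
              (ν-coprime (coprime-1-q^ (2 ℕ.* m) e n∤e))
      ... | j , inj₂ ≡.refl = coprime-resp (trans (ν-+ _ _) (+-cong ν-1 (ν-q^-odd j)))
              (ν-coprime (coprime-1+q^ m (suc (2 ℕ.* j))))

      modulus-coprime : ∀ m e → ¬ (suc (2 ℕ.* m) ∣ e) →
        Coprime (1# - q ^ e) (ν (Φ (suc (2 ℕ.* m))) ^ 3 * Φ (suc (2 ℕ.* m)) ^ 2)
      modulus-coprime m e n∤e = coprime-*ʳ (coprime-^ʳ K-1 3 (coprime-1-q^-ν m e n∤e)) (coprime-^ʳ K-1 2 (coprime-1-q^ (2 ℕ.* m) e n∤e))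

      -- Φ_n(q) divides q^n - 1, and since n is odd, the substitution q ↦ -q shows that Φ_n(-q)
      -- divides q^n + 1.
      modulus-∣ : ∀ m → let n = suc (2 ℕ.* m) in ∃ λ r →
        (1# - q ^ n) * (1# - q ^ n) * ((1# + q ^ n) * (1# + q ^ n) * (1# + q ^ n)) ≈ ν (Φ n) ^ 3 * Φ n ^ 2 * r
      modulus-∣ m with Φ-∣ (2 ℕ.* m)
      ... | w , eq = w * w * (- ν w * - ν w * - ν w) , (begin
        (1# - q ^ n) * (1# - q ^ n) * ((1# + q ^ n) * (1# + q ^ n) * (1# + q ^ n))
          ≈⟨ minus ⟨*⟩ minus ⟨*⟩ (plus ⟨*⟩ plus ⟨*⟩ plus) ⟩
        _ ≈⟨ solve 4 (λ p w v z → let o = con 1ℤ in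
               :- (p :* w) :* :- (p :* w) :* (:- (v :* z) :* :- (v :* z) :* :- (v :* z))
               := v :* (v :* (v :* o)) :* (p :* (p :* o)) :* (w :* w :* (:- z :* :- z :* :- z))) refl _ _ _ _ ⟩
        ν (Φ n) ^ 3 * Φ n ^ 2 * (w * w * (- ν w * - ν w * - ν w))  ∎)
        where
        n = suc (2 ℕ.* m)
        minus : 1# - q ^ n ≈ - (Φ n * w)
        minus = trans (solve 1 (λ z → con 1ℤ :- z := :- (z :- con 1ℤ)) refl _) (-‿cong eq)
        plus : 1# + q ^ n ≈ - (ν (Φ n) * ν w)
        plus = trans (solve 1 (λ z → con 1ℤ :+ z := :- (:- z :+ :- con 1ℤ)) refl _) (-‿cong (begin
          - q ^ n + - 1#       ≈⟨ +-cong (ν-q^-odd m) (trans (ν-neg 1#) (-‿cong ν-1)) ⟨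
          ν (q ^ n) + ν (- 1#) ≈⟨ ν-+ _ _ ⟨
          ν (q ^ n - 1#)       ≈⟨ ν-cong eq ⟩
          ν (Φ n * w)          ≈⟨ ν-* _ _ ⟩
          ν (Φ n) * ν w        ∎))

open import Defs

-- Formal power series over ℤ

Series : Set
Series = ℕ → ℤ

infix 4 _≐_
_≐_ : Series → Series → Set
f ≐ g = ∀ i → f i ≡ g i

infixl 7 _⊛_
-- The Cauchy product, stripping its left factor in the way `_⊗_` strips a list, so that `coeff-⊗`
-- is an induction on the list.
_⊛_ : Series → Series → Series
(f ⊛ g) zero    = f 0 ℤ.* g 0
(f ⊛ g) (suc n) = f 0 ℤ.* g (suc n) ℤ.+ (f ∘ suc ⊛ g) n

private
  _+S_ : Series → Series → Series
  (f +S g) i = f i ℤ.+ g i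

⊛-cong : ∀ {f f′ g g′} → f ≐ f′ → g ≐ g′ → f ⊛ g ≐ f′ ⊛ g′
⊛-cong p r zero    = ≡.cong₂ ℤ._*_ (p 0) (r 0)
⊛-cong p r (suc n) = ≡.cong₂ ℤ._+_ (≡.cong₂ ℤ._*_ (p 0) (r (suc n))) (⊛-cong (p ∘ suc) r n)

⊛-zeroˡ : ∀ {f} g → f ≐ (λ _ → 0ℤ) → f ⊛ g ≐ (λ _ → 0ℤ)
⊛-zeroˡ {f} g p zero    = ≡.cong (ℤ._* g 0) (p 0)
⊛-zeroˡ {f} g p (suc n) = ≡.cong₂ ℤ._+_ (≡.cong (ℤ._* g (suc n)) (p 0)) (⊛-zeroˡ g (p ∘ suc) n)

⊛-identityˡ : ∀ f → coeff oneP ⊛ f ≐ f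
⊛-identityˡ f zero    = ℤ.*-identityˡ (f 0)
⊛-identityˡ f (suc n) = ≡.trans (≡.cong₂ ℤ._+_ (ℤ.*-identityˡ (f (suc n))) (⊛-zeroˡ f (λ _ → ≡.refl) n)) (ℤ.+-identityʳ _)

⊛-distribʳ : ∀ h f g → (f +S g) ⊛ h ≐ (f ⊛ h) +S (g ⊛ h)
⊛-distribʳ h f g zero    = ℤ.*-distribʳ-+ (h 0) (f 0) (g 0)
⊛-distribʳ h f g (suc n) = ≡.trans (≡.cong₂ ℤ._+_ (≡.refl {x = (f 0 ℤ.+ g 0) ℤ.* h (suc n)}) (⊛-distribʳ h (f ∘ suc) (g ∘ suc) n))
  (ℤ-Solver.solve 5 (λ a b c x y → (a :+ᵢ b) :*ᵢ c :+ᵢ (x :+ᵢ y) :=ᵢ a :*ᵢ c :+ᵢ x :+ᵢ (b :*ᵢ c :+ᵢ y)) ≡.refl (f 0) (g 0) (h (suc n)) _ _)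

⊛-scaleˡ : ∀ c f g → (λ i → c ℤ.* f i) ⊛ g ≐ (λ i → c ℤ.* (f ⊛ g) i)
⊛-scaleˡ c f g zero    = ℤ.*-assoc c (f 0) (g 0)
⊛-scaleˡ c f g (suc n) = ≡.trans (≡.cong₂ ℤ._+_ (≡.refl {x = c ℤ.* f 0 ℤ.* g (suc n)}) (⊛-scaleˡ c (f ∘ suc) g n))
  (ℤ-Solver.solve 4 (λ c a b x → c :*ᵢ a :*ᵢ b :+ᵢ c :*ᵢ x :=ᵢ c :*ᵢ (a :*ᵢ b :+ᵢ x)) ≡.refl c (f 0) (g (suc n)) _)

-- The product recurses on its left factor; commutativity needs the recursion on the right one as
-- well.
⊛-sucʳ : ∀ f g n → (f ⊛ g) (suc n) ≡ f (suc n) ℤ.* g 0 ℤ.+ (f ⊛ g ∘ suc) n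
⊛-sucʳ f g zero    = ℤ.+-comm (f 0 ℤ.* g 1) (f 1 ℤ.* g 0)
⊛-sucʳ f g (suc n) = ≡.trans (≡.cong₂ ℤ._+_ (≡.refl {x = f 0 ℤ.* g (suc (suc n))}) (⊛-sucʳ (f ∘ suc) g n))
  (ℤ-Solver.solve 3 (λ a b c → a :+ᵢ (b :+ᵢ c) :=ᵢ b :+ᵢ (a :+ᵢ c)) ≡.refl (f 0 ℤ.* g (suc (suc n))) (f (suc (suc n)) ℤ.* g 0) _)

⊛-comm : ∀ f g → f ⊛ g ≐ g ⊛ f
⊛-comm f g zero    = ℤ.*-comm (f 0) (g 0)
⊛-comm f g (suc n) = ≡.trans (≡.cong₂ ℤ._+_ (ℤ.*-comm (f 0) (g (suc n))) (⊛-comm (f ∘ suc) g n)) (≡.sym (⊛-sucʳ g f n))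

⊛-assoc : ∀ f g h → (f ⊛ g) ⊛ h ≐ f ⊛ (g ⊛ h)
⊛-assoc f g h zero    = ℤ.*-assoc (f 0) (g 0) (h 0)
⊛-assoc f g h (suc n) = ≡.trans
  (≡.cong₂ ℤ._+_ (≡.refl {x = f 0 ℤ.* g 0 ℤ.* h (suc n)}) (≡.trans (⊛-distribʳ h (λ i → f 0 ℤ.* g (suc i)) (f ∘ suc ⊛ g) n)
    (≡.cong₂ ℤ._+_ (⊛-scaleˡ (f 0) (g ∘ suc) h n) (⊛-assoc (f ∘ suc) g h n))))
  (ℤ-Solver.solve 5 (λ a b c x y → a :*ᵢ b :*ᵢ c :+ᵢ (a :*ᵢ x :+ᵢ y) :=ᵢ a :*ᵢ (b :*ᵢ c :+ᵢ x) :+ᵢ y) ≡.refl (f 0) (g 0) (h (suc n)) _ _)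

seriesRing : CommutativeRing 0ℓ 0ℓ
seriesRing = record
  { Carrier = Series ; _≈_ = _≐_ ; _+_ = _+S_ ; _*_ = _⊛_ ; -_ = λ f i → ℤ.- f i ; 0# = λ _ → 0ℤ ; 1# = coeff oneP
  ; isCommutativeRing = record
    { isRing = record
      { +-isAbelianGroup = Pointwise.isAbelianGroup ℕ ℤ.+-0-isAbelianGroup
      ; *-cong     = ⊛-cong
      ; *-assoc    = ⊛-assoc
      ; *-identity = ⊛-identityˡ , λ f i → ≡.trans (⊛-comm f (coeff oneP) i) (⊛-identityˡ f i)
      ; distrib    = (λ f g h i → ≡.trans (⊛-comm f (g +S h) i) (≡.trans (⊛-distribʳ f g h i)
                        (≡.cong₂ ℤ._+_ (⊛-comm g f i) (⊛-comm h f i)))) , ⊛-distribʳ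
      }
    ; *-comm = ⊛-comm
    }
  }

module Reciprocal (f : Series) where

  -- Each coefficient of a reciprocal depends on all earlier ones. Kept in a list in descending
  -- order, they turn the Cauchy product into a dot product and the recursion into a structural one.
  convolve : Series → List ℤ → ℤ
  convolve g []       = 0ℤ
  convolve g (c ∷ cs) = g 0 ℤ.* c ℤ.+ convolve (g ∘ suc) cs

  -- The coefficients of index ≤ n of the reciprocal, the highest one first.
  coefficients : ℕ → List ℤ
  next : ℕ → ℤ
  coefficients zero    = 1ℤ ∷ []
  coefficients (suc n) = next n ∷ coefficients n
  next n = ℤ.- convolve (f ∘ suc) (coefficients n)

  reciprocal : Series
  reciprocal zero    = 1ℤ
  reciprocal (suc n) = next n

  ⊛-convolve : ∀ g n → (g ⊛ reciprocal) n ≡ convolve g (coefficients n)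
  ⊛-convolve g zero    = ≡.sym (ℤ.+-identityʳ _)
  ⊛-convolve g (suc n) = ≡.cong₂ ℤ._+_ (≡.refl {x = g 0 ℤ.* next n}) (⊛-convolve (g ∘ suc) n)

  ⊛-reciprocal : f 0 ≡ 1ℤ → f ⊛ reciprocal ≐ coeff oneP
  ⊛-reciprocal f0≡1 zero    = ≡.trans (ℤ.*-identityʳ _) f0≡1
  ⊛-reciprocal f0≡1 (suc n) = ≡.trans (≡.cong₂ ℤ._+_ (≡.trans (≡.cong (ℤ._* next n) f0≡1) (ℤ.*-identityˡ _)) (⊛-convolve (f ∘ suc) n))
    (ℤ.+-inverseˡ (convolve (f ∘ suc) (coefficients n)))

open Reciprocal public using (reciprocal; ⊛-reciprocal)

-- Polynomials inside the power series

coeff-⊕ : ∀ p r → coeff (p ⊕ r) ≐ coeff p +S coeff r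
coeff-⊕ []      r       i       = ≡.sym (ℤ.+-identityˡ _)
coeff-⊕ (a ∷ p) []      i       = ≡.sym (ℤ.+-identityʳ _)
coeff-⊕ (a ∷ p) (b ∷ r) zero    = ≡.refl
coeff-⊕ (a ∷ p) (b ∷ r) (suc i) = coeff-⊕ p r i

coeff-· : ∀ c p → coeff (c · p) ≐ (λ i → c ℤ.* coeff p i)
coeff-· c []      i       = ≡.sym (ℤ.*-zeroʳ c)
coeff-· c (a ∷ p) zero    = ≡.refl
coeff-· c (a ∷ p) (suc i) = coeff-· c p i

coeff-⊝ : ∀ p → coeff (⊝ p) ≐ (λ i → ℤ.- coeff p i)
coeff-⊝ p i = ≡.trans (coeff-· -1ℤ p i) (ℤ.-1*i≡-i (coeff p i))

coeff-⊗ : ∀ p r → coeff (p ⊗ r) ≐ coeff p ⊛ coeff r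
coeff-⊗ []      r i       = ≡.sym (⊛-zeroˡ (coeff r) (λ _ → ≡.refl) i)
coeff-⊗ (a ∷ p) r zero    = ≡.trans (coeff-⊕ (a · r) _ 0) (≡.trans (ℤ.+-identityʳ _) (coeff-· a r 0))
coeff-⊗ (a ∷ p) r (suc i) = ≡.trans (coeff-⊕ (a · r) _ (suc i)) (≡.cong₂ ℤ._+_ (coeff-· a r (suc i)) (coeff-⊗ p r i))

-- Equality of polynomials is by definition equality of their images under `coeff`, so the laws are
-- pulled back from the series.
polyRing : CommutativeRing 0ℓ 0ℓ
polyRing = record
  { Carrier = Poly ; _≈_ = _≈_ ; _+_ = _⊕_ ; _*_ = _⊗_ ; -_ = ⊝_ ; 0# = [] ; 1# = oneP
  ; isCommutativeRing = RingMonomorphism.isCommutativeRing isRingMonomorphism (CommutativeRing.isCommutativeRing seriesRing)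
  }
  where
  raw : RawRing 0ℓ 0ℓ
  raw = record { Carrier = Poly ; _≈_ = _≈_ ; _+_ = _⊕_ ; _*_ = _⊗_ ; -_ = ⊝_ ; 0# = [] ; 1# = oneP }
  open RingMorphisms raw (CommutativeRing.rawRing seriesRing)
  isRingMonomorphism : IsRingMonomorphism coeff
  isRingMonomorphism = record
    { isRingHomomorphism = record
      { isSemiringHomomorphism = record
        { isNearSemiringHomomorphism = record
          { +-isMonoidHomomorphism = record
            { isMagmaHomomorphism = record
              { isRelHomomorphism = record { cong = λ p → p }
              ; homo = coeff-⊕ }
            ; ε-homo = λ _ → ≡.refl }
          ; *-homo = coeff-⊗ }
        ; 1#-homo = λ _ → ≡.refl }
      ; -‿homo = coeff-⊝ }
    ; injective = λ p → p }

module S = CommutativeRing seriesRing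
module P = CommutativeRing polyRing
open Algebra.Properties.Semiring.Exp S.semiring using (_^_; ^-congˡ)
open Algebra.Properties.Semiring.Exp P.semiring using () renaming (_^_ to _^ₚ_)
open SumsAndProducts seriesRing using (Π; Σ<; Π-cong; unit-cancel)

q : Series
q = coeff (X^ 1)

coeff-⊖ : ∀ p r → coeff (p ⊖ r) ≐ coeff p S.- coeff r
coeff-⊖ p r = S.trans (coeff-⊕ p (⊝ r)) (S.+-congˡ {coeff p} (coeff-⊝ r))

coeff-X^ : ∀ k → coeff (X^ k) ≐ q ^ k
coeff-X^ zero    i       = ≡.refl
coeff-X^ (suc k) zero    = ≡.sym (ℤ.*-zeroˡ ((q ^ k) 0))
coeff-X^ (suc k) (suc i) = ≡.trans (coeff-X^ k i) (≡.sym (≡.trans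
  (≡.cong₂ ℤ._+_ (ℤ.*-zeroˡ ((q ^ k) (suc i))) (⊛-identityˡ (q ^ k) i)) (ℤ.+-identityˡ _)))

coeff-^ : ∀ p k → coeff (p ^ₚ k) ≐ coeff p ^ k
coeff-^ p zero    = S.refl
coeff-^ p (suc k) = S.trans (coeff-⊗ p (p ^ₚ k)) (S.*-congˡ {coeff p} (coeff-^ p k))

coeff-^P : ∀ p k → coeff (p ^P k) ≐ coeff p ^ k
coeff-^P p zero    = S.refl
coeff-^P p (suc k) = S.trans (coeff-⊗ p (p ^P k)) (S.*-congˡ {coeff p} (coeff-^P p k))

coeff-1-X^ : ∀ e → coeff (oneP ⊖ X^ e) ≐ S.1# S.- q ^ e
coeff-1-X^ e = S.trans (coeff-⊖ oneP (X^ e)) (S.+-congˡ {S.1#} (S.-‿cong (coeff-X^ e)))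

coeff-qPoch : ∀ a b k → coeff (qPoch a b k) ≐ Π (λ i → S.1# S.- q ^ (a ℕ.+ b ℕ.* i)) k
coeff-qPoch a b zero    = S.refl
coeff-qPoch a b (suc k) = S.trans (coeff-⊗ (qPoch a b k) _) (S.*-cong (coeff-qPoch a b k) (coeff-1-X^ (a ℕ.+ b ℕ.* k)))

coeff-qint2 : ∀ n → coeff (qint2 n) ≐ Σ< (λ i → q ^ (2 ℕ.* i)) n
coeff-qint2 zero    = S.refl
coeff-qint2 (suc n) = S.trans (coeff-⊕ (qint2 n) _) (S.+-cong (coeff-qint2 n) (coeff-X^ (2 ℕ.* n)))

coeff-signPow : ∀ k p → coeff (signPow k · p) ≐ (S.- S.1#) ^ k ⊛ coeff p
coeff-signPow k p = S.trans (coeff-· (signPow k) p) (go k)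
  where
  f = coeff p
  go : ∀ k → (λ i → signPow k ℤ.* f i) ≐ (S.- S.1#) ^ k ⊛ f
  go zero    i = ≡.trans (ℤ.*-identityˡ (f i)) (≡.sym (⊛-identityˡ f i))
  go (suc k) = S.trans {j = S.- ((S.- S.1#) ^ k ⊛ f)}
    (λ i → ≡.trans (≡.sym (ℤ.neg-distribˡ-* (signPow k) (f i))) (≡.cong ℤ.-_ (go k i)))
    (S.trans (S.-‿cong (S.sym (S.*-identityˡ _))) (S.trans (-‿distribˡ-* _ _) (S.sym (S.*-assoc _ _ f))))
    where
    open Algebra.Properties.Ring S.ring using (-‿distribˡ-*)

-- Fractions of polynomials and the series they represent

module FractionAlgebra {c ℓ : Level} (R : CommutativeRing c ℓ) where
  open CommutativeRing R renaming (_≈_ to _≋_)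
  open IntegerCoefficients R
  open SumsAndProducts R using (_⟨*⟩_)

  sum-of-fractions : ∀ {a b c d f g} → a ≋ f * b → c ≋ g * d → a * d + c * b ≋ (f + g) * (b * d)
  sum-of-fractions {b = b} {d = d} {f} {g} p r = trans (+-cong (*-congʳ p) (*-congʳ r))
    (solve 4 (λ b d f g → f :* b :* d :+ g :* d :* b := (f :+ g) :* (b :* d)) refl b d f g)

  product-of-fractions : ∀ {a b c d f g} → a ≋ f * b → c ≋ g * d → a * c ≋ f * g * (b * d)
  product-of-fractions {b = b} {d = d} {f} {g} p r = trans (*-cong p r)
    (solve 4 (λ b d f g → f :* b :* (g :* d) := f :* g :* (b :* d)) refl b d f g)

  sum-integral : ∀ {b a b′ a′ f g} → b * f ≋ a → b′ * g ≋ a′ → b * b′ * (f + g) ≋ a * b′ + a′ * b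
  sum-integral {b} {a} {b′} {a′} {f} {g} p r = trans
    (solve 4 (λ b b′ f g → b :* b′ :* (f :+ g) := b :* f :* b′ :+ b′ :* g :* b) refl b b′ f g) (+-cong (*-congʳ p) (*-congʳ r))

  product-integral : ∀ {b a b′ a′ f g} → b * f ≋ a → b′ * g ≋ a′ → b * b′ * (f * g) ≋ a * a′
  product-integral {b} {a} {b′} {a′} {f} {g} p r = trans
    (solve 4 (λ b b′ f g → b :* b′ :* (f :* g) := b :* f :* (b′ :* g)) refl b b′ f g) (*-cong p r)

  difference-of-fractions : ∀ {n₁ d₁ n₂ d₂ f g m o b a p u} → n₁ ≋ f * d₁ → n₂ ≋ g * d₂ → f - g ≋ m * o →
    m ≋ p * u → b * o ≋ a → (n₁ * d₂ - n₂ * d₁) * b ≋ p * (u * a) * d₁ * d₂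
  difference-of-fractions {d₁ = d₁} {d₂ = d₂} {f} {g} {m} {o} {b} {a} {p} {u} e₁ e₂ e₃ e₄ e₅ =
    trans (*-congʳ (+-cong (*-congʳ e₁) (-‿cong (*-congʳ e₂))))
    (trans (solve 5 (λ f g d₁ d₂ b → (f :* d₁ :* d₂ :- g :* d₂ :* d₁) :* b := (f :- g) :* (d₁ :* d₂ :* b)) refl f g d₁ d₂ b)
    (trans (*-congʳ (trans e₃ (*-congʳ e₄)))
    (trans (solve 6 (λ p u o d₁ d₂ b → p :* u :* o :* (d₁ :* d₂ :* b) := p :* (u :* (b :* o)) :* d₁ :* d₂) refl p u o d₁ d₂ b)
           (*-congʳ (*-congʳ (*-congˡ (*-congˡ e₅)))))))

open FractionAlgebra seriesRing

infix 4 _↝_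
-- Cross-multiplied, so that fractions can be added and multiplied without inverting a denominator.
_↝_ : Frac → Series → Set
(a , b) ↝ f = coeff a ≐ f ⊛ coeff b

↝-+ : ∀ {x y f g} → x ↝ f → y ↝ g → x +F y ↝ f S.+ g
↝-+ {a , b} {c , d} {f} {g} p r = S.trans (coeff-⊕ (a ⊗ d) (c ⊗ b)) (S.trans (S.+-cong (coeff-⊗ a d) (coeff-⊗ c b))
  (S.trans (sum-of-fractions {b = coeff b} {d = coeff d} {f} {g} p r) (S.*-congˡ {f S.+ g} (S.sym (coeff-⊗ b d)))))

↝-* : ∀ {x y f g} → x ↝ f → y ↝ g → x *F y ↝ f ⊛ g
↝-* {a , b} {c , d} {f} {g} p r = S.trans (coeff-⊗ a c)
  (S.trans (product-of-fractions {b = coeff b} {d = coeff d} {f} {g} p r) (S.*-congˡ {f ⊛ g} (S.sym (coeff-⊗ b d))))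

↝-sumF : ∀ {F f} N → (∀ i → F i ↝ f i) → sumF F N ↝ Σ< f N
↝-sumF zero    F↝f = S.sym (S.zeroˡ S.1#)
↝-sumF {F} {f} (suc N) F↝f = ↝-+ {sumF F N} {F N} {Σ< f N} {f N} (↝-sumF N F↝f) (F↝f N)

-- The substitution q ↦ -q

alternate : Series → Series
alternate f i = signPow i ℤ.* f i

alternate-⊛ : ∀ f g → alternate (f ⊛ g) ≐ alternate f ⊛ alternate g
alternate-⊛ f g zero    = ≡.trans (ℤ.*-identityˡ _) (≡.sym (≡.cong₂ ℤ._*_ (ℤ.*-identityˡ (f 0)) (ℤ.*-identityˡ (g 0))))
alternate-⊛ f g (suc n) = ≡.sym (≡.trans
  (≡.cong₂ ℤ._+_ (≡.cong (ℤ._* alternate g (suc n)) (ℤ.*-identityˡ (f 0)))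
    (≡.trans (⊛-cong (λ i → shift (signPow i) (f (suc i))) (λ _ → ≡.refl) n)
    (≡.trans (⊛-scaleˡ -1ℤ (alternate (f ∘ suc)) (alternate g) n) (≡.cong (-1ℤ ℤ.*_) (≡.sym (alternate-⊛ (f ∘ suc) g n))))))
  (ℤ-Solver.solve 4 (λ a s b x → a :*ᵢ (:-ᵢ s :*ᵢ b) :+ᵢ conᵢ -1ℤ :*ᵢ (s :*ᵢ x) :=ᵢ :-ᵢ s :*ᵢ (a :*ᵢ b :+ᵢ x)) ≡.refl
     (f 0) (signPow n) (g (suc n)) ((f ∘ suc ⊛ g) n)))
  where
  shift : ∀ s b → ℤ.- s ℤ.* b ≡ -1ℤ ℤ.* (s ℤ.* b)
  shift = ℤ-Solver.solve 2 (λ s b → :-ᵢ s :*ᵢ b :=ᵢ conᵢ -1ℤ :*ᵢ (s :*ᵢ b)) ≡.refl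

coeff-negArg : ∀ p → coeff (negArg p) ≐ alternate (coeff p)
coeff-negArg []      i       = ≡.sym (ℤ.*-zeroʳ (signPow i))
coeff-negArg (a ∷ p) zero    = ≡.sym (ℤ.*-identityˡ a)
coeff-negArg (a ∷ p) (suc i) = ≡.trans (coeff-⊝ (negArg p) i)
  (≡.trans (≡.cong ℤ.-_ (coeff-negArg p i)) (ℤ.neg-distribˡ-* (signPow i) (coeff p i)))

negArg-cong : ∀ {p r} → p ≈ r → negArg p ≈ negArg r
negArg-cong {p} {r} eq i = ≡.trans (coeff-negArg p i) (≡.trans (≡.cong (signPow i ℤ.*_) (eq i)) (≡.sym (coeff-negArg r i)))

negArg-⊕ : ∀ p r → negArg (p ⊕ r) ≈ negArg p ⊕ negArg r
negArg-⊕ p r i = ≡.trans (coeff-negArg (p ⊕ r) i) (≡.trans (≡.cong (signPow i ℤ.*_) (coeff-⊕ p r i))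
  (≡.trans (ℤ.*-distribˡ-+ (signPow i) (coeff p i) (coeff r i)) (≡.sym (≡.trans (coeff-⊕ (negArg p) (negArg r) i)
    (≡.cong₂ ℤ._+_ (coeff-negArg p i) (coeff-negArg r i))))))

negArg-⊗ : ∀ p r → negArg (p ⊗ r) ≈ negArg p ⊗ negArg r
negArg-⊗ p r = S.trans (coeff-negArg (p ⊗ r)) (S.trans (λ i → ≡.cong (signPow i ℤ.*_) (coeff-⊗ p r i))
  (S.trans (alternate-⊛ (coeff p) (coeff r)) (S.sym (S.trans (coeff-⊗ (negArg p) (negArg r))
    (S.*-cong (coeff-negArg p) (coeff-negArg r))))))

negArg-⊝ : ∀ p → negArg (⊝ p) ≈ ⊝ negArg p
negArg-⊝ p i = ≡.trans (coeff-negArg (⊝ p) i) (≡.trans (≡.cong (signPow i ℤ.*_) (coeff-⊝ p i))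
  (≡.trans (≡.sym (ℤ.neg-distribʳ-* (signPow i) (coeff p i)))
    (≡.trans (≡.cong ℤ.-_ (≡.sym (coeff-negArg p i))) (≡.sym (coeff-⊝ (negArg p) i)))))

negArg-X : negArg (X^ 1) ≈ ⊝ X^ 1
negArg-X zero          = ≡.refl
negArg-X (suc zero)    = ≡.refl
negArg-X (suc (suc i)) = ≡.refl

-- Coprimality of integer polynomials

NonzeroConst : Poly → Set
NonzeroConst p = ∃ λ z → z ≢ 0ℤ × p ≈ const z

NonzeroConst-⊗ : ∀ {p r} → NonzeroConst p → NonzeroConst r → NonzeroConst (p ⊗ r)
NonzeroConst-⊗ {p} {r} (y , y≢0 , p≈) (z , z≢0 , r≈) = y ℤ.* z ,
  ([ y≢0 , z≢0 ]′ ∘ ℤ.i*j≡0⇒i≡0∨j≡0 y) ,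
  S.trans (coeff-⊗ p r) (S.trans (⊛-cong p≈ r≈) (S.trans (S.sym (coeff-⊗ (const y) (const z)))
    (λ { zero → ℤ.+-identityʳ _ ; (suc i) → ≡.refl })))

NonzeroConst-negArg : ∀ {p} → NonzeroConst p → NonzeroConst (negArg p)
NonzeroConst-negArg {p} (z , z≢0 , p≈) = z , z≢0 , S.trans (negArg-cong {p} {const z} p≈) (λ { zero → ≡.refl ; (suc i) → ≡.refl })

NonzeroConst-1 : NonzeroConst oneP
NonzeroConst-1 = 1ℤ , (λ ()) , S.refl

1-q^ : ℕ → Series
1-q^ e = S.1# S.- q ^ e

-- For e > 0 the constant term of 1 - q^e is 1, so the reciprocal has integer coefficients. `inv 0`
-- is a default value without meaning, which `inverse` excludes.
inv : ℕ → Series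
inv e = reciprocal (1-q^ e)

inverse : ∀ e → 0 ℕ.< e → 1-q^ e ⊛ inv e ≐ S.1#
inverse (suc e) _ = ⊛-reciprocal (1-q^ (suc e)) (≡.cong (λ z → 1ℤ ℤ.+ ℤ.- z) (ℤ.*-zeroˡ ((q ^ e) 0)))

open Comaximal polyRing NonzeroConst (λ {p} {r} → NonzeroConst-⊗ {p} {r})

module C = Cyclotomic polyRing NonzeroConst (λ {p} {r} → NonzeroConst-⊗ {p} {r}) (X^ 1)

coeff-1-q^ : ∀ e → coeff (P.1# P.- X^ 1 ^ₚ e) ≐ 1-q^ e
coeff-1-q^ e = S.trans (coeff-⊖ oneP (X^ 1 ^ₚ e)) (S.+-congˡ {S.1#} (S.-‿cong (coeff-^ (X^ 1) e)))

nat≈const : ∀ Φ k → C.nat Φ k ≈ const (ℤ.+ k)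
nat≈const Φ zero    zero    = ≡.refl
nat≈const Φ zero    (suc i) = ≡.refl
nat≈const Φ (suc k) i       = ≡.trans (coeff-⊕ oneP (C.nat Φ k) i) (≡.trans (≡.cong₂ ℤ._+_ (≡.refl {x = coeff oneP i}) (nat≈const Φ k i)) (go i))
  where
  go : ∀ i → coeff oneP i ℤ.+ coeff (const (ℤ.+ k)) i ≡ coeff (const (ℤ.+ suc k)) i
  go zero    = ≡.refl
  go (suc i) = ≡.refl

-- Among power series q^g - 1 is a unit, so the cancellation takes place there.
q^-1-cancel : ∀ {p r} g → 0 ℕ.< g → (X^ 1 ^ₚ g P.- P.1#) ⊗ p ≈ (X^ 1 ^ₚ g P.- P.1#) ⊗ r → p ≈ r
q^-1-cancel {p} {r} g 0<g eq = unit-cancel {q ^ g S.- S.1#} {S.- inv g} {coeff p} {coeff r}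
  (S.trans (S.*-congʳ {S.- inv g} (flip g)) (S.trans (S.sym (-‿distribˡ-* (1-q^ g) (S.- inv g)))
    (S.trans (S.-‿cong (S.sym (-‿distribʳ-* (1-q^ g) (inv g)))) (S.trans (-‿involutive _) (inverse g 0<g)))))
  (S.trans (S.sym (image p)) (S.trans eq (image r)))
  where
  open Algebra.Properties.Ring S.ring using (-‿distribˡ-*; -‿distribʳ-*; -‿involutive)
  flip : ∀ g → q ^ g S.- S.1# ≐ S.- (1-q^ g)
  flip g i = ≡.trans (ℤ.+-comm ((q ^ g) i) (ℤ.- coeff oneP i)) (≡.sym (≡.trans (ℤ.neg-distrib-+ (coeff oneP i) (ℤ.- (q ^ g) i))
    (≡.cong₂ ℤ._+_ (≡.refl {x = ℤ.- coeff oneP i}) (ℤ.neg-involutive ((q ^ g) i)))))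
  image : ∀ p → coeff ((X^ 1 ^ₚ g P.- P.1#) ⊗ p) ≐ (q ^ g S.- S.1#) ⊛ coeff p
  image p = S.trans (coeff-⊗ (X^ 1 ^ₚ g P.- P.1#) p) (S.*-congʳ {coeff p}
    (S.trans (coeff-⊖ (X^ 1 ^ₚ g) oneP) (S.+-congʳ {S.- S.1#} (coeff-^ (X^ 1) g))))

divProd≡ : ∀ Φ m e → divProd Φ m e ≡ C.divisorProduct Φ m e
divProd≡ Φ m zero    = ≡.refl
divProd≡ Φ m (suc e) = ≡.cong (λ p → if does (suc e ∣? m) then Φ (suc e) ⊗ p else p) (divProd≡ Φ m e)

module Congruence (Φ : ℕ → Poly) (isCyclotomic : IsCyclotomic Φ) where

  divisorProduct≈ : ∀ m → 0 ℕ.< m → C.divisorProduct Φ m m ≈ X^ 1 ^ₚ m P.- P.1#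
  divisorProduct≈ m 0<m i = ≡.trans (≡.cong (λ p → coeff p i) (≡.sym (divProd≡ Φ m m)))
    (≡.trans (isCyclotomic m 0<m i) (S.trans (coeff-⊖ (X^ m) oneP) (S.trans (S.+-congʳ {S.- S.1#}
      (S.trans (coeff-X^ m) (S.sym (coeff-^ (X^ 1) m)))) (S.sym (coeff-⊖ (X^ 1 ^ₚ m) oneP))) i))

  NonzeroConst-nat : ∀ m → NonzeroConst (C.nat Φ (suc m))
  NonzeroConst-nat m = ℤ.+ suc m , (λ ()) , nat≈const Φ (suc m)

  modulus-coprime : ∀ m e → ¬ (suc (2 ℕ.* m) ∣ e) → Coprime (P.1# P.- X^ 1 ^ₚ e) (modulus Φ (suc (2 ℕ.* m)))
  modulus-coprime = C.modulus-coprime Φ NonzeroConst-1 NonzeroConst-nat (λ {p} {r} → q^-1-cancel {p} {r}) divisorProduct≈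
    negArg (λ {p} {r} → negArg-cong {p} {r}) negArg-⊕ negArg-⊗ negArg-⊝ (λ { zero → ≡.refl ; (suc i) → ≡.refl }) negArg-X
    (λ {p} → NonzeroConst-negArg {p})

  modulus-∣ : ∀ m → let n = suc (2 ℕ.* m) ; u = P.1# P.- X^ 1 ^ₚ n ; v = P.1# P.+ X^ 1 ^ₚ n in
    ∃ λ r → u ⊗ u ⊗ (v ⊗ v ⊗ v) ≈ modulus Φ n ⊗ r
  modulus-∣ = C.modulus-∣ Φ NonzeroConst-1 NonzeroConst-nat (λ {p} {r} → q^-1-cancel {p} {r}) divisorProduct≈
    negArg (λ {p} {r} → negArg-cong {p} {r}) negArg-⊕ negArg-⊗ negArg-⊝ (λ { zero → ≡.refl ; (suc i) → ≡.refl }) negArg-X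
    (λ {p} → NonzeroConst-negArg {p})

-- Fractions with denominator coprime to the modulus

module Localised (M : Poly) where

  -- f is the power series of the fraction A / B. Taking the series as the element makes equal
  -- fractions equal without reducing them.
  O : Series → Set
  O f = ∃ λ B → ∃ λ A → Coprime B M × coeff B ⊛ f ≐ coeff A

  coprime-oneP : Coprime oneP M
  coprime-oneP = coprime-1 NonzeroConst-1 {M}

  poly∈O : ∀ p → O (coeff p)
  poly∈O p = oneP , p , coprime-oneP , ⊛-identityˡ (coeff p)

  isSubring : IsSubring seriesRing O
  isSubring = record
    { resp     = λ { f≐g (B , A , cop , eq) → B , A , cop , S.trans (S.*-congˡ {coeff B} (S.sym f≐g)) eq }
    ; 1-closed = poly∈O oneP
    ; +-closed = λ { {f} {g} (B , A , cop , p) (B′ , A′ , cop′ , r) → B ⊗ B′ , A ⊗ B′ ⊕ A′ ⊗ B , coprime-*ˡ {B} {B′} {M} cop cop′ ,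
        S.trans (S.*-congʳ {f S.+ g} (coeff-⊗ B B′))
          (S.trans (sum-integral {coeff B} {coeff A} {coeff B′} {coeff A′} {f} {g} p r)
            (S.sym (S.trans (coeff-⊕ (A ⊗ B′) (A′ ⊗ B)) (S.+-cong (coeff-⊗ A B′) (coeff-⊗ A′ B))))) }
    ; *-closed = λ { {f} {g} (B , A , cop , p) (B′ , A′ , cop′ , r) → B ⊗ B′ , A ⊗ A′ , coprime-*ˡ {B} {B′} {M} cop cop′ ,
        S.trans (S.*-congʳ {f ⊛ g} (coeff-⊗ B B′))
          (S.trans (product-integral {coeff B} {coeff A} {coeff B′} {coeff A′} {f} {g} p r) (S.sym (coeff-⊗ A A′))) }
    ; -‿closed = λ { {f} (B , A , cop , p) → B , ⊝ A , cop ,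
        S.trans (S.sym (-‿distribʳ-* (coeff B) f)) (S.trans (S.-‿cong p) (S.sym (coeff-⊝ A))) }
    }
    where open Algebra.Properties.Ring S.ring using (-‿distribʳ-*)

  -- The cofactor o is A / B, so multiplying f - g = M U o by B and by both denominators gives the
  -- required relation with U A; the Bezout relation for B is the one stored in O.
  congMod : ∀ x y {f g m} U → x ↝ f → y ↝ g → m ≐ coeff (M ⊗ U) → Ideals._≡_[_] seriesRing O isSubring f g m → CongMod x y M
  congMod (N₁ , D₁) (N₂ , D₂) {f} {g} {m} U x↝f y↝g m≐ (o , (B , A , (s , t , z , (w , w≢0 , z≈) , cop) , Bo) , f-g) =
    U ⊗ A , B , (s , t , w , w≢0 , S.trans cop z≈) ,
    S.trans (S.trans (coeff-⊗ (N₁ ⊗ D₂ ⊖ N₂ ⊗ D₁) B) (S.*-congʳ {coeff B}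
        (S.trans (coeff-⊖ (N₁ ⊗ D₂) (N₂ ⊗ D₁)) (S.+-cong (coeff-⊗ N₁ D₂) (S.-‿cong (coeff-⊗ N₂ D₁))))))
      (S.trans (difference-of-fractions {d₁ = coeff D₁} {d₂ = coeff D₂} {f} {g} {m} {o} {coeff B} {coeff A} {coeff M} {coeff U}
          x↝f y↝g f-g (S.trans m≐ (coeff-⊗ M U)) Bo)
        (S.sym (S.trans (coeff-⊗ (M ⊗ (U ⊗ A) ⊗ D₁) D₂) (S.*-congʳ {coeff D₂}
          (S.trans (coeff-⊗ (M ⊗ (U ⊗ A)) D₁) (S.*-congʳ {coeff D₁}
            (S.trans (coeff-⊗ M (U ⊗ A)) (S.*-congˡ {coeff M} (coeff-⊗ U A)))))))))

-- The two sides of the theorem as series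

module Representation (O : Series → Set) (isSubring : IsSubring seriesRing O) (d N : ℕ) (3≤d : 3 ℕ.≤ d) where
  module T = TruncatedSum seriesRing O isSubring q inv d N

  coeff-1+X^ : ∀ e → coeff (oneP ⊕ X^ e) ≐ S.1# S.+ q ^ e
  coeff-1+X^ e = S.trans (coeff-⊕ oneP (X^ e)) (S.+-congˡ {S.1#} (coeff-X^ e))

  coeff-qPoch^ : ∀ e k j → coeff (qPoch e (2 ℕ.* d) k ^P j) ≐ T.qPochhammer inverse 3≤d e k ^ j
  coeff-qPoch^ e k j = S.trans (coeff-^P (qPoch e (2 ℕ.* d) k) j) (^-congˡ j (coeff-qPoch e (2 ℕ.* d) k))

  cq↝c : ∀ k → cq d k ↝ T.c k
  cq↝c k = S.trans (coeff-signPow k ((oneP ⊕ X^ e) ⊗ (p ^P 3) ⊗ X^ e′)) (S.trans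
    (S.*-congˡ {(S.- S.1#) ^ k} (S.trans (coeff-⊗ ((oneP ⊕ X^ e) ⊗ (p ^P 3)) (X^ e′))
      (S.*-cong (S.trans (coeff-⊗ (oneP ⊕ X^ e) (p ^P 3)) (S.*-cong (coeff-1+X^ e) (coeff-qPoch^ 2 k 3))) (coeff-X^ e′))))
    (S.trans (T.c-fraction inverse 3≤d k)
      (S.*-congˡ {T.c k} (S.sym (S.trans (coeff-⊗ (oneP ⊕ X^ 1) (qPoch (2 ℕ.* d) (2 ℕ.* d) k ^P 3))
        (S.*-cong (coeff-1+X^ 1) (coeff-qPoch^ (2 ℕ.* d) k 3)))))))
    where
    e = 2 ℕ.* d ℕ.* k ℕ.+ 1
    e′ = d ℕ.* k ℕ.* k ℕ.+ 2 ℕ.* k ℕ.* (d ℕ.∸ 1)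
    p = qPoch 2 (2 ℕ.* d) k

  tq↝t : ∀ k → tq d k ↝ T.t k
  tq↝t k = S.trans (coeff-⊗ ((p ^P 2) ⊗ qPoch d (2 ℕ.* d) k) (X^ (2 ℕ.* (d ℕ.∸ 1) ℕ.* k))) (S.trans
    (S.*-cong (S.trans (coeff-⊗ (p ^P 2) (qPoch d (2 ℕ.* d) k)) (S.*-cong (coeff-qPoch^ 2 k 2) (coeff-qPoch d (2 ℕ.* d) k)))
      (coeff-X^ (2 ℕ.* (d ℕ.∸ 1) ℕ.* k)))
    (S.trans (T.t-fraction inverse 3≤d k)
      (S.*-congˡ {T.t k} (S.sym (S.trans (coeff-⊗ (p₁ ⊗ p₂) p₃) (S.*-cong (S.trans (coeff-⊗ p₁ p₂)
        (S.*-cong (coeff-qPoch (d ℕ.+ 1) (2 ℕ.* d) k) (coeff-qPoch (2 ℕ.* d) (2 ℕ.* d) k)))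
        (coeff-qPoch (2 ℕ.* d ℕ.+ 1) (2 ℕ.* d) k)))))))
    where
    p = qPoch 2 (2 ℕ.* d) k
    p₁ = qPoch (d ℕ.+ 1) (2 ℕ.* d) k
    p₂ = qPoch (2 ℕ.* d) (2 ℕ.* d) k
    p₃ = qPoch (2 ℕ.* d ℕ.+ 1) (2 ℕ.* d) k

  lhs↝tripleSum : ∀ n → lhs d n ↝ T.tripleSum n
  lhs↝tripleSum n = ↝-sumF n (λ i → ↝-sumF (n ℕ.∸ i) (λ j → ↝-sumF (n ℕ.∸ i ℕ.∸ j) (λ s →
    ↝-* {cq d i *F cq d j} {cq d s} {T.c i ⊛ T.c j} {T.c s}
      (↝-* {cq d i} {cq d j} {T.c i} {T.c j} (cq↝c i) (cq↝c j)) (cq↝c s))))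

  ↝-resp : ∀ x {f g} → f ≐ g → x ↝ f → x ↝ g
  ↝-resp (a , b) f≐g p = S.trans p (S.*-congʳ {coeff b} f≐g)

  -- `rhs` in the statement cubes the prefactor and the sum separately, whereas the congruence
  -- concerns the cube of their product; `regroup` reconciles the two.
  rhs↝rhs³ : rhs d (suc (N ℕ.* d)) N ↝ T.rhs ⊛ T.rhs ⊛ T.rhs
  rhs↝rhs³ = ↝-resp (rhs d n N) (regroup u v) (↝-* {F} {cubeF G} {u ⊛ u ⊛ u} {v ⊛ v ⊛ v} F↝
      (↝-* {G *F G} {G} {v ⊛ v} {v} (↝-* {G} {G} {v} {v} G↝ G↝) G↝))
    where
    n = suc (N ℕ.* d)
    e = 3 ℕ.* N ℕ.* (n ℕ.+ 1 ℕ.∸ d)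
    u = T.[n] ⊛ ((S.- T.a) ^ N ⊛ T.Q^tri N)
    v = Σ< T.t (suc N)
    F G : Frac
    F = signPow (3 ℕ.* N) · ((qint2 n ^P 3) ⊗ X^ e) , oneP
    G = sumF (tq d) (suc N)
    G↝ : G ↝ v
    G↝ = ↝-sumF (suc N) tq↝t
    F↝ : F ↝ u ⊛ u ⊛ u
    F↝ = S.trans (coeff-signPow (3 ℕ.* N) ((qint2 n ^P 3) ⊗ X^ e)) (S.trans
      (S.*-congˡ {(S.- S.1#) ^ (3 ℕ.* N)} (S.trans (coeff-⊗ (qint2 n ^P 3) (X^ e))
        (S.*-cong (S.trans (coeff-^P (qint2 n) 3) (^-congˡ 3 (coeff-qint2 n))) (coeff-X^ e))))
      (S.trans (T.prefactor-cube inverse 3≤d) (S.sym (S.*-identityʳ (u ⊛ u ⊛ u)))))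
    open IntegerCoefficients seriesRing
    regroup : ∀ u v → u ⊛ u ⊛ u ⊛ (v ⊛ v ⊛ v) ≐ u ⊛ v ⊛ (u ⊛ v) ⊛ (u ⊛ v)
    regroup u v = solve 2 (λ u v → u :* u :* u :* (v :* v :* v) := u :* v :* (u :* v) :* (u :* v)) S.refl u v

open import Data.Nat using (_≤_; _∸_)

theorem5p1 : (Φ : ℕ → Poly) → IsCyclotomic Φ →
    (n d : ℕ) → 1 ≤ n → ¬ (2 ∣ n) → 3 ≤ d → (h : d ∣ n ∸ 1) →
    CongMod (lhs d n) (rhs d n (_∣_.quotient h)) (modulus Φ n)
theorem5p1 Φ isCyclotomic (suc _) d 1≤n 2∤n 3≤d (divides N ≡.refl) with parity (suc (N ℕ.* d))
... | m , inj₁ n-even = contradiction (divides m (≡.trans n-even (ℕ.*-comm 2 m))) 2∤n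
... | m , inj₂ n-odd  = congMod (lhs d n) (rhs d n N) (proj₁ factor) (lhs↝tripleSum n) rhs↝rhs³ factor≐ (congruent N ≡.refl)
  where
  n = suc (N ℕ.* d)
  open Congruence Φ isCyclotomic
  open Localised (modulus Φ n)
  open Representation O isSubring d N 3≤d
  open Ideals seriesRing O isSubring using (_≡_[_]; ≡[]-reflexive)

  U V : Poly
  U = P.1# P.- X^ 1 ^ₚ n
  V = P.1# P.+ X^ 1 ^ₚ n

  factor : ∃ λ r → U ⊗ U ⊗ (V ⊗ V ⊗ V) ≈ modulus Φ n ⊗ r
  -- The cyclotomic lemmas speak of 2 m + 1, whereas n is 1 + N d; the equation between the two is
  -- substituted.
  factor = ≡.subst (λ n → let u = P.1# P.- X^ 1 ^ₚ n ; v = P.1# P.+ X^ 1 ^ₚ n in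
    ∃ λ r → u ⊗ u ⊗ (v ⊗ v ⊗ v) ≈ modulus Φ n ⊗ r) (≡.sym n-odd) (modulus-∣ m)

  1+q^n : Series
  1+q^n = S.1# S.+ q ^ n

  multiple : Series
  multiple = 1-q^ n ⊛ 1-q^ n ⊛ (1+q^n ⊛ 1+q^n ⊛ 1+q^n)

  factor≐ : multiple ≐ coeff (modulus Φ n ⊗ proj₁ factor)
  factor≐ = S.trans (S.sym (S.trans (coeff-⊗ (U ⊗ U) (V ⊗ V ⊗ V))
      (S.*-cong (S.trans (coeff-⊗ U U) (S.*-cong (coeff-1-q^ n) (coeff-1-q^ n)))
        (S.trans (coeff-⊗ (V ⊗ V) V) (S.*-cong (S.trans (coeff-⊗ V V) (S.*-cong V≐ V≐)) V≐)))))
    (proj₂ factor)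
    where
    V≐ : coeff V ≐ 1+q^n
    V≐ = S.trans (coeff-⊕ oneP (X^ 1 ^ₚ n)) (S.+-congˡ {S.1#} (coeff-^ (X^ 1) n))

  inv∈O : ∀ e → ¬ (n ∣ e) → O (inv e)
  inv∈O e n∤e = P.1# P.- X^ 1 ^ₚ e , oneP ,
    ≡.subst (λ n → ¬ (n ∣ e) → Coprime (P.1# P.- X^ 1 ^ₚ e) (modulus Φ n)) (≡.sym n-odd) (modulus-coprime m e) n∤e ,
    -- Here e = 0 cannot occur, because n divides 0.
    S.trans (S.*-congʳ {inv e} (coeff-1-q^ e)) (inverse e (ℕ.n≢0⇒n>0 (λ { ≡.refl → n∤e (n ∣0) })))

  -- N also occurs in the modules opened above, so the case distinction is made on a copy k.
  congruent : ∀ k → N ≡ k → T.tripleSum n ≡ T.rhs ⊛ T.rhs ⊛ T.rhs [ multiple ]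
  congruent zero    N≡0    = ≡[]-reflexive (T.base-case inverse 3≤d N≡0)
  congruent (suc _) ≡.refl = T.triple≡rhs³ inverse 3≤d (s≤s z≤n) 2∤n (poly∈O (X^ 1)) inv∈O
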